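{- Let $n\ge2$. The theory $T_n^1$ is complete, and thus (up to deductive closure) $T_n^1=\operatorname{Th}(\mathfrak T_{\omega^\omega}^{n,1-qe})$. The set of its $\mathcal L_n^{\mathrm{rel}}$-consequences is $\operatorname{Th}(\mathfrak T_{\omega^\omega}^{n,\mathrm{rel}})$; under the definitional equivalence between the functions $S_i$ and their graphs $E_i$, this theory corresponds exactly to $\operatorname{Th}(\mathfrak T_{\omega^\omega}^n)$.
   Context: Trees. $\mathfrak T_{\omega^\omega}^n=(n^{<\omega^\omega},\subseteq,S_0,\dots,S_{n-1})$, where $n^{<\omega^\omega}$ is the set of all functions $s:\beta\to n=\{0,\dots,n-1\}$ with $\beta<\omega^\omega$, $\subseteq$ is inclusion, and $S_i(s)$ is $s$ extended by one further entry $i$. $\mathfrak T_{\omega^\omega}^{n,\mathrm{rel}}$ is the same tree in the language $\mathcal L_n^{\mathrm{rel}}=\{\subseteq,E_0,\dots,E_{n-1}\}$ with $E_i(x,y)\Leftrightarrow y=S_i(x)$. Colored ordinals. An $n$-colored ordinal is a structure $(A,<,C_0,\dots,C_{n-1})$ with $(A,<)$ an ordinal and the $C_i$ partitioning $A$. $\equiv_q$ is agreement on first-order sentences of quantifier rank $\le q$. $\Sigma_n^+(q)$ is a finite set containing, for each $\equiv_q$-class of $n$-colored ordinals with a nonempty representative, exactly one characteristic sentence of rank $\le q$ defining that class among $n$-colored ordinals. Languages. $\mathcal L_n^\wedge=\mathcal L_n^{\mathrm{rel}}\cup\{\wedge,\epsilon\}$ ($\wedge$ a binary function, $\epsilon$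 a constant), $\mathcal L_n^{1-qe}=\mathcal L_n^\wedge\cup\{P_{q,\sigma}:q<\omega,\sigma\in\Sigma_n^+(q)\}$ ($P_{q,\sigma}$ binary). $x\subsetneq y$ abbreviates $x\subseteq y\wedge x\ne y$. For $\sigma\in\Sigma_n^+(q)$, $\varphi_\sigma(x,y)$ is the $\mathcal L_n^{\mathrm{rel}}$-formula obtained from $\sigma$ by restricting quantifiers to $\{z:x\subseteq z\subsetneq y\}$, replacing the order by $\subsetneq$, and replacing $C_i(z)$ by $\exists u(E_i(z,u)\wedge u\subseteq y)$. $\mathfrak T_{\omega^\omega}^{n,1-qe}$ is the expansion of $\mathfrak T_{\omega^\omega}^{n,\mathrm{rel}}$ in which $\epsilon$ is the empty sequence, $\wedge$ is the longest common initial segment, and $P_{q,\sigma}(x,y)$ holds iff $x\subsetneq y$ and $\varphi_\sigma(x,y)$. Theory $T_n^1$ in $\mathcal L_n^{1-qe}$ (universal closures of): (A1) $\subseteq$ is a partial order with least element $\epsilon$, the predecessors of any element are linearly ordered, and $x\wedge y$ is the greatest common predecessor of $x,y$. (A2) $\forall x\exists!y\,E_i(x,y)$; $E_i(x,y)\to x\subsetneq y\wedge\neg\exists z(x\subsetneq z\subsetneq y)$; and for $i\ne j$, $E_i(x,y)\wedge E_j(x,z)\to y\ne z$. (A3) $x\subsetneq y\to\bigvee_{i<n}\exists z(E_i(x,z)\wedge z\subseteq y)$. (A4) $P_{q,\sigma}(x,y)\leftrightarrow x\subsetneq y\wedge\varphi_\sigma(x,y)$, for all $q<\omega$, $\sigma\in\Sigma_n^+(q)$.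 (A5) $x\subsetneq y\to\bigvee_{\sigma\in\Sigma_n^+(q)}P_{q,\sigma}(x,y)$, for all $q<\omega$. (Realization) $\forall x\exists y\,P_{q,\sigma}(x,y)$, for all $q<\omega$, $\sigma\in\Sigma_n^+(q)$.
   Formalization: Each characteristic sentence in Σ_n^+(q) is required to define its ≡_q-class among all structures of the colored-order language, not only among n-colored ordinals; otherwise adding the disjunct "of no colored-ordinal type" makes A5 vacuous and T_n^1 incomplete. -}

module Defs where

open import Axiom.ExcludedMiddle using (ExcludedMiddle)
open import Data.Empty using (⊥; ⊥-elim)
open import Data.Fin.Base using (Fin; zero; suc; _↑ˡ_; _↑ʳ_)
open import Data.Fin.Patterns using (0F; 1F; 2F)
open import Data.List.Base using (List; []; _∷_; _∷ʳ_)
open import Data.List.Relation.Binary.Lex.Strict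
  using (Lex-<; base; halt; this; next; <-compare; <-transitive; <-decidable)
open import Data.List.Relation.Binary.Pointwise using (Pointwise-≡⇒≡)
open import Data.List.Relation.Unary.Linked as Linked using (Linked; []; [-]; _∷_)
open import Data.Nat.Base as ℕ using (ℕ; zero; suc; _+_; _≥_; z≤n)
open import Data.Nat.Induction using (<-rec)
import Data.Nat.Properties as ℕ
open import Data.Product using (Σ; Σ-syntax; ∃; ∃-syntax; ∃!; _×_; _,_; proj₁; proj₂; swap)
open import Data.Sum.Base using (_⊎_; inj₁; inj₂)
open import Data.Vec.Functional as Vector using (Vector) renaming ([] to ⟨⟩; _∷_ to _◂_)
open import Function.Base using (_∘_)
open import Function.Bundles using (_⇔_)
open import Induction.WellFounded using (WellFounded; Acc; acc)
open import Level using (Level; 0ℓ)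
open import Relation.Binary.Core using (Rel)
open import Relation.Binary.Definitions using (tri<; tri≈; tri>; Decidable; Trichotomous; Transitive)
open import Relation.Binary.PropositionalEquality
  using (_≡_; _≢_; refl; sym; trans; subst; isEquivalence; resp₂)
open import Relation.Binary.Structures using (IsEquivalence; IsStrictTotalOrder)
open import Relation.Nullary using (¬_; Dec; yes; no; contradiction; recompute)
open import Relation.Unary using (Pred; _∪_)

private
  variable
    k n : ℕ
    ℓ ℓ′ : Level


------------------------------------------------------------------------
-- First-order logic

record Language : Set₁ where
  field
    Func : ℕ → Set
    Pr   : ℕ → Set

open Language

data Term (L : Language) (k : ℕ) : Set where
  var : Fin k → Term L k
  app : ∀ {a} → Func L a → Vector (Term L k) a → Term L k

infix  7 _≐_
infixr 5 _∧′_
infixr 4 _∨′_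
infixr 3 _⇒′_

-- De Bruijn indices: a quantifier binds variable 0 of its body.
data Formula (L : Language) (k : ℕ) : Set where
  atom : ∀ {a} → Pr L a → Vector (Term L k) a → Formula L k
  _≐_  : Term L k → Term L k → Formula L k
  ⊥′   : Formula L k
  _∧′_ _∨′_ _⇒′_ : Formula L k → Formula L k → Formula L k
  ∀′ ∃′ : Formula L (suc k) → Formula L k

Sentence : Language → Set
Sentence L = Formula L 0

module _ {L : Language} where

  infix 6 ¬′_
  infix 2 _⇔′_

  ¬′_ : Formula L k → Formula L k
  ¬′ φ = φ ⇒′ ⊥′

  _⇔′_ : Formula L k → Formula L k → Formula L k
  φ ⇔′ ψ = (φ ⇒′ ψ) ∧′ (ψ ⇒′ φ)

  ⋁ : ∀ {m} → Vector (Formula L k) m → Formula L k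
  ⋁ = Vector.foldr _∨′_ ⊥′

  closure : Formula L k → Sentence L
  closure {k = zero}  φ = φ
  closure {k = suc k} φ = closure (∀′ φ)

  rank : Formula L k → ℕ
  rank (atom _ _) = 0
  rank (_ ≐ _)    = 0
  rank ⊥′         = 0
  rank (φ ∧′ ψ)   = rank φ ℕ.⊔ rank ψ
  rank (φ ∨′ ψ)   = rank φ ℕ.⊔ rank ψ
  rank (φ ⇒′ ψ)   = rank φ ℕ.⊔ rank ψ
  rank (∀′ φ)     = suc (rank φ)
  rank (∃′ φ)     = suc (rank φ)

-- Carriers are setoids: the equality symbol is interpreted by _≈_, which
-- plays the role of identity.  Empty carriers are allowed.
record Structure (L : Language) : Set₁ where
  infix 4 _≈_
  field
    Carrier       : Set
    _≈_           : Rel Carrier 0ℓ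
    ≈-equivalence : IsEquivalence _≈_
    func          : ∀ {a} → Func L a → Vector Carrier a → Carrier
    pr            : ∀ {a} → Pr L a → Vector Carrier a → Set
    func-cong     : ∀ {a} (f : Func L a) {xs ys : Vector Carrier a} →
                    (∀ i → xs i ≈ ys i) → func f xs ≈ func f ys
    pr-cong       : ∀ {a} (r : Pr L a) {xs ys : Vector Carrier a} →
                    (∀ i → xs i ≈ ys i) → pr r xs → pr r ys

  module ≈ = IsEquivalence ≈-equivalence

module _ {L : Language} (M : Structure L) where
  open Structure M

  eval : Vector Carrier k → Term L k → Carrier
  eval ρ (var i)    = ρ i
  eval ρ (app f ts) = func f (λ i → eval ρ (ts i))

  Sat : Vector Carrier k → Formula L k → Set
  Sat ρ (atom r ts) = pr r (λ i → eval ρ (ts i))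
  Sat ρ (s ≐ t)     = eval ρ s ≈ eval ρ t
  Sat ρ ⊥′          = ⊥
  Sat ρ (φ ∧′ ψ)    = Sat ρ φ × Sat ρ ψ
  Sat ρ (φ ∨′ ψ)    = Sat ρ φ ⊎ Sat ρ ψ
  Sat ρ (φ ⇒′ ψ)    = Sat ρ φ → Sat ρ ψ
  Sat ρ (∀′ φ)      = ∀ a → Sat (a ◂ ρ) φ
  Sat ρ (∃′ φ)      = ∃[ a ] Sat (a ◂ ρ) φ

  Th : Pred (Sentence L) 0ℓ
  Th φ = Sat ⟨⟩ φ

  eval-cong : {ρ τ : Vector Carrier k} → (∀ i → ρ i ≈ τ i) →
              ∀ t → eval ρ t ≈ eval τ t
  eval-cong e (var i)    = e i
  eval-cong e (app f ts) = func-cong f (λ i → eval-cong e (ts i))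

  private
    ◂-cong : ∀ {a} {ρ τ : Vector Carrier k} → (∀ i → ρ i ≈ τ i) →
             ∀ i → (a ◂ ρ) i ≈ (a ◂ τ) i
    ◂-cong e zero    = ≈.refl
    ◂-cong e (suc i) = e i

  Sat-cong : {ρ τ : Vector Carrier k} → (∀ i → ρ i ≈ τ i) →
             ∀ φ → Sat ρ φ → Sat τ φ
  Sat-cong e (atom r ts) p        = pr-cong r (λ i → eval-cong e (ts i)) p
  Sat-cong e (s ≐ t)     p        =
    ≈.trans (≈.sym (eval-cong e s)) (≈.trans p (eval-cong e t))
  Sat-cong e (φ ∧′ ψ)    (p , p′) = Sat-cong e φ p , Sat-cong e ψ p′
  Sat-cong e (φ ∨′ ψ)    (inj₁ p) = inj₁ (Sat-cong e φ p)
  Sat-cong e (φ ∨′ ψ)    (inj₂ p) = inj₂ (Sat-cong e ψ p)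
  Sat-cong e (φ ⇒′ ψ)    f p      = Sat-cong e ψ (f (Sat-cong (≈.sym ∘ e) φ p))
  Sat-cong e (∀′ φ)      f a      = Sat-cong (◂-cong e) φ (f a)
  Sat-cong e (∃′ φ)      (a , p)  = a , Sat-cong (◂-cong e) φ p

infix 4 _⊨_ _⊩_

_⊨_ : {L : Language} → Structure L → Sentence L → Set
M ⊨ φ = Th M φ

_⊩_ : {L : Language} → Pred (Sentence L) ℓ → Sentence L → Set _
T ⊩ φ = ∀ M → (∀ ψ → T ψ → M ⊨ ψ) → M ⊨ φ

Complete : {L : Language} → Pred (Sentence L) ℓ → Set _
Complete T = ¬ (T ⊩ ⊥′) × (∀ φ → (T ⊩ φ) ⊎ (T ⊩ ¬′ φ))

infix 4 _≡[_]_
_≡[_]_ : {L : Language} → Structure L → ℕ → Structure L → Set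
M ≡[ q ] N = ∀ φ → rank φ ℕ.≤ q → (M ⊨ φ) ⇔ (N ⊨ φ)

record _↪_ (L L′ : Language) : Set where
  field
    onFunc : ∀ {a} → Func L a → Func L′ a
    onPr   : ∀ {a} → Pr L a → Pr L′ a

module _ {L L′ : Language} (h : L ↪ L′) where
  open _↪_ h

  embedᵗ : Term L k → Term L′ k
  embedᵗ (var i)    = var i
  embedᵗ (app f ts) = app (onFunc f) (λ i → embedᵗ (ts i))

  embed : Formula L k → Formula L′ k
  embed (atom r ts) = atom (onPr r) (λ i → embedᵗ (ts i))
  embed (s ≐ t)     = embedᵗ s ≐ embedᵗ t
  embed ⊥′          = ⊥′
  embed (φ ∧′ ψ)    = embed φ ∧′ embed ψ
  embed (φ ∨′ ψ)    = embed φ ∨′ embed ψ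
  embed (φ ⇒′ ψ)    = embed φ ⇒′ embed ψ
  embed (∀′ φ)      = ∀′ (embed φ)
  embed (∃′ φ)      = ∃′ (embed φ)

  -- The L-consequences of an L′-theory.
  restrict : Pred (Sentence L′) ℓ → Pred (Sentence L) _
  restrict T φ = T ⊩ embed φ

  image : Pred (Sentence L) ℓ → Pred (Sentence L′) ℓ
  image T χ = ∃[ φ ] T φ × embed φ ≡ χ

------------------------------------------------------------------------
-- Languages of trees

data NoSymbol : ℕ → Set where

data RelPr (n : ℕ) : ℕ → Set where
  sub  : RelPr n 2
  edge : Fin n → RelPr n 2

data SubPr : ℕ → Set where
  sub : SubPr 2

data SuccFunc (n : ℕ) : ℕ → Set where
  succ : Fin n → SuccFunc n 1

ℒ-rel : ℕ → Language
ℒ-rel n = record { Func = NoSymbol ; Pr = RelPr n }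

ℒ-fun : ℕ → Language
ℒ-fun n = record { Func = SuccFunc n ; Pr = SubPr }

ℒ-common : ℕ → Language
ℒ-common n = record { Func = SuccFunc n ; Pr = RelPr n }

rel↪common : ℒ-rel n ↪ ℒ-common n
rel↪common = record { onFunc = λ () ; onPr = λ r → r }

fun↪common : ℒ-fun n ↪ ℒ-common n
fun↪common = record { onFunc = λ f → f ; onPr = λ { sub → sub } }

------------------------------------------------------------------------
-- Colored ordinals

data ColPr (n : ℕ) : ℕ → Set where
  lt  : ColPr n 2
  col : Fin n → ColPr n 1

ℒ-col : ℕ → Language
ℒ-col n = record { Func = NoSymbol ; Pr = ColPr n }

-- Ordinals are taken up to isomorphism, as well-orders.  A color class may
-- be empty.
record IsColoredOrdinal {n} (A : Structure (ℒ-col n)) : Set where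
  open Structure A
  _<_ : Rel Carrier 0ℓ
  x < y = pr lt (x ◂ y ◂ ⟨⟩)
  field
    isStrictTotalOrder : IsStrictTotalOrder _≈_ _<_
    wellFounded        : WellFounded _<_
    uniqueColor        : ∀ x → ∃! _≡_ (λ i → pr (col i) (x ◂ ⟨⟩))

IsNonemptyColoredOrdinal : Structure (ℒ-col n) → Set
IsNonemptyColoredOrdinal A = IsColoredOrdinal A × Structure.Carrier A

-- σ is a characteristic sentence of A for rank q: it axiomatizes the
-- ≡[ q ]-class of A among all structures, not only among colored ordinals.
IsCharacteristic : ℕ → Structure (ℒ-col n) → Sentence (ℒ-col n) → Set₁
IsCharacteristic q A σ = rank σ ℕ.≤ q × (∀ B → (B ⊨ σ) ⇔ (B ≡[ q ] A))

-- A choice of the finite sets Σₙ⁺(q), each given as an enumeration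
-- indexed by Fin (size q).
record CharacteristicSystem (n : ℕ) : Set₁ where
  field
    size           : ℕ → ℕ
    sentence       : ∀ q → Fin (size q) → Sentence (ℒ-col n)
    characteristic : ∀ q i → Σ[ A ∈ Structure (ℒ-col n) ]
                     IsNonemptyColoredOrdinal A × IsCharacteristic q A (sentence q i)
    exactlyOne     : ∀ q A → IsNonemptyColoredOrdinal A →
                     ∃! _≡_ (λ i → A ⊨ sentence q i)

open CharacteristicSystem

-- φ_σ(x , y).  The two parameters come after the k variables of the
-- original formula; for a sentence, x is variable 0 and y is variable 1.
module _ {n : ℕ} where

  private
    index : Term (ℒ-col n) k → Fin k
    index (var i) = i

    _⊆′_ _⊊′_ : Fin k → Fin k → Formula (ℒ-rel n) k
    i ⊆′ j = atom sub (var i ◂ var j ◂ ⟨⟩)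
    i ⊊′ j = (i ⊆′ j) ∧′ ¬′ (var i ≐ var j)

    within : Formula (ℒ-rel n) (suc k + 2)
    within {k = k} = (suc (k ↑ʳ 0F) ⊆′ 0F) ∧′ (0F ⊊′ suc (k ↑ʳ 1F))

  relativize : Formula (ℒ-col n) k → Formula (ℒ-rel n) (k + 2)
  relativize (atom lt ts) = (index (ts 0F) ↑ˡ 2) ⊊′ (index (ts 1F) ↑ˡ 2)
  relativize {k = k} (atom (col i) ts) =
    ∃′ (atom (edge i) (var (suc (index (ts 0F) ↑ˡ 2)) ◂ var 0F ◂ ⟨⟩)
        ∧′ (0F ⊆′ suc (k ↑ʳ 1F)))
  relativize (s ≐ t)   = var (index s ↑ˡ 2) ≐ var (index t ↑ˡ 2)
  relativize ⊥′        = ⊥′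
  relativize (φ ∧′ ψ)  = relativize φ ∧′ relativize ψ
  relativize (φ ∨′ ψ)  = relativize φ ∨′ relativize ψ
  relativize (φ ⇒′ ψ)  = relativize φ ⇒′ relativize ψ
  relativize {k = k} (∀′ φ) = ∀′ (within {k = k} ⇒′ relativize φ)
  relativize {k = k} (∃′ φ) = ∃′ (within {k = k} ∧′ relativize φ)

------------------------------------------------------------------------
-- The theory Tₙ¹

data MeetFunc : ℕ → Set where
  meet : MeetFunc 2
  root : MeetFunc 0

data QePr {n : ℕ} (S : CharacteristicSystem n) : ℕ → Set where
  rel : ∀ {a} → RelPr n a → QePr S a
  P   : ∀ q → Fin (size S q) → QePr S 2

ℒ-qe : CharacteristicSystem n → Language
ℒ-qe S = record { Func = MeetFunc ; Pr = QePr S }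

rel↪qe : {S : CharacteristicSystem n} → ℒ-rel n ↪ ℒ-qe S
rel↪qe = record { onFunc = λ () ; onPr = rel }

module _ {n : ℕ} (S : CharacteristicSystem n) where

  private
    infix 6 _⊑_ _⊏_
    infixr 8 _⋏_

    _⊑_ _⊏_ : Term (ℒ-qe S) k → Term (ℒ-qe S) k → Formula (ℒ-qe S) k
    s ⊑ t = atom (rel sub) (s ◂ t ◂ ⟨⟩)
    s ⊏ t = s ⊑ t ∧′ ¬′ (s ≐ t)

    E : Fin n → Term (ℒ-qe S) k → Term (ℒ-qe S) k → Formula (ℒ-qe S) k
    E i s t = atom (rel (edge i)) (s ◂ t ◂ ⟨⟩)

    P′ : ∀ q → Fin (size S q) → Term (ℒ-qe S) k → Term (ℒ-qe S) k → Formula (ℒ-qe S) k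
    P′ q i s t = atom (P q i) (s ◂ t ◂ ⟨⟩)

    _⋏_ : Term (ℒ-qe S) k → Term (ℒ-qe S) k → Term (ℒ-qe S) k
    s ⋏ t = app meet (s ◂ t ◂ ⟨⟩)

    ε : Term (ℒ-qe S) k
    ε = app root ⟨⟩

    v₀ : Term (ℒ-qe S) (1 + k)
    v₀ = var 0F

    v₁ : Term (ℒ-qe S) (2 + k)
    v₁ = var 1F

    v₂ : Term (ℒ-qe S) (3 + k)
    v₂ = var 2F

  -- In each axiom x, y, z are the variables 0, 1, 2, except below an inner
  -- quantifier, where they are shifted by one.
  data T¹ : Pred (Sentence (ℒ-qe S)) 0ℓ where
    ⊆-refl      : T¹ (closure {k = 1} (v₀ ⊑ v₀))
    ⊆-antisym   : T¹ (closure {k = 2} (v₀ ⊑ v₁ ∧′ v₁ ⊑ v₀ ⇒′ v₀ ≐ v₁))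
    ⊆-trans     : T¹ (closure {k = 3} (v₀ ⊑ v₁ ∧′ v₁ ⊑ v₂ ⇒′ v₀ ⊑ v₂))
    ε-least     : T¹ (closure {k = 1} (ε ⊑ v₀))
    pred-linear : T¹ (closure {k = 3} (v₀ ⊑ v₂ ∧′ v₁ ⊑ v₂ ⇒′ v₀ ⊑ v₁ ∨′ v₁ ⊑ v₀))
    meet-lower  : T¹ (closure {k = 2} (v₀ ⋏ v₁ ⊑ v₀ ∧′ v₀ ⋏ v₁ ⊑ v₁))
    meet-great  : T¹ (closure {k = 3} (v₂ ⊑ v₀ ∧′ v₂ ⊑ v₁ ⇒′ v₂ ⊑ v₀ ⋏ v₁))
    E-total     : ∀ i → T¹ (closure {k = 1}
                    (∃′ (E i v₁ v₀ ∧′ ∀′ (E i v₂ v₀ ⇒′ v₀ ≐ v₁))))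
    E-cover     : ∀ i → T¹ (closure {k = 2}
                    (E i v₀ v₁ ⇒′ v₀ ⊏ v₁ ∧′ ¬′ ∃′ (v₁ ⊏ v₀ ∧′ v₀ ⊏ v₂)))
    E-disjoint  : ∀ i j → i ≢ j → T¹ (closure {k = 3}
                    (E i v₀ v₁ ∧′ E j v₀ v₂ ⇒′ ¬′ (v₁ ≐ v₂)))
    branching   : T¹ (closure {k = 2}
                    (v₀ ⊏ v₁ ⇒′ ⋁ (λ i → ∃′ (E i v₁ v₀ ∧′ v₀ ⊑ v₂))))
    P-def       : ∀ q σ → T¹ (closure {k = 2}
                    (P′ q σ v₀ v₁ ⇔′ v₀ ⊏ v₁ ∧′ embed rel↪qe (relativize (sentence S q σ))))
    P-exhaust   : ∀ q → T¹ (closure {k = 2}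
                    (v₀ ⊏ v₁ ⇒′ ⋁ (λ σ → P′ q σ v₀ v₁)))
    realization : ∀ q σ → T¹ (closure {k = 1} (∃′ (P′ q σ v₁ v₀)))

------------------------------------------------------------------------
-- The ordinal ω^ω

-- Cantor normal form: the list a₁ ≥ a₂ ≥ ⋯ ≥ aₖ stands for
-- ω^a₁ + ω^a₂ + ⋯ + ω^aₖ, and the order is lexicographic.
record Ω : Set where
  constructor cnf
  field
    exponents   : List ℕ
    .descending : Linked _≥_ exponents

open Ω

infix 4 _<ᴸ_ _<Ω_ _<Ω?_

_<ᴸ_ : Rel (List ℕ) 0ℓ
_<ᴸ_ = Lex-< _≡_ ℕ._<_

_<Ω_ : Rel Ω 0ℓ
α <Ω β = exponents α <ᴸ exponents β

0Ω : Ω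
0Ω = cnf [] []

sucΩ : Ω → Ω
sucΩ (cnf as d) = cnf (as ∷ʳ 0) (descending-∷ʳ d)
  where
  descending-∷ʳ : ∀ {as} → Linked _≥_ as → Linked _≥_ (as ∷ʳ 0)
  descending-∷ʳ []      = [-]
  descending-∷ʳ [-]     = z≤n ∷ [-]
  descending-∷ʳ (r ∷ d) = r ∷ descending-∷ʳ d

_<Ω?_ : Decidable _<Ω_
α <Ω? β = <-decidable ℕ._≟_ ℕ._<?_ (exponents α) (exponents β)

<Ω-trans : Transitive _<Ω_
<Ω-trans = <-transitive isEquivalence (resp₂ ℕ._<_) ℕ.<-trans

<Ω-compare : Trichotomous _≡_ _<Ω_
<Ω-compare (cnf as _) (cnf bs _) with <-compare sym ℕ.<-cmp as bs
... | tri< p ¬e ¬q = tri< p (λ { refl → ¬q p }) ¬q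
... | tri> ¬p ¬e q = tri> ¬p (λ { refl → ¬p q }) q
... | tri≈ ¬p e ¬q with refl ← Pointwise-≡⇒≡ e = tri≈ ¬p refl ¬q

<Ω-irrefl : ∀ α → ¬ α <Ω α
<Ω-irrefl α p with <Ω-compare α α
... | tri< _ α≢α _ = α≢α refl
... | tri≈ ¬p _ _  = ¬p p
... | tri> ¬p _ _  = ¬p p

<Ω-wellFounded : WellFounded _<Ω_
<Ω-wellFounded (cnf [] _)       = acc λ { {cnf [] _} (base ()) ; {cnf (_ ∷ _) _} () }
<Ω-wellFounded (cnf (a ∷ as) d) = accessible a as d
  where
  Accessible : ℕ → Set
  Accessible a = ∀ as .(d : Linked _≥_ (a ∷ as)) → Acc _<Ω_ (cnf (a ∷ as) d)

  extend : ∀ a → (∀ {b} → b ℕ.< a → Accessible b) →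
           ∀ {as} .{d′} → Acc _<Ω_ (cnf as d′) →
           .(d : Linked _≥_ (a ∷ as)) → Acc _<Ω_ (cnf (a ∷ as) d)
  extend a below {as} (acc rs) d = acc (λ {β} → smaller β)
    where
    smaller : ∀ β → exponents β <ᴸ a ∷ as → Acc _<Ω_ β
    smaller (cnf [] _)       _             = <Ω-wellFounded (cnf [] [])
    smaller (cnf (b ∷ bs) e) (this b<a)    = below b<a bs e
    smaller (cnf (b ∷ bs) e) (next refl p) =
      extend a below (rs {cnf bs (Linked.tail e)} p) e

  step : ∀ a → (∀ {b} → b ℕ.< a → Accessible b) → Accessible a
  step a below []       d = extend a below (<Ω-wellFounded (cnf [] [])) d
  step a below (b ∷ bs) d = extend a below tail-acc d
    where
    b≤a : b ℕ.≤ a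
    b≤a = recompute (b ℕ.≤? a) (Linked.head d)

    tail-acc : Acc _<Ω_ (cnf (b ∷ bs) (Linked.tail d))
    tail-acc with ℕ.m≤n⇒m<n∨m≡n b≤a
    ... | inj₁ b<a  = below b<a bs (Linked.tail d)
    ... | inj₂ refl = step a below bs (Linked.tail d)

  accessible : ∀ a → Accessible a
  accessible = <-rec Accessible step

------------------------------------------------------------------------
-- Sequences of length less than ω^ω

record Node (n : ℕ) : Set where
  constructor node
  field
    len   : Ω
    entry : ∀ γ → .(γ <Ω len) → Fin n

open Node

infix 4 _⊆_ _≈ᴺ_ _⊊_

-- Inclusion of graphs.
record _⊆_ (s t : Node n) : Set where
  constructor incl
  field
    apply : ∀ γ (p : γ <Ω len s) → Σ[ q ∈ γ <Ω len t ] entry s γ p ≡ entry t γ q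

open _⊆_

_≈ᴺ_ : Rel (Node n) 0ℓ
s ≈ᴺ t = s ⊆ t × t ⊆ s

_⊊_ : Rel (Node n) 0ℓ
s ⊊ t = s ⊆ t × ¬ s ≈ᴺ t

empty : Node n
empty = node 0Ω λ γ p → ⊥-elim (none γ p)
  where
  none : ∀ γ → .(γ <Ω 0Ω) → ⊥
  none γ p with recompute (γ <Ω? 0Ω) p
  ... | base ()

append : Fin n → Node n → Node n
append i s = node (sucΩ (len s)) λ γ _ → value γ (γ <Ω? len s)
  where
  value : ∀ γ → Dec (γ <Ω len s) → Fin _
  value γ (yes p) = entry s γ p
  value γ (no _)  = i

⊆ᴺ-refl : {s : Node n} → s ⊆ s
⊆ᴺ-refl = incl λ γ p → p , refl

⊆ᴺ-trans : {s t u : Node n} → s ⊆ t → t ⊆ u → s ⊆ u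
⊆ᴺ-trans s⊆t t⊆u = incl λ γ p →
  let (q , e) = apply s⊆t γ p
      (r , f) = apply t⊆u γ q
  in r , trans e f

≈ᴺ-isEquivalence : IsEquivalence (_≈ᴺ_ {n})
≈ᴺ-isEquivalence = record
  { refl  = ⊆ᴺ-refl , ⊆ᴺ-refl
  ; sym   = swap
  ; trans = λ (p , p′) (q , q′) → ⊆ᴺ-trans p q , ⊆ᴺ-trans q′ p′
  }

private
  module N {n} = IsEquivalence (≈ᴺ-isEquivalence {n})

≈ᴺ⇒len≡ : {s t : Node n} → s ≈ᴺ t → len s ≡ len t
≈ᴺ⇒len≡ {s = s} {t} (s⊆t , t⊆s) with <Ω-compare (len s) (len t)
... | tri< p _ _ = contradiction (proj₁ (apply t⊆s (len s) p)) (<Ω-irrefl (len s))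
... | tri≈ _ e _ = e
... | tri> _ _ p = contradiction (proj₁ (apply s⊆t (len t) p)) (<Ω-irrefl (len t))

append-mono : ∀ i {s t : Node n} → s ≈ᴺ t → append i s ⊆ append i t
append-mono i {s} {t} e@(s⊆t , t⊆s) = incl λ γ p → longer γ p , same γ p
  where
  longer : ∀ γ → γ <Ω sucΩ (len s) → γ <Ω sucΩ (len t)
  longer γ p = subst (λ α → γ <Ω sucΩ α) (≈ᴺ⇒len≡ e) p

  same : ∀ γ (p : γ <Ω sucΩ (len s)) →
         entry (append i s) γ p ≡ entry (append i t) γ (longer γ p)
  same γ _ with γ <Ω? len s | γ <Ω? len t
  ... | yes p | yes _ = proj₂ (apply s⊆t γ p)
  ... | no _  | no _  = refl
  ... | yes p | no ¬q = contradiction (proj₁ (apply s⊆t γ p)) ¬q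
  ... | no ¬p | yes q = contradiction (proj₁ (apply t⊆s γ q)) ¬p

append-cong : ∀ i {s t : Node n} → s ≈ᴺ t → append i s ≈ᴺ append i t
append-cong i e = append-mono i e , append-mono i (swap e)

⊆-resp : {s s′ t t′ : Node n} → s ≈ᴺ s′ → t ≈ᴺ t′ → s ⊆ t → s′ ⊆ t′
⊆-resp e f p = ⊆ᴺ-trans (proj₂ e) (⊆ᴺ-trans p (proj₁ f))

------------------------------------------------------------------------
-- Longest common initial segment

Agree : Node n → Node n → Ω → Set
Agree s t γ = Σ[ p ∈ γ <Ω len s ] Σ[ q ∈ γ <Ω len t ] entry s γ p ≡ entry t γ q

module Meet (em : ExcludedMiddle 0ℓ) where

  private
    Least : (Ω → Set) → Ω → Set
    Least D γ = D γ × (∀ δ → δ <Ω γ → ¬ D δ)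

    least : (D : Ω → Set) → ∀ α → Acc _<Ω_ α → D α → ∃ (Least D)
    least D α (acc rs) d with em {Σ[ β ∈ Ω ] β <Ω α × D β}
    ... | yes (β , β<α , d′) = least D β (rs β<α) d′
    ... | no none            = α , d , λ δ δ<α d′ → none (δ , δ<α , d′)

  firstDisagreement : (s t : Node n) → ∃ (Least (λ γ → ¬ Agree s t γ))
  firstDisagreement s t =
    least _ (len s) (<Ω-wellFounded (len s)) (λ (p , _) → <Ω-irrefl (len s) p)

  private
    cut : Node n → Node n → Ω
    cut s t = proj₁ (firstDisagreement s t)

    agree : ∀ (s t : Node n) γ → γ <Ω cut s t → Agree s t γ
    agree s t γ p with em {Agree s t γ}
    ... | yes a = a
    ... | no ¬a = contradiction ¬a (proj₂ (proj₂ (firstDisagreement s t)) γ p)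

  infixr 7 _⊓_
  _⊓_ : Node n → Node n → Node n
  s ⊓ t = node (cut s t) λ γ p →
    entry s γ (proj₁ (agree s t γ p))

  ⊓-lowerˡ : (s t : Node n) → s ⊓ t ⊆ s
  ⊓-lowerˡ s t = incl λ γ p → proj₁ (agree s t γ p) , refl

  ⊓-lowerʳ : (s t : Node n) → s ⊓ t ⊆ t
  ⊓-lowerʳ s t = incl λ γ p → proj₂ (agree s t γ p)

  ⊓-greatest : {s t u : Node n} → u ⊆ s → u ⊆ t → u ⊆ s ⊓ t
  ⊓-greatest {s = s} {t} {u} u⊆s u⊆t = incl λ γ p → below γ p , proj₂ (apply u⊆s γ p)
    where
    agree-u : ∀ δ → δ <Ω len u → Agree s t δ
    agree-u δ r = proj₁ (apply u⊆s δ r) , proj₁ (apply u⊆t δ r) ,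
                  trans (sym (proj₂ (apply u⊆s δ r))) (proj₂ (apply u⊆t δ r))

    disagree : ¬ Agree s t (cut s t)
    disagree = proj₁ (proj₂ (firstDisagreement s t))

    below : ∀ γ → γ <Ω len u → γ <Ω cut s t
    below γ p with <Ω-compare γ (cut s t)
    ... | tri< γ<c _ _ = γ<c
    ... | tri≈ _ e _   = contradiction (subst (Agree s t) e (agree-u γ p)) disagree
    ... | tri> _ _ c<γ = contradiction (agree-u (cut s t) (<Ω-trans {cut s t} {γ} {len u} c<γ p)) disagree

  ⊓-mono : {s s′ t t′ : Node n} → s ⊆ s′ → t ⊆ t′ → s ⊓ t ⊆ s′ ⊓ t′
  ⊓-mono {s = s} {s′} {t} {t′} p q =
    ⊓-greatest (⊆ᴺ-trans (⊓-lowerˡ s t) p) (⊆ᴺ-trans (⊓-lowerʳ s t) q)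

------------------------------------------------------------------------
-- The trees

tree : ∀ n → Structure (ℒ-fun n)
tree n = record
  { Carrier       = Node n
  ; _≈_           = _≈ᴺ_
  ; ≈-equivalence = ≈ᴺ-isEquivalence
  ; func          = λ { (succ i) xs → append i (xs 0F) }
  ; pr            = λ { sub xs → xs 0F ⊆ xs 1F }
  ; func-cong     = λ { (succ i) e → append-cong i (e 0F) }
  ; pr-cong       = λ { sub e → ⊆-resp (e 0F) (e 1F) }
  }

tree-rel : ∀ n → Structure (ℒ-rel n)
tree-rel n = record
  { Carrier       = Node n
  ; _≈_           = _≈ᴺ_
  ; ≈-equivalence = ≈ᴺ-isEquivalence
  ; func          = λ ()
  ; pr            = λ { sub xs → xs 0F ⊆ xs 1F ; (edge i) xs → xs 1F ≈ᴺ append i (xs 0F) }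
  ; func-cong     = λ ()
  ; pr-cong       = λ where
      sub      e → ⊆-resp (e 0F) (e 1F)
      (edge i) e → λ p → N.trans (N.sym (e 1F)) (N.trans p (append-cong i (e 0F)))
  }

tree-qe : ExcludedMiddle 0ℓ → (S : CharacteristicSystem n) → Structure (ℒ-qe S)
tree-qe {n} em S = record
  { Carrier       = Node n
  ; _≈_           = _≈ᴺ_
  ; ≈-equivalence = ≈ᴺ-isEquivalence
  ; func          = λ { meet xs → xs 0F ⊓ xs 1F ; root _ → empty }
  ; pr            = pr′
  ; func-cong     = λ where
      meet e → ⊓-mono (proj₁ (e 0F)) (proj₁ (e 1F)) , ⊓-mono (proj₂ (e 0F)) (proj₂ (e 1F))
      root _ → N.refl
  ; pr-cong       = pr′-cong
  }
  where
  open Meet em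

  pr′ : ∀ {a} → QePr S a → Vector (Node n) a → Set
  pr′ (rel r) xs = Structure.pr (tree-rel n) r xs
  pr′ (P q σ) xs = xs 0F ⊊ xs 1F × Sat (tree-rel n) xs (relativize (sentence S q σ))

  pr′-cong : ∀ {a} (r : QePr S a) {xs ys : Vector (Node n) a} →
             (∀ i → xs i ≈ᴺ ys i) → pr′ r xs → pr′ r ys
  pr′-cong (rel r) e p = Structure.pr-cong (tree-rel n) r e p
  pr′-cong (P q σ) e ((p , ¬eq) , φ) =
    (⊆-resp (e 0F) (e 1F) p ,
     λ eq → ¬eq (N.trans (e 0F) (N.trans eq (N.sym (e 1F))))) ,
    Sat-cong (tree-rel n) e (relativize (sentence S q σ)) φ

------------------------------------------------------------------------
-- Definitional equivalence between the functions Sᵢ and their graphs Eᵢ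

-- Eᵢ(x , y) ↔ y = Sᵢ(x)
graphAxiom : Fin n → Sentence (ℒ-common n)
graphAxiom i = closure {k = 2}
  (atom (edge i) (var 0F ◂ var 1F ◂ ⟨⟩) ⇔′ var 1F ≐ app (succ i) (var 0F ◂ ⟨⟩))

GraphAxioms : Pred (Sentence (ℒ-common n)) 0ℓ
GraphAxioms χ = ∃[ i ] graphAxiom i ≡ χ

functional : Fin n → Sentence (ℒ-rel n)
functional i = closure {k = 1}
  (∃′ (atom (edge i) (var 1F ◂ var 0F ◂ ⟨⟩) ∧′
       ∀′ (atom (edge i) (var 2F ◂ var 0F ◂ ⟨⟩) ⇒′ var 0F ≐ var 1F)))

-- The two theories have a common definitional extension.  Reading the graph
-- axioms as definitions of the Sᵢ over T requires T to prove that the Eᵢ are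
-- graphs of functions; as definitions of the Eᵢ they are always admissible.
record DefinitionallyEquivalent
  (T : Pred (Sentence (ℒ-rel n)) ℓ) (T′ : Pred (Sentence (ℒ-fun n)) ℓ′) : Set (Level.suc 0ℓ Level.⊔ ℓ Level.⊔ ℓ′) where
  field
    admissible       : ∀ i → T ⊩ functional i
    sameConsequences : ∀ χ → (image rel↪common T ∪ GraphAxioms ⊩ χ) ⇔
                             (image fun↪common T′ ∪ GraphAxioms ⊩ χ)

{-# OPTIONS --safe #-}

-- An interval [x , y) of the tree is a colored linear order, and it suffices to control
-- intervals up to a game in which a move splits the interval in two; its types are finite
-- in number and compatible with concatenation.
--
-- Completeness: between two models of Tₙ¹, consider finite meet-closed partial isomorphisms
-- that preserve the game types of all intervals.  A new point c first adds its highest meet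
-- with the old points, which lies inside an old interval and is answered by a move of the
-- game there; from this meet c leaves along a new branch, whose type the other model
-- realizes, and the type determines the color of its first step.
--
-- Consistency: the tree of height ω^ω realizes every colored ordinal A up to q rounds.  By
-- induction on the end a of an interval [b , a) of A, the interval has copies above all nodes.
-- If a is a limit, choose b = h₀ < h₁ < ⋯ below a such that the splits of [h_k , a) all
-- occur below h_(k+1), up to game types; then [b , a) cannot be distinguished from the
-- concatenation of the [h_k , h_(k+1)), even if the h_k are not cofinal in a.  As there are
-- finitely many types, the copies of these pieces have lengths below a common ω^m, so their
-- concatenation is still a node.
module Submission where

open import Defs
open import Axiom.ExcludedMiddle using (ExcludedMiddle)
open import Data.Empty using (⊥)
open import Data.Fin.Base using (Fin; _↑ʳ_; _↑ˡ_; suc; zero)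
open import Data.Fin.Patterns using (0F; 1F; 2F)
import Data.Fin.Properties as Fin
open import Data.List.Base as List using (List; []; _++_; _∷_; _∷ʳ_)
open import Data.List.Membership.Propositional using (_∈_)
open import Data.List.Membership.Propositional.Properties
  using (∈-++⁺ʳ; ∈-++⁺ˡ; ∈-allFin; ∈-cartesianProductWith⁺; ∈-cartesianProductWith⁻;
         ∈-cartesianProduct⁺; ∈-map⁺)
open import Data.List.Relation.Binary.Lex.Strict using (base; halt; next; this)
open import Data.List.Relation.Unary.Any using (here; there)
open import Data.List.Relation.Unary.Linked using (Linked; [-]; []; _∷_)
open import Data.Maybe.Base as Maybe using (Maybe; just; maybe; nothing)
open import Data.Nat.Base as ℕ using (_≤_; suc; s≤s; zero; z≤n; ℕ)
import Data.Nat.Properties as ℕ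
open import Data.Product using (Σ-syntax; ∃; ∃-syntax; _×_; _,_; proj₁; proj₂; swap)
open import Data.Product.Function.NonDependent.Propositional using (_×-⇔_)
open import Data.Sum.Base as Sum using (_⊎_; inj₁; inj₂)
open import Data.Sum.Function.Propositional using (_⊎-⇔_)
open import Data.Unit.Base using (tt; ⊤)
open import Data.Vec.Functional using (Vector) renaming ([] to ⟨⟩; _∷_ to _◂_)
open import Function.Base using (_∘_; id)
open import Function.Bundles using (_⇔_; mk⇔; Equivalence)
open import Function.Construct.Composition using (_⇔-∘_)
open import Function.Construct.Identity using (⇔-id)
open import Function.Construct.Symmetry using (⇔-sym)
open import Function.Related.TypeIsomorphisms using (→-cong-⇔)
open import Induction.WellFounded using (Acc; WellFounded; acc)
open import Level using (0ℓ)
open import Relation.Binary.Core using (Rel)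
open import Relation.Binary.Definitions using (Trichotomous; tri<; tri>; tri≈)
open import Relation.Binary.PropositionalEquality using (_≡_; _≢_; cong; refl; subst; sym; trans)
open import Relation.Binary.Structures using (IsStrictTotalOrder)
open import Relation.Nullary using (Dec; contradiction; no; recompute; yes; ¬_)
open import Relation.Unary using (Pred)

open Language using (Func; Pr)
open Equivalence using (to; from)
open Ω using (exponents)
open Node
open _⊆_

-- A model of the theory may have ill-founded intervals, so types are carried from one model to
-- another by characteristic sentences, which axiomatize their classes among all structures.
-- Well-foundedness serves the standard tree: its intervals are colored ordinals, which gives
-- exhaustion, and induction over a colored ordinal gives realization.
--
-- Since a move splits an interval, the game is local: a new point affects one interval between
-- neighboring points, and all other intervals are recovered by concatenation. The game matches
-- first-order logic up to a shift of parameters: a sentence is decided by two rounds more than its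
-- quantifier rank, and `q` rounds are decided by sentences of a rank computed from a finite list of
-- tests. The two extra rounds detect the color of the first point of an interval.
--
-- The obstacle to consistency is that ω^ω has cofinality ω, so infinitely many copies in a row may
-- run out of the tree, while the ordinals to be copied are arbitrary. Hence copies are only similar
-- up to `q` rounds, and each comes with an exponent that bounds its length uniformly in the node
-- where it starts.

private
  variable
    k m n q r s : ℕ

-- Reducts and back-and-forth systems

∀-⇔ : ∀ {A : Set} {P Q : A → Set} → (∀ a → P a ⇔ Q a) → (∀ a → P a) ⇔ (∀ a → Q a)
∀-⇔ e = mk⇔ (λ f a → to (e a) (f a)) (λ f a → from (e a) (f a))

module _ {L : Language} {M : Structure L} where

  ⋁⁺ : ∀ {m} {ρ : Vector (Structure.Carrier M) k} (φs : Vector (Formula L k) m) i →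
       Sat M ρ (φs i) → Sat M ρ (⋁ φs)
  ⋁⁺ φs zero    p = inj₁ p
  ⋁⁺ φs (suc i) p = inj₂ (⋁⁺ (φs ∘ suc) i p)

  ⋁⁻ : ∀ {m} {ρ : Vector (Structure.Carrier M) k} (φs : Vector (Formula L k) m) →
       Sat M ρ (⋁ φs) → ∃[ i ] Sat M ρ (φs i)
  ⋁⁻ {m = suc m} φs (inj₁ p) = zero , p
  ⋁⁻ {m = suc m} φs (inj₂ p) = let (i , q) = ⋁⁻ (φs ∘ suc) p in suc i , q

-- A relation between structures instead of an equation, because functions out of an empty set of
-- symbols need not be definitionally equal.
record IsReduct {L L′} (h : L ↪ L′) (M : Structure L) (M′ : Structure L′) : Set where
  open _↪_ h
  private
    module M  = Structure M
    module M′ = Structure M′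
  field
    image⟨_⟩ : M.Carrier → M′.Carrier
    onto     : ∀ y → ∃[ x ] image⟨ x ⟩ M′.≈ y
    ≈-⇔      : ∀ {x y} → x M.≈ y ⇔ image⟨ x ⟩ M′.≈ image⟨ y ⟩
    func-≈   : ∀ {a} (f : Func L a) xs →
               image⟨ M.func f xs ⟩ M′.≈ M′.func (onFunc f) (image⟨_⟩ ∘ xs)
    pr-⇔     : ∀ {a} (r : Pr L a) {xs} →
               M.pr r xs ⇔ M′.pr (onPr r) (image⟨_⟩ ∘ xs)

  private
    Over : Vector M.Carrier k → Vector M′.Carrier k → Set
    Over ρ τ = ∀ i → image⟨ ρ i ⟩ M′.≈ τ i

    ◂-over : ∀ {ρ : Vector M.Carrier k} {τ x y} → image⟨ x ⟩ M′.≈ y → Over ρ τ →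
             Over (x ◂ ρ) (y ◂ τ)
    ◂-over e o zero    = e
    ◂-over e o (suc i) = o i

    eval-over : ∀ {ρ : Vector M.Carrier k} {τ} → Over ρ τ → ∀ t →
                image⟨ eval M ρ t ⟩ M′.≈ eval M′ τ (embedᵗ h t)
    eval-over o (var i)    = o i
    eval-over o (app f ts) =
      M′.≈.trans (func-≈ f _) (M′.func-cong (onFunc f) (λ i → eval-over o (ts i)))

    Sat-over : ∀ {ρ : Vector M.Carrier k} {τ} → Over ρ τ → ∀ φ →
               Sat M ρ φ ⇔ Sat M′ τ (embed h φ)
    Sat-over o (atom r ts) = mk⇔
      (M′.pr-cong (onPr r) (eval-over o ∘ ts) ∘ to (pr-⇔ r))
      (from (pr-⇔ r) ∘ M′.pr-cong (onPr r) (λ i → M′.≈.sym (eval-over o (ts i))))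
    Sat-over o (s ≐ t) = mk⇔
      (λ p → M′.≈.trans (M′.≈.sym (eval-over o s)) (M′.≈.trans (to ≈-⇔ p) (eval-over o t)))
      (λ p → from ≈-⇔ (M′.≈.trans (eval-over o s) (M′.≈.trans p (M′.≈.sym (eval-over o t)))))
    Sat-over o ⊥′       = ⇔-id _
    Sat-over o (φ ∧′ ψ) = Sat-over o φ ×-⇔ Sat-over o ψ
    Sat-over o (φ ∨′ ψ) = Sat-over o φ ⊎-⇔ Sat-over o ψ
    Sat-over o (φ ⇒′ ψ) = →-cong-⇔ (Sat-over o φ) (Sat-over o ψ)
    Sat-over o (∀′ φ)   = mk⇔
      (λ f y → to (Sat-over (◂-over (proj₂ (onto y)) o) φ) (f _))
      (λ f x → from (Sat-over (◂-over M′.≈.refl o) φ) (f _))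
    Sat-over o (∃′ φ)   = mk⇔
      (λ (x , p) → _ , to (Sat-over (◂-over M′.≈.refl o) φ) p)
      (λ (y , p) → _ , from (Sat-over (◂-over (proj₂ (onto y)) o) φ) p)

  Sat-embed : ∀ {ρ : Vector M.Carrier k} φ → Sat M ρ φ ⇔ Sat M′ (image⟨_⟩ ∘ ρ) (embed h φ)
  Sat-embed = Sat-over (λ _ → M′.≈.refl)

  ⊨-embed : ∀ φ → (M ⊨ φ) ⇔ (M′ ⊨ embed h φ)
  ⊨-embed = Sat-over (λ ())

reduct : ∀ {L L′} → L ↪ L′ → Structure L′ → Structure L
reduct h M = record
  { Carrier       = M.Carrier
  ; _≈_           = M._≈_
  ; ≈-equivalence = M.≈-equivalence
  ; func          = M.func ∘ onFunc
  ; pr            = M.pr ∘ onPr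
  ; func-cong     = M.func-cong ∘ onFunc
  ; pr-cong       = M.pr-cong ∘ onPr
  }
  where
  module M = Structure M
  open _↪_ h

reduct-isReduct : ∀ {L L′} (h : L ↪ L′) (M : Structure L′) → IsReduct h (reduct h M) M
reduct-isReduct h M = record
  { image⟨_⟩ = id
  ; onto     = λ y → y , ≈.refl
  ; ≈-⇔      = ⇔-id _
  ; func-≈   = λ _ _ → ≈.refl
  ; pr-⇔     = λ _ → ⇔-id _
  }
  where
  module ≈ = Structure.≈ M

-- Atoms may cost rounds too: `P q σ` abbreviates a relativized sentence whose quantifiers have to
-- be played. With weight 0 this is the quantifier rank.
weightedRank : ∀ {L} → (∀ {a} → Pr L a → ℕ) → Formula L k → ℕ
weightedRank w (atom p _) = w p
weightedRank w (_ ≐ _)    = 0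
weightedRank w ⊥′         = 0
weightedRank w (φ ∧′ ψ)   = weightedRank w φ ℕ.⊔ weightedRank w ψ
weightedRank w (φ ∨′ ψ)   = weightedRank w φ ℕ.⊔ weightedRank w ψ
weightedRank w (φ ⇒′ ψ)   = weightedRank w φ ℕ.⊔ weightedRank w ψ
weightedRank w (∀′ φ)     = suc (weightedRank w φ)
weightedRank w (∃′ φ)     = suc (weightedRank w φ)

module BackAndForth {L : Language} {M N : Structure L}
  (R : ℕ → ∀ {k} → Vector (Structure.Carrier M) k → Vector (Structure.Carrier N) k → Set)
  (R-antitone : ∀ {r s k} {ρ : Vector (Structure.Carrier M) k} {τ} → r ℕ.≤ s → R s ρ τ → R r ρ τ)
  (forth : ∀ {r k} {ρ : Vector (Structure.Carrier M) k} {τ} → R (suc r) ρ τ → ∀ a → ∃[ b ] R r (a ◂ ρ) (b ◂ τ))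
  (back  : ∀ {r k} {ρ : Vector (Structure.Carrier M) k} {τ} → R (suc r) ρ τ → ∀ b → ∃[ a ] R r (a ◂ ρ) (b ◂ τ))
  (R-≐   : ∀ {r k} {ρ : Vector (Structure.Carrier M) k} {τ} → R r ρ τ → ∀ s t → Sat M ρ (s ≐ t) ⇔ Sat N τ (s ≐ t))
  (w     : ∀ {a} → Pr L a → ℕ)
  (R-atom : ∀ {a k} {ρ : Vector (Structure.Carrier M) k} {τ} (p : Pr L a) (ts : Vector (Term L k) a) →
            R (w p) ρ τ → Sat M ρ (atom p ts) ⇔ Sat N τ (atom p ts))
  where

  agree : ∀ {ρ : Vector (Structure.Carrier M) k} {τ} φ → R (weightedRank w φ) ρ τ → Sat M ρ φ ⇔ Sat N τ φ
  agree (atom p ts) x = R-atom p ts x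
  agree (s ≐ t)     x = R-≐ x s t
  agree ⊥′          x = ⇔-id _
  agree (φ ∧′ ψ)    x = agree φ (R-antitone (ℕ.m≤m⊔n _ _) x) ×-⇔ agree ψ (R-antitone (ℕ.m≤n⊔m _ _) x)
  agree (φ ∨′ ψ)    x = agree φ (R-antitone (ℕ.m≤m⊔n _ _) x) ⊎-⇔ agree ψ (R-antitone (ℕ.m≤n⊔m _ _) x)
  agree (φ ⇒′ ψ)    x = →-cong-⇔ (agree φ (R-antitone (ℕ.m≤m⊔n _ _) x)) (agree ψ (R-antitone (ℕ.m≤n⊔m _ _) x))
  agree (∀′ φ)      x = mk⇔
    (λ p b → let (a , y) = back x b in to (agree φ y) (p a))
    (λ p a → let (b , y) = forth x a in from (agree φ y) (p b))
  agree (∃′ φ)      x = mk⇔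
    (λ (a , p) → let (b , y) = forth x a in b , to (agree φ y) p)
    (λ (b , p) → let (a , y) = back x b in a , from (agree φ y) p)

-- Prefix orders and the interval game

-- Dir i x y: x lies strictly below y, and y is reached from x in direction i.
-- The interval [x , y) is thereby a colored linear order.
record PrefixOrder (n : ℕ) : Set₁ where
  infix 4 _⊑_ _⊏_ _≋_
  infixr 7 _⋏_
  field
    Point      : Set
    _⊑_        : Rel Point 0ℓ
    ⊑-refl     : ∀ {x} → x ⊑ x
    ⊑-trans    : ∀ {x y z} → x ⊑ y → y ⊑ z → x ⊑ z
    ⊑-linear   : ∀ {x y z} → x ⊑ z → y ⊑ z → x ⊑ y ⊎ y ⊑ x
    _⋏_        : Point → Point → Point
    ⋏-lowerˡ   : ∀ x y → x ⋏ y ⊑ x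
    ⋏-lowerʳ   : ∀ x y → x ⋏ y ⊑ y
    ⋏-greatest : ∀ {x y z} → z ⊑ x → z ⊑ y → z ⊑ x ⋏ y
    Dir        : Fin n → Rel Point 0ℓ

  _⊏_ : Rel Point 0ℓ
  x ⊏ y = x ⊑ y × ¬ y ⊑ x

  _≋_ : Rel Point 0ℓ
  x ≋ y = x ⊑ y × y ⊑ x

  field
    Dir⇒⊏      : ∀ {i x y} → Dir i x y → x ⊏ y
    Dir-exists : ∀ {x y} → x ⊏ y → ∃[ i ] Dir i x y
    Dir-unique : ∀ {i j x y} → Dir i x y → Dir j x y → i ≡ j
    Dir-mono   : ∀ {i x y z} → Dir i x y → y ⊑ z → Dir i x z
    Dir-respˡ  : ∀ {i x y z} → x ≋ y → Dir i x z → Dir i y z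

  ⊏-⊑-trans : ∀ {x y z} → x ⊏ y → y ⊑ z → x ⊏ z
  ⊏-⊑-trans (p , ¬q) r = ⊑-trans p r , λ s → ¬q (⊑-trans r s)

  ⊑-⊏-trans : ∀ {x y z} → x ⊑ y → y ⊏ z → x ⊏ z
  ⊑-⊏-trans p (r , ¬s) = ⊑-trans p r , λ t → ¬s (⊑-trans t p)

  Dir-cut : ∀ {i x y z} → x ⊏ y → y ⊑ z → Dir i x z → Dir i x y
  Dir-cut {x = x} {y} p q d =
    let (j , e) = Dir-exists p
    in subst (λ j → Dir j x y) (Dir-unique (Dir-mono e q) d) e

open PrefixOrder using (Point)

infix 4 _⊢_⊑_ _⊢_⊏_
_⊢_⊑_ _⊢_⊏_ : ∀ {n} (K : PrefixOrder n) → Rel (Point K) 0ℓ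
K ⊢ x ⊑ y = PrefixOrder._⊑_ K x y
K ⊢ x ⊏ y = PrefixOrder._⊏_ K x y

-- The q-round game on the intervals [x , y) and [x′ , y′): the chosen points
-- split both of them in two.
data Sim {n} (K L : PrefixOrder n) : ℕ → (x y : Point K) (x′ y′ : Point L) → Set where
  stop : ∀ {x y x′ y′} → Sim K L 0 x y x′ y′
  step : ∀ {q x y x′ y′} →
         (∀ {i z} → K ⊢ x ⊑ z → PrefixOrder.Dir K i z y →
           ∃[ z′ ] L ⊢ x′ ⊑ z′ × PrefixOrder.Dir L i z′ y′ × Sim K L q x z x′ z′ × Sim K L q z y z′ y′) →
         (∀ {i z′} → L ⊢ x′ ⊑ z′ → PrefixOrder.Dir L i z′ y′ →
           ∃[ z ] K ⊢ x ⊑ z × PrefixOrder.Dir K i z y × Sim K L q x z x′ z′ × Sim K L q z y z′ y′) →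
         Sim K L (suc q) x y x′ y′

Sim-sym : ∀ {K L : PrefixOrder n} {x y x′ y′} → Sim K L q x y x′ y′ → Sim L K q x′ y′ x y
Sim-sym stop       = stop
Sim-sym (step f b) = step
  (λ p d → let (z , p′ , d′ , s , t) = b p d in z , p′ , d′ , Sim-sym s , Sim-sym t)
  (λ p d → let (z , p′ , d′ , s , t) = f p d in z , p′ , d′ , Sim-sym s , Sim-sym t)

Sim-trans : ∀ {K L M : PrefixOrder n} {x y x′ y′ x″ y″} →
            Sim K L q x y x′ y′ → Sim L M q x′ y′ x″ y″ → Sim K M q x y x″ y″
Sim-trans stop       stop         = stop
Sim-trans (step f b) (step f′ b′) = step
  (λ p d → let (_ , p₁ , d₁ , s₁ , t₁) = f p d
               (_ , p₂ , d₂ , s₂ , t₂) = f′ p₁ d₁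
           in _ , p₂ , d₂ , Sim-trans s₁ s₂ , Sim-trans t₁ t₂)
  (λ p d → let (_ , p₁ , d₁ , s₁ , t₁) = b′ p d
               (_ , p₂ , d₂ , s₂ , t₂) = b p₁ d₁
           in _ , p₂ , d₂ , Sim-trans s₂ s₁ , Sim-trans t₂ t₁)

Sim-antitone : ∀ {K L : PrefixOrder n} {x y x′ y′} → q ℕ.≤ r →
               Sim K L r x y x′ y′ → Sim K L q x y x′ y′
Sim-antitone z≤n     _          = stop
Sim-antitone (s≤s l) (step f b) = step
  (λ p d → let (_ , p₁ , d₁ , s , t) = f p d in _ , p₁ , d₁ , Sim-antitone l s , Sim-antitone l t)
  (λ p d → let (_ , p₁ , d₁ , s , t) = b p d in _ , p₁ , d₁ , Sim-antitone l s , Sim-antitone l t)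

Sim-pred : ∀ {K L : PrefixOrder n} {x y x′ y′} →
           Sim K L (suc q) x y x′ y′ → Sim K L q x y x′ y′
Sim-pred = Sim-antitone (ℕ.n≤1+n _)

module _ {K : PrefixOrder n} where
  open PrefixOrder K

  Sim-≋ : ∀ {x y x′ y′} → x ≋ x′ → y ≋ y′ → Sim K K q x y x′ y′
  Sim-≋ {q = zero}  _       _       = stop
  Sim-≋ {q = suc q} e@(e₁ , e₂) e′@(e₃ , e₄) = step
    (λ p d → _ , ⊑-trans e₂ p , Dir-mono d e₃ , Sim-≋ e ≋-refl , Sim-≋ ≋-refl e′)
    (λ p d → _ , ⊑-trans e₁ p , Dir-mono d e₄ , Sim-≋ e ≋-refl , Sim-≋ ≋-refl e′)
    where
    ≋-refl : ∀ {x} → x ≋ x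
    ≋-refl = ⊑-refl , ⊑-refl

module _ {K L : PrefixOrder n} where
  private
    module K = PrefixOrder K
    module L = PrefixOrder L

  Sim-empty : ∀ {x y x′ y′} → ¬ x K.⊏ y → ¬ x′ L.⊏ y′ → Sim K L q x y x′ y′
  Sim-empty {q = zero}  _  _  = stop
  Sim-empty {q = suc q} ¬p ¬q = step
    (λ p d → contradiction (K.⊑-⊏-trans p (K.Dir⇒⊏ d)) ¬p)
    (λ p d → contradiction (L.⊑-⊏-trans p (L.Dir⇒⊏ d)) ¬q)

  -- Moving at `x` itself forces an answer inside the other interval.
  Sim-⊏ : ∀ {x y x′ y′} → Sim K L (suc q) x y x′ y′ → x K.⊏ y → x′ L.⊏ y′
  Sim-⊏ (step f _) p =
    let (_ , p′ , d , _) = f K.⊑-refl (proj₂ (K.Dir-exists p)) in L.⊑-⊏-trans p′ (L.Dir⇒⊏ d)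

module Intervals (em : ExcludedMiddle 0ℓ) where

  module _ (K : PrefixOrder n) where
    open PrefixOrder K

    ⊑∨⊏ : ∀ {x y z} → x ⊑ z → y ⊑ z → x ⊑ y ⊎ y ⊏ x
    ⊑∨⊏ {x} {y} p q with em {x ⊑ y} | ⊑-linear p q
    ... | yes r | _      = inj₁ r
    ... | no ¬r | inj₁ r = inj₁ r
    ... | no ¬r | inj₂ r = inj₂ (r , ¬r)

  module _ {K L : PrefixOrder n} where
    private
      module K = PrefixOrder K
      module L = PrefixOrder L

    -- The first round moves at `x`. If the answer were strictly above `x′`, a second move at `x′`
    -- would need an answer in the empty interval from `x` to `x`. So the answer is `x′`, and it has
    -- the right direction.
    Sim-first : ∀ {i x y x′ y′} → Sim K L 2 x y x′ y′ → K.Dir i x y → L.Dir i x′ y′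
    Sim-first {x = x} {x′ = x′} (step f _) d with f K.⊑-refl d
    ... | z′ , p , d′ , step _ b , _ with em {z′ L.⊑ x′}
    ...   | yes r = L.Dir-respˡ (r , p) d′
    ...   | no ¬r =
      let (_ , p″ , d″ , _) = b L.⊑-refl (proj₂ (L.Dir-exists (p , ¬r)))
      in contradiction p″ (proj₂ (K.Dir⇒⊏ d″))

  mutual
    private
      Sim-+-forth : ∀ {K L : PrefixOrder n}
                    {x y z x′ y′ z′} → K ⊢ x ⊑ y → K ⊢ y ⊑ z → L ⊢ x′ ⊑ y′ → L ⊢ y′ ⊑ z′ →
                    Sim K L (suc q) x y x′ y′ → Sim K L (suc q) y z y′ z′ →
                    ∀ {i u} → K ⊢ x ⊑ u → PrefixOrder.Dir K i u z →
                    ∃[ u′ ] L ⊢ x′ ⊑ u′ × PrefixOrder.Dir L i u′ z′ × Sim K L q x u x′ u′ × Sim K L q u z u′ z′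
      Sim-+-forth {K = K} {L} x≤y y≤z x≤y′ y≤z′ s@(step f _) t@(step g _) x≤u d
        with ⊑∨⊏ K y≤z (proj₁ (PrefixOrder.Dir⇒⊏ K d))
      ... | inj₁ y≤u =
        let (_ , p , d′ , s₁ , s₂) = g y≤u d
        in _ , L.⊑-trans x≤y′ p , d′ , Sim-+ x≤y y≤u x≤y′ p (Sim-pred s) s₁ , s₂
        where
        module L = PrefixOrder L
      ... | inj₂ u<y =
        let (_ , p , d′ , s₁ , s₂) = f x≤u (K.Dir-cut u<y y≤z d)
        in _ , p , L.Dir-mono d′ y≤z′ , s₁ ,
           Sim-+ (proj₁ u<y) y≤z (proj₁ (L.Dir⇒⊏ d′)) y≤z′ s₂ (Sim-pred t)
        where
        module K = PrefixOrder K
        module L = PrefixOrder L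

    -- A move falls into one of the two parts and is answered there; the half next to the untouched
    -- part is then glued to it with one round fewer. The color of a point depends only on its first
    -- step, so it is the same relative to either end.
    Sim-+ : ∀ {K L : PrefixOrder n}
            {x y z x′ y′ z′} → K ⊢ x ⊑ y → K ⊢ y ⊑ z → L ⊢ x′ ⊑ y′ → L ⊢ y′ ⊑ z′ →
            Sim K L q x y x′ y′ → Sim K L q y z y′ z′ → Sim K L q x z x′ z′
    Sim-+ {q = zero} _ _ _ _ _ _ = stop
    Sim-+ {q = suc q} p p₁ p′ p₁′ s t = step
      (λ x≤u d → Sim-+-forth p p₁ p′ p₁′ s t x≤u d)
      (λ x≤u d → let (_ , l , d′ , s₁ , s₂) = Sim-+-forth p′ p₁′ p p₁ (Sim-sym s) (Sim-sym t) x≤u d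
                 in _ , l , d′ , Sim-sym s₁ , Sim-sym s₂)

-- For each q, finitely many of these interval properties decide Sim q.
data Test (n : ℕ) : Set where
  ⊤ᵗ   : Test n
  ¬ᵗ_  : Test n → Test n
  _∧ᵗ_ : Test n → Test n → Test n
  ∃ᵗ   : Fin n → Test n → Test n → Test n

module _ (K : PrefixOrder n) where
  open PrefixOrder K

  Holds : Test n → Rel (PrefixOrder.Point K) 0ℓ
  Holds ⊤ᵗ         x y = ⊤
  Holds (¬ᵗ t)     x y = ¬ Holds t x y
  Holds (s ∧ᵗ t)   x y = Holds s x y × Holds t x y
  Holds (∃ᵗ i s t) x y = ∃[ z ] x ⊑ z × Dir i z y × Holds s x z × Holds t z y

-- The complete sign patterns over a list of tests. Every interval satisfies one, and sharing one
-- forces agreement on the whole list.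
signs : List (Test n) → List (Test n)
signs []       = ⊤ᵗ ∷ []
signs (t ∷ ts) = List.cartesianProductWith _∧ᵗ_ (t ∷ ¬ᵗ t ∷ []) (signs ts)

-- A test for `suc q` rounds names the color of a split point and a complete `q`-round description
-- of each half, so a witness on the other side is an answer to the move.
tests : ∀ n → ℕ → List (Test n)
tests n zero    = []
tests n (suc q) = List.cartesianProductWith (λ i (s , t) → ∃ᵗ i s t) (List.allFin n)
  (List.cartesianProduct (signs (tests n q)) (signs (tests n q)))

AgreeOn : (K L : PrefixOrder n) → List (Test n) → (x y : Point K) (x′ y′ : Point L) → Set
AgreeOn K L ts x y x′ y′ = ∀ {t} → t ∈ ts → Holds K t x y ⇔ Holds L t x′ y′

module _ {K L : PrefixOrder n} where

  signs-agree : ∀ ts {s x y x′ y′} → s ∈ signs ts → Holds K s x y → Holds L s x′ y′ →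
                AgreeOn K L ts x y x′ y′
  signs-agree (t ∷ ts) s∈ h h′ t∈ with ∈-cartesianProductWith⁻ _∧ᵗ_ (t ∷ ¬ᵗ t ∷ []) (signs ts) s∈
  signs-agree (t ∷ ts) s∈ (h , _) (h′ , _) (here refl) | _ , _ , here refl , _ , refl =
    mk⇔ (λ _ → h′) (λ _ → h)
  signs-agree (t ∷ ts) s∈ (h , _) (h′ , _) (here refl) | _ , _ , there (here refl) , _ , refl =
    mk⇔ (λ p → contradiction p h) (λ p → contradiction p h′)
  signs-agree (t ∷ ts) s∈ (_ , h) (_ , h′) (there t∈) | _ , _ , _ , s∈′ , refl =
    signs-agree ts s∈′ h h′ t∈

module Tests (em : ExcludedMiddle 0ℓ) where

  signs-complete : (K : PrefixOrder n) → ∀ ts x y → ∃[ s ] s ∈ signs ts × Holds K s x y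
  signs-complete K []       x y = ⊤ᵗ , here refl , tt
  signs-complete K (t ∷ ts) x y with signs-complete K ts x y | em {Holds K t x y}
  ... | _ , s∈ , h | yes p = _ , ∈-cartesianProductWith⁺ _∧ᵗ_ {t ∷ ¬ᵗ t ∷ []} (here refl) s∈ , p , h
  ... | _ , s∈ , h | no ¬p = _ , ∈-cartesianProductWith⁺ _∧ᵗ_ {t ∷ ¬ᵗ t ∷ []} (there (here refl)) s∈ , ¬p , h

  agree⇒Sim : ∀ {K L : PrefixOrder n} {x y x′ y′} →
              AgreeOn K L (tests n q) x y x′ y′ → Sim K L q x y x′ y′
  agree⇒Sim {q = zero}  _ = stop
  agree⇒Sim {n = n} {q = suc q} {K} {L} {x} {y} {x′} {y′} a =
    step (λ p d → forth a p d)
         (λ p d → let (_ , p′ , d′ , s , t) = forth (λ t∈ → mk⇔ (from (a t∈)) (to (a t∈))) p d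
                  in _ , p′ , d′ , Sim-sym s , Sim-sym t)
    where
    forth : ∀ {K L : PrefixOrder n} {x y x′ y′} →
            AgreeOn K L (tests n (suc q)) x y x′ y′ → ∀ {i z} → K ⊢ x ⊑ z → PrefixOrder.Dir K i z y →
            ∃[ z′ ] L ⊢ x′ ⊑ z′ × PrefixOrder.Dir L i z′ y′ × Sim K L q x z x′ z′ × Sim K L q z y z′ y′
    forth {K} {L} {x} {y} a {i} {z} p d =
      let (s , s∈ , hs) = signs-complete K (tests n q) x z
          (t , t∈ , ht) = signs-complete K (tests n q) z y
          (z′ , p′ , d′ , hs′ , ht′) =
            to (a (∈-cartesianProductWith⁺ (λ i (s , t) → ∃ᵗ i s t) (∈-allFin i)
                    (∈-cartesianProduct⁺ s∈ t∈)))
               (z , p , d , hs , ht)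
      in z′ , p′ , d′ , agree⇒Sim (signs-agree (tests n q) s∈ hs hs′)
                      , agree⇒Sim (signs-agree (tests n q) t∈ ht ht′)

-- Finite partial isomorphisms

module FiniteMax (em : ExcludedMiddle 0ℓ) where

  finite-max : ∀ {m} (Q : Pred (Fin m) 0ℓ) (_≼_ : Rel (Fin m) 0ℓ) →
               (∀ {i} → i ≼ i) → (∀ {i j k} → i ≼ j → j ≼ k → i ≼ k) →
               (∀ {i j} → Q i → Q j → i ≼ j ⊎ j ≼ i) →
               ∃ Q → ∃[ j ] Q j × ∀ {i} → Q i → i ≼ j
  finite-max {suc m} Q _≼_ ≼-refl ≼-trans total (i₀ , p₀) with em {∃[ i ] Q (suc i)}
  ... | no none = zero , at-zero i₀ p₀ , λ {i} → only i
    where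
    at-zero : ∀ i → Q i → Q zero
    at-zero zero    p = p
    at-zero (suc i) p = contradiction (i , p) none
    only : ∀ i → Q i → i ≼ zero
    only zero    _ = ≼-refl
    only (suc i) p = contradiction (i , p) none
  ... | yes some
    with finite-max (Q ∘ suc) (λ i j → suc i ≼ suc j) ≼-refl ≼-trans total some | em {Q zero}
  ...   | j , pj , max | no ¬p = suc j , pj , λ {i} → bound i
    where
    bound : ∀ i → Q i → i ≼ suc j
    bound zero    p = contradiction p ¬p
    bound (suc i) p = max p
  ...   | j , pj , max | yes p with total p pj
  ...     | inj₁ l = suc j , pj , λ {i} → bound i
    where
    bound : ∀ i → Q i → i ≼ suc j
    bound zero    _ = l
    bound (suc i) p = max p
  ...     | inj₂ l = zero , p , λ {i} → bound i
    where
    bound : ∀ i → Q i → i ≼ zero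
    bound zero    _ = ≼-refl
    bound (suc i) p = ≼-trans (max p) l

-- f and g list the graph of the isomorphism, with repetitions allowed.
record PartialIso {n} (K L : PrefixOrder n) (r : ℕ) {m}
                  (f : Vector (Point K) m) (g : Vector (Point L) m) : Set where
  private
    module K = PrefixOrder K
    module L = PrefixOrder L
  field
    ⊑-⇔  : ∀ {i j} → f i K.⊑ f j ⇔ g i L.⊑ g j
    sim  : ∀ {i j} → f i K.⊑ f j → Sim K L r (f i) (f j) (g i) (g j)
    closed : ∀ i j → ∃[ k ] f k K.≋ f i K.⋏ f j × g k L.≋ g i L.⋏ g j

PartialIso-sym : ∀ {K L : PrefixOrder n} {f : Vector (Point K) m} {g} →
                 PartialIso K L r f g → PartialIso L K r g f
PartialIso-sym p = record
  { ⊑-⇔  = mk⇔ (from ⊑-⇔) (to ⊑-⇔)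
  ; sim  = λ l → Sim-sym (sim (from ⊑-⇔ l))
  ; closed = λ i j → let (k , e , e′) = closed i j in k , e′ , e
  }
  where
  open PartialIso p

PartialIso-antitone : ∀ {K L : PrefixOrder n} {f : Vector (Point K) m} {g} → r ℕ.≤ s →
                      PartialIso K L s f g → PartialIso K L r f g
PartialIso-antitone l p = record
  { ⊑-⇔  = ⊑-⇔
  ; sim  = λ q → Sim-antitone l (sim q)
  ; closed = closed
  }
  where
  open PartialIso p

module _ (K : PrefixOrder n) where
  open PrefixOrder K

  ≋-refl : ∀ {x} → x ≋ x
  ≋-refl = ⊑-refl , ⊑-refl

  ⋏-absorb : ∀ {x y} → x ⊑ y → x ≋ x ⋏ y
  ⋏-absorb p = ⋏-greatest ⊑-refl p , ⋏-lowerˡ _ _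

  ⋏-comm : ∀ x y → x ⋏ y ≋ y ⋏ x
  ⋏-comm x y = ⋏-greatest (⋏-lowerʳ x y) (⋏-lowerˡ x y) , ⋏-greatest (⋏-lowerʳ y x) (⋏-lowerˡ y x)

  ≋-trans : ∀ {x y z} → x ≋ y → y ≋ z → x ≋ z
  ≋-trans (p , q) (p′ , q′) = ⊑-trans p p′ , ⊑-trans q′ q

  ⋏-cong : ∀ {x x′ y y′} → x ≋ x′ → y ≋ y′ → x ⋏ y ≋ x′ ⋏ y′
  ⋏-cong (p , q) (p′ , q′) =
    ⋏-greatest (⊑-trans (⋏-lowerˡ _ _) p) (⊑-trans (⋏-lowerʳ _ _) p′) ,
    ⋏-greatest (⊑-trans (⋏-lowerˡ _ _) q) (⊑-trans (⋏-lowerʳ _ _) q′)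

  -- `c` and `b ⋏ x` are comparable, both being below `b`; `c ⊑ b ⋏ x` would put `c` below `x`.
  -- Hence `b ⋏ x` is already below `c`.
  ≋-⋏-below : ∀ {x b c k} → c ⊑ b → k ≋ b ⋏ x → ¬ c ⊑ x → k ≋ c ⋏ x
  ≋-⋏-below {x} {b} {c} {k} c⊑b (p , q) ¬c⊑x = ⋏-greatest k⊑c k⊑x ,
    ⊑-trans (⋏-greatest (⊑-trans (⋏-lowerˡ c x) c⊑b) (⋏-lowerʳ c x)) q
    where
    k⊑x : k ⊑ x
    k⊑x = ⊑-trans p (⋏-lowerʳ b x)
    k⊑c : k ⊑ c
    k⊑c with ⊑-linear (⊑-trans p (⋏-lowerˡ b x)) c⊑b
    ... | inj₁ l = l
    ... | inj₂ l = contradiction (⊑-trans l k⊑x) ¬c⊑x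

module _ {K L : PrefixOrder n} where
  private
    module K = PrefixOrder K
    module L = PrefixOrder L

  PartialIso-insert : ∀ {f : Vector (Point K) m} {g c c′} → PartialIso K L r f g →
    (∀ i → f i K.⊑ c ⇔ g i L.⊑ c′) → (∀ i → c K.⊑ f i ⇔ c′ L.⊑ g i) →
    (∀ i → f i K.⊑ c → Sim K L r (f i) c (g i) c′) →
    (∀ i → c K.⊑ f i → Sim K L r c (f i) c′ (g i)) →
    (∀ i → ∃[ k ] (c ◂ f) k K.≋ c K.⋏ f i × (c′ ◂ g) k L.≋ c′ L.⋏ g i) →
    PartialIso K L r (c ◂ f) (c′ ◂ g)
  PartialIso-insert {m = m} {r = r} {f} {g} {c} {c′} p below above sim-below sim-above meets = record
    { ⊑-⇔  = λ {i} {j} → order i j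
    ; sim  = λ {i} {j} → sims i j
    ; closed = meet′
    }
    where
    open PartialIso p

    order : ∀ i j → (c ◂ f) i K.⊑ (c ◂ f) j ⇔ (c′ ◂ g) i L.⊑ (c′ ◂ g) j
    order zero    zero    = mk⇔ (λ _ → L.⊑-refl) (λ _ → K.⊑-refl)
    order zero    (suc j) = above j
    order (suc i) zero    = below i
    order (suc i) (suc j) = ⊑-⇔

    sims : ∀ i j → (c ◂ f) i K.⊑ (c ◂ f) j →
           Sim K L r ((c ◂ f) i) ((c ◂ f) j) ((c′ ◂ g) i) ((c′ ◂ g) j)
    sims zero    zero    _ = Sim-empty (λ (_ , ¬p) → ¬p K.⊑-refl) (λ (_ , ¬p) → ¬p L.⊑-refl)
    sims zero    (suc j) q = sim-above j q
    sims (suc i) zero    q = sim-below i q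
    sims (suc i) (suc j) q = sim q

    meet′ : ∀ i j → ∃[ k ] (c ◂ f) k K.≋ (c ◂ f) i K.⋏ (c ◂ f) j ×
                           (c′ ◂ g) k L.≋ (c′ ◂ g) i L.⋏ (c′ ◂ g) j
    meet′ zero    zero    = zero , ⋏-absorb K K.⊑-refl , ⋏-absorb L L.⊑-refl
    meet′ zero    (suc j) = meets j
    meet′ (suc i) zero    = let (k , e , e′) = meets i in
      k , ≋-trans K e (⋏-comm K c (f i)) , ≋-trans L e′ (⋏-comm L c′ (g i))
    meet′ (suc i) (suc j) = let (k , e) = closed i j in suc k , e

module Extension (em : ExcludedMiddle 0ℓ) where
  open FiniteMax em
  open Intervals em

  module _ {K L : PrefixOrder n} where
    private
      module K = PrefixOrder K
      module L = PrefixOrder L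

    PartialIso-repeat : ∀ {f : Vector (Point K) m} {g c} → PartialIso K L r f g →
                        ∀ j → c K.≋ f j → PartialIso K L r (c ◂ f) (g j ◂ g)
    PartialIso-repeat p j (c⊑ , ⊑c) = PartialIso-insert p
      (λ i → mk⇔ (λ q → to ⊑-⇔ (K.⊑-trans q c⊑)) (λ q → K.⊑-trans (from ⊑-⇔ q) ⊑c))
      (λ i → mk⇔ (λ q → to ⊑-⇔ (K.⊑-trans ⊑c q)) (λ q → K.⊑-trans c⊑ (from ⊑-⇔ q)))
      (λ i q → Sim-trans (Sim-≋ (≋-refl K) (c⊑ , ⊑c)) (sim (K.⊑-trans q c⊑)))
      (λ i q → Sim-trans (Sim-≋ (c⊑ , ⊑c) (≋-refl K)) (sim (K.⊑-trans ⊑c q)))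
      (λ i → let (k , (e₁ , e₂) , e′) = closed j i in suc k ,
         (K.⋏-greatest (K.⊑-trans e₁ (K.⊑-trans (K.⋏-lowerˡ _ _) ⊑c))
                       (K.⊑-trans e₁ (K.⋏-lowerʳ _ _)) ,
          K.⊑-trans (K.⋏-greatest (K.⊑-trans (K.⋏-lowerˡ _ _) c⊑) (K.⋏-lowerʳ _ _)) e₂) ,
         e′)
      where
      open PartialIso p

    -- A point that is really new has nearest old neighbors `f a` below and `f b` above. One move of
    -- the game between them answers it, and its intervals to all other old points pass through
    -- `f a` or `f b`.
    PartialIso-between : ∀ {f : Vector (Point K) m} {g c} → PartialIso K L (2 ℕ.+ r) f g →
                         ∀ {i j} → f i K.⊑ c → c K.⊑ f j →
                         ∃[ c′ ] PartialIso K L (1 ℕ.+ r) (c ◂ f) (c′ ◂ g)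
    PartialIso-between {r = r} {f = f} {g} {c} p {i₀} {j₀} l u
      with em {∃[ k ] c K.≋ f k}
    ... | yes (k , e) = g k , PartialIso-antitone (ℕ.n≤1+n _) (PartialIso-repeat p k e)
    ... | no new
      with finite-max (λ i → f i K.⊑ c) (λ i j → f i K.⊑ f j) K.⊑-refl K.⊑-trans K.⊑-linear (i₀ , l)
         | finite-max (λ j → c K.⊑ f j × f j K.⊑ f j₀) (λ i j → f j K.⊑ f i) K.⊑-refl
             (λ q q′ → K.⊑-trans q′ q) (λ (_ , q) (_ , q′) → K.⊑-linear q′ q) (j₀ , u , K.⊑-refl)
    ... | a , a⊑c , a-max | b , (c⊑b , b⊑j₀) , b-min′ =
      split (PartialIso.sim p (K.⊑-trans a⊑c c⊑b))
      where
      open PartialIso p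

      meet-above : ∀ i {k} → f k K.≋ f b K.⋏ f i → c K.⊑ f k → c K.⊑ f i
      meet-above i (e , _) q = K.⊑-trans q (K.⊑-trans e (K.⋏-lowerʳ _ _))

      -- Old points above `c` need not form a chain, so `b` was chosen least only among those below
      -- `f j₀`. For any other `f i` above `c`, the meet with `f b` is an old point in that chain.
      b-min : ∀ {i} → c K.⊑ f i → f b K.⊑ f i
      b-min {i} q =
        let (k , (e₁ , e₂) , _) = closed b i
            k⊑b = K.⊑-trans e₁ (K.⋏-lowerˡ _ _)
        in K.⊑-trans (b-min′ (K.⊑-trans (K.⋏-greatest c⊑b q) e₂ , K.⊑-trans k⊑b b⊑j₀))
                     (K.⊑-trans e₁ (K.⋏-lowerʳ _ _))

      a⊏c : f a K.⊏ c
      a⊏c = a⊑c , λ q → new (a , q , a⊑c)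

      c⊏b : c K.⊏ f b
      c⊏b = c⊑b , λ q → new (b , c⊑b , q)

      split : Sim K L (2 ℕ.+ r) (f a) (f b) (g a) (g b) →
              ∃[ c′ ] PartialIso K L (1 ℕ.+ r) (c ◂ f) (c′ ◂ g)
      split (step forth _) with forth a⊑c (proj₂ (K.Dir-exists c⊏b))
      ... | c′ , a⊑c′ , d′ , sim-a , sim-b =
        c′ , PartialIso-insert (PartialIso-antitone (ℕ.n≤1+n _) p) below above sim-below sim-above meets
        where
        c′⊏b : c′ L.⊏ g b
        c′⊏b = L.Dir⇒⊏ d′

        a⊏c′ : g a L.⊏ c′
        a⊏c′ = Sim-⊏ sim-a a⊏c

        below : ∀ i → f i K.⊑ c ⇔ g i L.⊑ c′
        below i = mk⇔ (λ q → L.⊑-trans (to ⊑-⇔ (a-max q)) a⊑c′) bwd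
          where
          bwd : g i L.⊑ c′ → f i K.⊑ c
          bwd q with K.⊑-linear (from ⊑-⇔ (L.⊑-trans q (proj₁ c′⊏b))) c⊑b
          ... | inj₁ q′ = q′
          ... | inj₂ q′ = contradiction (L.⊑-trans (to ⊑-⇔ (b-min q′)) q) (proj₂ c′⊏b)

        above : ∀ i → c K.⊑ f i ⇔ c′ L.⊑ g i
        above i = mk⇔ (λ q → L.⊑-trans (proj₁ c′⊏b) (to ⊑-⇔ (b-min q))) bwd
          where
          -- The old meet of `f b` and `f i` is comparable with `c`. Were it below `c`, it would be
          -- below `f a`, and `c′`, being below `g b` and `g i`, would be below `g a`.
          bwd : c′ L.⊑ g i → c K.⊑ f i
          bwd q with closed b i
          ... | k , e , e′ with K.⊑-linear c⊑b (K.⊑-trans (proj₁ e) (K.⋏-lowerˡ _ _))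
          ...   | inj₁ q′ = meet-above i {k} e q′
          ...   | inj₂ q′ = contradiction
            (L.⊑-trans (L.⋏-greatest (proj₁ c′⊏b) q) (L.⊑-trans (proj₂ e′) (to ⊑-⇔ (a-max q′))))
            (proj₂ a⊏c′)

        sim-below : ∀ i → f i K.⊑ c → Sim K L (1 ℕ.+ r) (f i) c (g i) c′
        sim-below i q = Sim-+ (a-max q) a⊑c (to ⊑-⇔ (a-max q)) a⊑c′ (Sim-pred (sim (a-max q))) sim-a

        sim-above : ∀ i → c K.⊑ f i → Sim K L (1 ℕ.+ r) c (f i) c′ (g i)
        sim-above i q = Sim-+ c⊑b (b-min q) (proj₁ c′⊏b) (to ⊑-⇔ (b-min q)) sim-b (Sim-pred (sim (b-min q)))

        meets : ∀ i → ∃[ k ] (c ◂ f) k K.≋ c K.⋏ f i × (c′ ◂ g) k L.≋ c′ L.⋏ g i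
        meets i with em {c K.⊑ f i}
        ... | yes q = zero , ⋏-absorb K q , ⋏-absorb L (to (above i) q)
        ... | no ¬q = let (k , e , e′) = closed b i in
          suc k , ≋-⋏-below K c⊑b e ¬q , ≋-⋏-below L (proj₁ c′⊏b) e′ (λ q → ¬q (from (above i) q))

-- The reserve of two rounds lets Position preserve strict inequalities and directions.
record Position {n} (K L : PrefixOrder n) (r : ℕ) {k}
                (u : Vector (Point K) k) (v : Vector (Point L) k) : Set where
  private
    module K = PrefixOrder K
    module L = PrefixOrder L
  field
    {size} : ℕ
    {f}    : Vector (Point K) size
    {g}    : Vector (Point L) size
    iso    : PartialIso K L (2 ℕ.+ r) f g
    track  : ∀ i → ∃[ j ] u i K.≋ f j × v i L.≋ g j

Position-sym : ∀ {K L : PrefixOrder n} {u : Vector (Point K) k} {v} →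
               Position K L r u v → Position L K r v u
Position-sym p = record
  { iso   = PartialIso-sym iso
  ; track = λ i → let (j , e , e′) = track i in j , e′ , e
  }
  where
  open Position p

Position-antitone : ∀ {K L : PrefixOrder n} {u : Vector (Point K) k} {v} → r ℕ.≤ s →
                    Position K L s u v → Position K L r u v
Position-antitone l p = record
  { iso   = PartialIso-antitone (s≤s (s≤s l)) iso
  ; track = track
  }
  where
  open Position p

module _ {K L : PrefixOrder n} where
  private
    module K = PrefixOrder K
    module L = PrefixOrder L

  Position-select : ∀ {k′} {u : Vector (Point K) k} {v} {u′ : Vector (Point K) k′} {v′} →
                    Position K L r u v → (∀ i → ∃[ j ] u′ i K.≋ u j × v′ i L.≋ v j) →
                    Position K L r u′ v′
  Position-select p t = record
    { iso   = iso
    ; track = λ i → let (j , e₁ , e₂) = t i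
                        (k , e₃ , e₄) = track j
                    in k , ≋-trans K e₁ e₃ , ≋-trans L e₂ e₄
    }
    where
    open Position p

  Position-⊑ : ∀ {u : Vector (Point K) k} {v} → Position K L r u v →
               ∀ i j → u i K.⊑ u j ⇔ v i L.⊑ v j
  Position-⊑ p i j =
    let (_ , (a , a′) , (b , b′)) = track i
        (_ , (c , c′) , (d , d′)) = track j
    in mk⇔ (λ q → L.⊑-trans b (L.⊑-trans (to ⊑-⇔ (K.⊑-trans a′ (K.⊑-trans q c))) d′))
           (λ q → K.⊑-trans a (K.⊑-trans (from ⊑-⇔ (L.⊑-trans b′ (L.⊑-trans q d))) c′))
    where
    open Position p
    open PartialIso iso

  Position-⊏ : ∀ {u : Vector (Point K) k} {v} → Position K L r u v →
               ∀ i j → u i K.⊏ u j ⇔ v i L.⊏ v j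
  Position-⊏ p i j = Position-⊑ p i j ×-⇔ →-cong-⇔ (Position-⊑ p j i) (⇔-id _)

  Position-≋ : ∀ {u : Vector (Point K) k} {v} → Position K L r u v →
               ∀ i j → u i K.≋ u j ⇔ v i L.≋ v j
  Position-≋ p i j = Position-⊑ p i j ×-⇔ Position-⊑ p j i

  Position-sim : ∀ {u : Vector (Point K) k} {v} → Position K L r u v →
                 ∀ i j → u i K.⊑ u j → Sim K L (2 ℕ.+ r) (u i) (u j) (v i) (v j)
  Position-sim p i j q =
    let (_ , e₁ , e₂) = track i
        (_ , e₃ , e₄) = track j
    in Sim-trans (Sim-≋ e₁ e₃)
         (Sim-trans (sim (K.⊑-trans (proj₂ e₁) (K.⊑-trans q (proj₁ e₃)))) (Sim-≋ (swap e₂) (swap e₄)))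
    where
    open Position p
    open PartialIso iso

module Positions (em : ExcludedMiddle 0ℓ) where
  open Extension em
  open Intervals em

  Position-Dir-⇒ : ∀ {K L : PrefixOrder n}
                   {u : Vector (Point K) k} {v} → Position K L r u v →
                   ∀ i j {a} → PrefixOrder.Dir K a (u i) (u j) → PrefixOrder.Dir L a (v i) (v j)
  Position-Dir-⇒ {K = K} p i j d =
    Sim-first (Sim-antitone (s≤s (s≤s z≤n)) (Position-sim p i j (proj₁ (PrefixOrder.Dir⇒⊏ K d)))) d

  module _ {K L : PrefixOrder n} where
    private
      module K = PrefixOrder K
      module L = PrefixOrder L

    Position-Dir : ∀ {u : Vector (Point K) k} {v} → Position K L r u v →
                   ∀ i j {a} → K.Dir a (u i) (u j) ⇔ L.Dir a (v i) (v j)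
    Position-Dir p i j = mk⇔ (Position-Dir-⇒ p i j) (Position-Dir-⇒ (Position-sym p) i j)

    Position-between : ∀ {u : Vector (Point K) k} {v c} → Position K L (suc r) u v →
                       ∀ i j → u i K.⊑ c → c K.⊑ u j → ∃[ c′ ] Position K L r (c ◂ u) (c′ ◂ v)
    Position-between {r = r} {u = u} {v} {c} p i j l h =
      let (_ , (_ , l′) , _) = track i
          (_ , (h′ , _) , _) = track j
          (c′ , iso′) = PartialIso-between iso (K.⊑-trans l′ l) (K.⊑-trans h h′)
      in c′ , record { iso = iso′ ; track = track′ c′ }
      where
      open Position p
      track′ : ∀ c′ i → ∃[ j ] (c ◂ u) i K.≋ (c ◂ f) j × (c′ ◂ v) i L.≋ (c′ ◂ g) j
      track′ c′ zero    = zero , ≋-refl K , ≋-refl L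
      track′ c′ (suc i) = let (j , e) = track i in suc j , e

  Position-start : ∀ {K L : PrefixOrder n}
                   {x y x′ y′} → K ⊢ x ⊏ y → L ⊢ x′ ⊏ y′ → Sim K L (2 ℕ.+ r) x y x′ y′ →
                   Position K L r (x ◂ y ◂ ⟨⟩) (x′ ◂ y′ ◂ ⟨⟩)
  Position-start {K = K} {L} {x} {y} {x′} {y′} (p , ¬p) (q , ¬q) s = record
    { iso   = PartialIso-insert (PartialIso-insert none (λ ()) (λ ()) (λ ()) (λ ()) (λ ()))
        (λ { 0F → mk⇔ (λ p′ → contradiction p′ ¬p) (λ q′ → contradiction q′ ¬q) })
        (λ { 0F → mk⇔ (λ _ → q) (λ _ → p) })
        (λ { 0F p′ → contradiction p′ ¬p })
        (λ { 0F _ → s })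
        (λ { 0F → 0F , ⋏-absorb K p , ⋏-absorb L q })
    ; track = λ i → i , ≋-refl K , ≋-refl L
    }
    where
    none : PartialIso K L (2 ℕ.+ _) ⟨⟩ ⟨⟩
    none = record { ⊑-⇔ = λ {} ; sim = λ {} ; closed = λ () }

-- Intervals as colored orders

-- An isomorphism up to `≋` between `A` and the interval from `x` to `y`. It covers segments of a
-- tree as well as abstract ordinals, whose elements are not points of a prefix order.
record Presents {n} (A : Structure (ℒ-col n)) (K : PrefixOrder n) (x y : Point K) : Set where
  private
    module A = Structure A
  open PrefixOrder K hiding (Point)
  field
    point : A.Carrier → Point K
    lower : ∀ a → x ⊑ point a
    upper : ∀ a → point a ⊏ y
    onto  : ∀ {z} → x ⊑ z → z ⊏ y → ∃[ a ] point a ≋ z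
    ≈-⇔   : ∀ {a b} → a A.≈ b ⇔ point a ≋ point b
    lt-⇔  : ∀ {as} → A.pr lt as ⇔ point (as 0F) ⊏ point (as 1F)
    col-⇔ : ∀ {i as} → A.pr (col i) as ⇔ Dir i (point (as 0F)) y

module _ (K : PrefixOrder n) (x y : Point K) where
  open PrefixOrder K using (_⊑_; _⊏_; _≋_; Dir; Dir-mono; Dir-respˡ; ⊑-refl; ⊑-⊏-trans; ⊏-⊑-trans)

  Seg : Structure (ℒ-col n)
  Seg = record
    { Carrier       = Σ[ z ∈ Point K ] x ⊑ z × z ⊏ y
    ; _≈_           = λ a b → proj₁ a ≋ proj₁ b
    ; ≈-equivalence = record
      { refl = ≋-refl K ; sym = swap ; trans = ≋-trans K }
    ; func          = λ ()
    ; pr            = λ where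
        lt      as → proj₁ (as 0F) ⊏ proj₁ (as 1F)
        (col i) as → Dir i (proj₁ (as 0F)) y
    ; func-cong     = λ ()
    ; pr-cong       = λ where
        lt      e p → ⊑-⊏-trans (proj₂ (e 0F)) (⊏-⊑-trans p (proj₁ (e 1F)))
        (col i) e d → Dir-respˡ (e 0F) d
    }

  Seg-presents : Presents Seg K x y
  Seg-presents = record
    { point = proj₁
    ; lower = proj₁ ∘ proj₂
    ; upper = proj₂ ∘ proj₂
    ; onto  = λ p q → (_ , p , q) , ≋-refl K
    ; ≈-⇔   = ⇔-id _
    ; lt-⇔  = ⇔-id _
    ; col-⇔ = ⇔-id _
    }

module Segments (em : ExcludedMiddle 0ℓ) where
  open Positions em

  module _ {A B : Structure (ℒ-col n)} {K L : PrefixOrder n} {x y : Point K} {x′ y′ : Point L}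
           (PA : Presents A K x y) (PB : Presents B L x′ y′) where
    private
      module K = PrefixOrder K
      module L = PrefixOrder L
      module A = Presents PA
      module B = Presents PB

      -- The two ends are tracked along with the elements, so every new element lies between two
      -- tracked points.
      R : ℕ → ∀ {k} → Vector (Structure.Carrier A) k → Vector (Structure.Carrier B) k → Set
      R r ρ τ = Position K L r (y ◂ x ◂ A.point ∘ ρ) (y′ ◂ x′ ◂ B.point ∘ τ)

      module _ {ρ : Vector (Structure.Carrier A) k} {τ} (p : R r ρ τ) where

        push : ∀ {c c′ a b} → Position K L q (c ◂ y ◂ x ◂ A.point ∘ ρ) (c′ ◂ y′ ◂ x′ ◂ B.point ∘ τ) →
               A.point a K.≋ c → B.point b L.≋ c′ → R q (a ◂ ρ) (b ◂ τ)
        push p e e′ = Position-select p λ where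
          0F              → 1F , ≋-refl K , ≋-refl L
          1F              → 2F , ≋-refl K , ≋-refl L
          2F              → 0F , e , e′
          (suc (suc (suc i))) → suc (suc (suc i)) , ≋-refl K , ≋-refl L

      R-forth : ∀ {r k} {ρ : Vector (Structure.Carrier A) k} {τ} → R (suc r) ρ τ →
                ∀ a → ∃[ b ] R r (a ◂ ρ) (b ◂ τ)
      R-forth {r} {ρ = ρ} {τ} p a =
        let (c′ , p′) = Position-between p 1F 0F (A.lower a) (proj₁ (A.upper a))
            (b , e)   = B.onto (to (Position-⊑ p′ 2F 0F) (A.lower a)) (to (Position-⊏ p′ 0F 1F) (A.upper a))
        in b , push p p′ (≋-refl K) e

      R-back : ∀ {r k} {ρ : Vector (Structure.Carrier A) k} {τ} → R (suc r) ρ τ →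
               ∀ b → ∃[ a ] R r (a ◂ ρ) (b ◂ τ)
      R-back p b =
        let (c , p″) = Position-between (Position-sym p) 1F 0F (B.lower b) (proj₁ (B.upper b))
            p′       = Position-sym p″
            (a , e)  = A.onto (from (Position-⊑ p′ 2F 0F) (B.lower b)) (from (Position-⊏ p′ 0F 1F) (B.upper b))
        in a , push p p′ e (≋-refl L)

      R-≐ : ∀ {r k} {ρ : Vector (Structure.Carrier A) k} {τ} → R r ρ τ → ∀ s t →
            Sat A ρ (s ≐ t) ⇔ Sat B τ (s ≐ t)
      R-≐ p (var i) (var j) =
        ⇔-sym B.≈-⇔ ⇔-∘ (Position-≋ p (suc (suc i)) (suc (suc j)) ⇔-∘ A.≈-⇔)

      R-atom : ∀ {a k} {ρ : Vector (Structure.Carrier A) k} {τ} (s : ColPr n a)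
               (ts : Vector (Term (ℒ-col n) k) a) →
               R 0 ρ τ → Sat A ρ (atom s ts) ⇔ Sat B τ (atom s ts)
      R-atom {ρ = ρ} {τ} lt ts p = ⇔-sym B.lt-⇔ ⇔-∘ (lemma (ts 0F) (ts 1F) ⇔-∘ A.lt-⇔)
        where
        lemma : ∀ s t → A.point (eval A ρ s) K.⊏ A.point (eval A ρ t) ⇔
                        B.point (eval B τ s) L.⊏ B.point (eval B τ t)
        lemma (var i) (var j) = Position-⊏ p (suc (suc i)) (suc (suc j))
      R-atom {ρ = ρ} {τ} (col i) ts p = ⇔-sym B.col-⇔ ⇔-∘ (lemma (ts 0F) ⇔-∘ A.col-⇔)
        where
        lemma : ∀ s → K.Dir i (A.point (eval A ρ s)) y ⇔ L.Dir i (B.point (eval B τ s)) y′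
        lemma (var j) = Position-Dir p (suc (suc j)) 0F

    Sim⇒⊨ : x K.⊏ y → x′ L.⊏ y′ → (φ : Sentence (ℒ-col n)) →
            Sim K L (2 ℕ.+ weightedRank (λ _ → 0) φ) x y x′ y′ → (A ⊨ φ) ⇔ (B ⊨ φ)
    Sim⇒⊨ x<y x<y′ φ s =
      BackAndForth.agree R Position-antitone R-forth R-back R-≐ (λ _ → 0) R-atom φ
        (Position-select (Position-start x<y x<y′ s) λ where
          0F → 1F , ≋-refl K , ≋-refl L
          1F → 0F , ≋-refl K , ≋-refl L)

-- First-order formulas for the interval tests

at-or-above strictly-below : Maybe (Fin k) → Formula (ℒ-col n) (suc k)
at-or-above nothing     = ⊥′ ⇒′ ⊥′
at-or-above (just j)    = ¬′ atom lt (var 0F ◂ var (suc j) ◂ ⟨⟩)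
strictly-below nothing  = ⊥′ ⇒′ ⊥′
strictly-below (just j) = atom lt (var 0F ◂ var (suc j) ◂ ⟨⟩)

-- The test t at the interval [l , r), where nothing stands for the respective end of the structure.
formula : Test n → (l r : Maybe (Fin k)) → Formula (ℒ-col n) k
formula ⊤ᵗ         l r = ⊥′ ⇒′ ⊥′
formula (¬ᵗ t)     l r = ¬′ formula t l r
formula (s ∧ᵗ t)   l r = formula s l r ∧′ formula t l r
formula (∃ᵗ i s t) l r = ∃′
  (at-or-above l ∧′ strictly-below r ∧′ atom (col i) (var 0F ◂ ⟨⟩) ∧′
   formula s (Maybe.map suc l) (just 0F) ∧′ formula t (just 0F) (Maybe.map suc r))

max-rank : List (Test n) → ℕ
max-rank []       = 0
max-rank (t ∷ ts) = rank (formula {k = 0} t nothing nothing) ℕ.⊔ max-rank ts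

rank≤max-rank : ∀ {t : Test n} {ts} → t ∈ ts → rank (formula {k = 0} t nothing nothing) ℕ.≤ max-rank ts
rank≤max-rank {ts = t ∷ ts} (here refl) = ℕ.m≤m⊔n _ (max-rank ts)
rank≤max-rank {ts = t ∷ ts} (there t∈)  = ℕ.≤-trans (rank≤max-rank t∈) (ℕ.m≤n⊔m _ (max-rank ts))

module Formulas (em : ExcludedMiddle 0ℓ) where
  open Intervals em
  open Tests em

  module _ {K : PrefixOrder n} {x y : Point K} where
    open PrefixOrder K hiding (Point)
    private
      module S = Structure (Seg K x y)

    end : Point K → Vector S.Carrier k → Maybe (Fin k) → Point K
    end z ρ = maybe (λ j → proj₁ (ρ j)) z

    private
      end-suc : ∀ {z z′} {ρ : Vector S.Carrier k} {a} l → end z ρ l ≡ z′ →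
                end z (a ◂ ρ) (Maybe.map suc l) ≡ z′
      end-suc nothing  e = e
      end-suc (just j) e = e

    formula-⇔ : ∀ (t : Test n) {ρ : Vector S.Carrier k} {l r a b} → end x ρ l ≡ a → end y ρ r ≡ b →
                Sat (Seg K x y) ρ (formula t l r) ⇔ Holds K t a b
    formula-⇔ ⊤ᵗ       e e′ = mk⇔ _ (λ _ ())
    formula-⇔ (¬ᵗ t)   e e′ = →-cong-⇔ (formula-⇔ t e e′) (⇔-id _)
    formula-⇔ (s ∧ᵗ t) e e′ = formula-⇔ s e e′ ×-⇔ formula-⇔ t e e′
    formula-⇔ (∃ᵗ i s t) {ρ} {l} {r} refl refl = mk⇔
      (λ ((z , p , q) , f , g , d , hs , ht) →
         z , to (from-⇔ l) f , Dir-cut (to (to-⇔ r) g) (end⊑ r) d ,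
         to (formula-⇔ s (end-suc l refl) refl) hs , to (formula-⇔ t refl (end-suc r refl)) ht)
      (λ (z , p , d , hs , ht) →
         (z , ⊑-trans (⊑end l) p , ⊏-⊑-trans (Dir⇒⊏ d) (end⊑ r)) ,
         from (from-⇔ l) p , from (to-⇔ r) (Dir⇒⊏ d) , Dir-mono d (end⊑ r) ,
         from (formula-⇔ s (end-suc l refl) refl) hs , from (formula-⇔ t refl (end-suc r refl)) ht)
      where
      ⊑end : ∀ l → x ⊑ end x ρ l
      ⊑end nothing  = ⊑-refl
      ⊑end (just j) = proj₁ (proj₂ (ρ j))

      end⊑ : ∀ r → end y ρ r ⊑ y
      end⊑ nothing  = ⊑-refl
      end⊑ (just j) = proj₁ (proj₂ (proj₂ (ρ j)))

      -- The formula can only deny that the point is strictly below the left end. This amounts to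
      -- being at or above it because both lie below `y` and are therefore comparable.
      from-⇔ : ∀ l {c} → Sat (Seg K x y) (c ◂ ρ) (at-or-above l) ⇔ (end x ρ l ⊑ proj₁ c)
      from-⇔ nothing {_ , p , _} = mk⇔ (λ _ → p) (λ _ ())
      from-⇔ (just j) {_ , _ , q} = mk⇔
        (λ ¬p → case (⊑∨⊏ K (proj₁ (proj₂ (proj₂ (ρ j)))) (proj₁ q)) ¬p)
        (λ p s → proj₂ s p)
        where
        case : ∀ {u v} → u ⊑ v ⊎ v ⊏ u → ¬ v ⊏ u → u ⊑ v
        case (inj₁ p) _  = p
        case (inj₂ p) ¬p = contradiction p ¬p

      to-⇔ : ∀ r {c} → Sat (Seg K x y) (c ◂ ρ) (strictly-below r) ⇔ (proj₁ c ⊏ end y ρ r)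
      to-⇔ nothing {_ , _ , q} = mk⇔ (λ _ → q) (λ _ ())
      to-⇔ (just j) = ⇔-id _

  -- The finitely many tests that decide `q` rounds are expressed by sentences, and `max-rank`
  -- bounds the ranks of these.
  ≡[]⇒Sim : ∀ {K L : PrefixOrder n} {x y x′ y′} →
            Seg K x y ≡[ max-rank (tests n q) ] Seg L x′ y′ → Sim K L q x y x′ y′
  ≡[]⇒Sim e = agree⇒Sim λ {t} t∈ →
    formula-⇔ t refl refl ⇔-∘ (e (formula t nothing nothing) (rank≤max-rank t∈) ⇔-∘
    ⇔-sym (formula-⇔ t refl refl))

-- Tree-like structures

module _ {L : Language} (M : Structure L) where
  open Structure M

  pr-⇔ : ∀ {a} (r : Language.Pr L a) {xs ys : Vector Carrier a} →
         (∀ i → xs i ≈ ys i) → pr r xs ⇔ pr r ys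
  pr-⇔ r e = mk⇔ (pr-cong r e) (pr-cong r (≈.sym ∘ e))

  -- Vectors are functions, so a vector is not definitionally the list of its entries. Congruence of
  -- the predicates bridges the gap.
  ◂-η₂ : (xs : Vector Carrier 2) → ∀ i → xs i ≈ (xs 0F ◂ xs 1F ◂ ⟨⟩) i
  ◂-η₂ xs 0F = ≈.refl
  ◂-η₂ xs 1F = ≈.refl

  pr-η₂ : (r : Language.Pr L 2) {xs : Vector Carrier 2} → pr r xs ⇔ pr r (xs 0F ◂ xs 1F ◂ ⟨⟩)
  pr-η₂ r = pr-⇔ r (◂-η₂ _)

record TreeLike {n} (M : Structure (ℒ-rel n)) : Set where
  open Structure M
  infix 4 _⊑_
  infixr 7 _⋏_

  _⊑_ : Carrier → Carrier → Set
  x ⊑ y = pr sub (x ◂ y ◂ ⟨⟩)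

  E : Fin n → Carrier → Carrier → Set
  E i x y = pr (edge i) (x ◂ y ◂ ⟨⟩)

  field
    ⊑-refl       : ∀ {x} → x ⊑ x
    ⊑-antisym    : ∀ {x y} → x ⊑ y → y ⊑ x → x ≈ y
    ⊑-trans      : ∀ {x y z} → x ⊑ y → y ⊑ z → x ⊑ z
    ⊑-linear     : ∀ {x y z} → x ⊑ z → y ⊑ z → x ⊑ y ⊎ y ⊑ x
    _⋏_          : Carrier → Carrier → Carrier
    ⋏-lowerˡ     : ∀ x y → x ⋏ y ⊑ x
    ⋏-lowerʳ     : ∀ x y → x ⋏ y ⊑ y
    ⋏-greatest   : ∀ {x y z} → z ⊑ x → z ⊑ y → z ⊑ x ⋏ y
    E-functional : ∀ {i x y z} → E i x y → E i x z → y ≈ z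
    E-⊏          : ∀ {i x y} → E i x y → x ⊑ y × ¬ x ≈ y
    E-immediate  : ∀ {i x y z} → E i x y → x ⊑ z × ¬ x ≈ z → ¬ (z ⊑ y × ¬ z ≈ y)
    E-separate   : ∀ {i j x y z} → i ≢ j → E i x y → E j x z → ¬ y ≈ z
    E-branch     : ∀ {x y} → x ⊑ y × ¬ x ≈ y → ∃[ i ] ∃[ z ] E i x z × z ⊑ y

  private
    ≈⇒⊑ : ∀ {x y} → x ≈ y → x ⊑ y
    ≈⇒⊑ e = pr-cong sub (λ { 0F → ≈.refl ; 1F → e }) ⊑-refl

    E-resp : ∀ {i x x′ y y′} → x ≈ x′ → y ≈ y′ → E i x y → E i x′ y′
    E-resp e e′ = pr-cong (edge _) λ { 0F → e ; 1F → e′ }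

    -- Different labels would give different successors, and then `u` would lie strictly between `x`
    -- and its immediate successor `v`.
    unique : ∀ {i j x u v} → E i x u → E j x v → u ⊑ v → i ≡ j
    unique {i} {j} e e′ l with i Fin.≟ j
    ... | yes p = p
    ... | no ¬p = contradiction (l , E-separate ¬p e e′) (E-immediate e′ (E-⊏ e))

  prefixOrder : PrefixOrder n
  prefixOrder = record
    { Point      = Carrier
    ; _⊑_        = _⊑_
    ; ⊑-refl     = ⊑-refl
    ; ⊑-trans    = ⊑-trans
    ; ⊑-linear   = ⊑-linear
    ; _⋏_        = _⋏_
    ; ⋏-lowerˡ   = ⋏-lowerˡ
    ; ⋏-lowerʳ   = ⋏-lowerʳ
    ; ⋏-greatest = ⋏-greatest
    -- This is the condition by which `relativize` translates the color `col i`.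
    ; Dir        = λ i x y → ∃[ u ] E i x u × u ⊑ y
    ; Dir⇒⊏      = λ (u , e , l) → ⊑-trans (proj₁ (E-⊏ e)) l ,
                     λ y⊑x → proj₂ (E-⊏ e) (⊑-antisym (proj₁ (E-⊏ e)) (⊑-trans l y⊑x))
    ; Dir-exists = λ (l , ¬l) → E-branch (l , λ e → ¬l (≈⇒⊑ (≈.sym e)))
    ; Dir-unique = λ (u , e , l) (v , e′ , l′) → case (⊑-linear l l′) e e′
    ; Dir-mono   = λ (u , e , l) l′ → u , e , ⊑-trans l l′
    ; Dir-respˡ  = λ (l , l′) (u , e , m) → u , E-resp (⊑-antisym l l′) ≈.refl e , m
    }
    where
    case : ∀ {i j x u v} → u ⊑ v ⊎ v ⊑ u → E i x u → E j x v → i ≡ j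
    case (inj₁ l) e e′ = unique e e′ l
    case (inj₂ l) e e′ = sym (unique e′ e l)

  open PrefixOrder prefixOrder public using (_⊏_; _≋_; Dir; Dir⇒⊏; ⊏-⊑-trans)

  ≈-⇔-≋ : ∀ {x y} → x ≈ y ⇔ x ≋ y
  ≈-⇔-≋ = mk⇔ (λ e → ≈⇒⊑ e , ≈⇒⊑ (≈.sym e)) (λ (l , l′) → ⊑-antisym l l′)

  ⊏-⇔ : ∀ {x y} → (x ⊑ y × ¬ x ≈ y) ⇔ x ⊏ y
  ⊏-⇔ = mk⇔ (λ (l , ¬e) → l , λ l′ → ¬e (⊑-antisym l l′))
            (λ (l , ¬l) → l , λ e → ¬l (≈⇒⊑ (≈.sym e)))

  -- Both points lie above the one `i`-successor of `x`. Thus points that leave `x` in the same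
  -- direction have their meet strictly above `x`.
  Dir-common : ∀ {i x y z} → Dir i x y → Dir i x z → ∃[ u ] x ⊏ u × u ⊑ y × u ⊑ z
  Dir-common (u , e , l) (v , e′ , l′) =
    u , to ⊏-⇔ (E-⊏ e) , l , ⊑-trans (≈⇒⊑ (E-functional e e′)) l′

  -- Positions control only the order and the directions; this expresses the edges in those terms.
  E-⇔ : ExcludedMiddle 0ℓ → ∀ {i x y} → E i x y ⇔ (Dir i x y × ¬ (∃[ z ] x ⊏ z × z ⊏ y))
  E-⇔ em {i} {x} {y} = mk⇔
    (λ e → (y , e , ⊑-refl) , λ (z , l , l′) → E-immediate e (from ⊏-⇔ l) (from ⊏-⇔ l′))
    bwd
    where
    bwd : Dir i x y × ¬ (∃[ z ] x ⊏ z × z ⊏ y) → E i x y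
    bwd ((u , e , l) , none) with em {y ⊑ u}
    ... | yes l′ = E-resp ≈.refl (⊑-antisym l l′) e
    ... | no ¬l′ = contradiction (u , to ⊏-⇔ (E-⊏ e) , l , ¬l′) none

  module _ {x y : Carrier} where

    private
      extend : ∀ {ρ : Vector (Structure.Carrier (Seg prefixOrder x y)) k} {τ : Vector Carrier (k ℕ.+ 2)} {c} →
               (∀ i → τ (i ↑ˡ 2) ≡ proj₁ (ρ i)) → ∀ i → (proj₁ c ◂ τ) (i ↑ˡ 2) ≡ proj₁ ((c ◂ ρ) i)
      extend e zero    = refl
      extend e (suc i) = e i

    relativize-⇔ : (φ : Formula (ℒ-col n) k) {ρ : Vector (Structure.Carrier (Seg prefixOrder x y)) k}
                   {τ : Vector Carrier (k ℕ.+ 2)} → (∀ i → τ (i ↑ˡ 2) ≡ proj₁ (ρ i)) →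
                   τ (k ↑ʳ 0F) ≡ x → τ (k ↑ʳ 1F) ≡ y →
                   Sat M τ (relativize φ) ⇔ Sat (Seg prefixOrder x y) ρ φ
    relativize-⇔ (atom lt ts) {ρ} {τ} e e₀ e₁ with ts 0F | ts 1F
    ... | var i | var j rewrite sym (e i) | sym (e j) =
      ⊏-⇔ ⇔-∘ (pr-η₂ M sub ×-⇔ ⇔-id _)
    relativize-⇔ {k} (atom (col i) ts) {ρ} {τ} e e₀ e₁ with ts 0F
    ... | var j rewrite sym (e j) | sym e₁ =
      mk⇔ (λ (u , p , p′) → u , to (pr-η₂ M (edge i)) p , to (pr-η₂ M sub) p′)
          (λ (u , p , p′) → u , from (pr-η₂ M (edge i)) p , from (pr-η₂ M sub) p′)
    relativize-⇔ (var i ≐ var j) {ρ} {τ} e e₀ e₁ rewrite sym (e i) | sym (e j) = ≈-⇔-≋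
    relativize-⇔ ⊥′       e e₀ e₁ = ⇔-id _
    relativize-⇔ (φ ∧′ ψ) e e₀ e₁ = relativize-⇔ φ e e₀ e₁ ×-⇔ relativize-⇔ ψ e e₀ e₁
    relativize-⇔ (φ ∨′ ψ) e e₀ e₁ = relativize-⇔ φ e e₀ e₁ ⊎-⇔ relativize-⇔ ψ e e₀ e₁
    relativize-⇔ (φ ⇒′ ψ) e e₀ e₁ = →-cong-⇔ (relativize-⇔ φ e e₀ e₁) (relativize-⇔ ψ e e₀ e₁)
    relativize-⇔ (∀′ φ) {ρ} {τ} e refl refl = mk⇔
      (λ f (z , l , l′) → to (relativize-⇔ φ (extend e) refl refl)
        (f z (from (pr-η₂ M sub) l , from (pr-η₂ M sub) (proj₁ l′) , proj₂ (from ⊏-⇔ l′))))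
      (λ f z (l , l′ , ¬e) → from (relativize-⇔ φ (extend e) refl refl)
        (f (z , to (pr-η₂ M sub) l , to ⊏-⇔ (to (pr-η₂ M sub) l′ , ¬e))))
    relativize-⇔ (∃′ φ) {ρ} {τ} e refl refl = mk⇔
      (λ (z , (l , l′ , ¬e) , s) → (z , to (pr-η₂ M sub) l , to ⊏-⇔ (to (pr-η₂ M sub) l′ , ¬e)) ,
        to (relativize-⇔ φ (extend e) refl refl) s)
      (λ ((z , l , l′) , s) → z ,
        (from (pr-η₂ M sub) l , from (pr-η₂ M sub) (proj₁ l′) , proj₂ (from ⊏-⇔ l′)) ,
        from (relativize-⇔ φ (extend e) refl refl) s)

-- Models of Tₙ¹

open CharacteristicSystem

module Model {n} {S : CharacteristicSystem n} (M : Structure (ℒ-qe S))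
             (axiom : ∀ ψ → T¹ S ψ → M ⊨ ψ) where
  open Structure M using (Carrier; _≈_; func; pr; pr-cong; func-cong; module ≈)

  private
    sub⇔ : {xs : Vector Carrier 2} → pr (rel sub) xs ⇔ pr (rel sub) (xs 0F ◂ xs 1F ◂ ⟨⟩)
    sub⇔ = pr-η₂ M (rel sub)

    edge⇔ : ∀ {i} {xs : Vector Carrier 2} → pr (rel (edge i)) xs ⇔ pr (rel (edge i)) (xs 0F ◂ xs 1F ◂ ⟨⟩)
    edge⇔ = pr-η₂ M (rel (edge _))

    strict⇔ : ∀ {xs : Vector Carrier 2} {A : Set} →
              (pr (rel sub) xs × A) ⇔ (pr (rel sub) (xs 0F ◂ xs 1F ◂ ⟨⟩) × A)
    strict⇔ = sub⇔ ×-⇔ ⇔-id _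

    meet-cong : ∀ {xs x y} → xs 0F ≈ x → xs 1F ≈ y → func meet xs ≈ func meet (x ◂ y ◂ ⟨⟩)
    meet-cong e e′ = func-cong meet λ { 0F → e ; 1F → e′ }

    ⊑-cong : ∀ {xs : Vector Carrier 2} {x y} → xs 0F ≈ x → xs 1F ≈ y →
             pr (rel sub) xs → pr (rel sub) (x ◂ y ◂ ⟨⟩)
    ⊑-cong e e′ = pr-cong (rel sub) λ { 0F → e ; 1F → e′ }

    branches : Fin n → Formula (ℒ-qe S) 2
    branches i = ∃′ (atom (rel (edge i)) (var 1F ◂ var 0F ◂ ⟨⟩) ∧′ atom (rel sub) (var 0F ◂ var 2F ◂ ⟨⟩))

  treeLike : TreeLike (reduct rel↪qe M)
  treeLike = record
    { ⊑-refl       = λ {x} → to sub⇔ (axiom _ ⊆-refl x)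
    -- `closure` binds variable 0 innermost, so an axiom receives its arguments from the highest
    -- variable down.
    ; ⊑-antisym    = λ {x} {y} p q → axiom _ ⊆-antisym y x (from sub⇔ p , from sub⇔ q)
    ; ⊑-trans      = λ {x} {y} {z} p q → to sub⇔ (axiom _ ⊆-trans z y x (from sub⇔ p , from sub⇔ q))
    ; ⊑-linear     = λ {x} {y} {z} p q →
                       Sum.map (to sub⇔) (to sub⇔) (axiom _ pred-linear z y x (from sub⇔ p , from sub⇔ q))
    ; _⋏_          = λ x y → func meet (x ◂ y ◂ ⟨⟩)
    ; ⋏-lowerˡ     = λ x y → ⊑-cong (meet-cong ≈.refl ≈.refl) ≈.refl (proj₁ (axiom _ meet-lower y x))
    ; ⋏-lowerʳ     = λ x y → ⊑-cong (meet-cong ≈.refl ≈.refl) ≈.refl (proj₂ (axiom _ meet-lower y x))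
    ; ⋏-greatest   = λ {x} {y} {z} p q → ⊑-cong ≈.refl (meet-cong ≈.refl ≈.refl)
                       (axiom _ meet-great z y x (from sub⇔ p , from sub⇔ q))
    ; E-functional = λ {i} {x} p q →
                       let (_ , _ , unique) = axiom _ (E-total i) x
                       in ≈.trans (unique _ (from edge⇔ p)) (≈.sym (unique _ (from edge⇔ q)))
    ; E-⊏          = λ {i} {x} {y} p → to strict⇔ (proj₁ (axiom _ (E-cover i) y x (from edge⇔ p)))
    ; E-immediate  = λ {i} {x} {y} {z} p q q′ →
                       proj₂ (axiom _ (E-cover i) y x (from edge⇔ p)) (z , from strict⇔ q , from strict⇔ q′)
    ; E-separate   = λ {i} {j} {x} {y} {z} i≢j p q →
                       axiom _ (E-disjoint i j i≢j) z y x (from edge⇔ p , from edge⇔ q)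
    ; E-branch     = λ {x} {y} p →
                       let (i , z , e , l) = ⋁⁻ {M = M} branches (axiom _ branching y x (from strict⇔ p))
                       in i , z , to edge⇔ e , to sub⇔ l
    }

  open TreeLike treeLike public

  root′ : Carrier
  root′ = func root ⟨⟩

  root-⊑ : ∀ x → root′ ⊑ x
  root-⊑ x = ⊑-cong (func-cong root λ ()) ≈.refl (axiom _ ε-least x)

  P-⇔ : ∀ {q σ x y} → pr (P q σ) (x ◂ y ◂ ⟨⟩) ⇔ (x ⊏ y × (Seg prefixOrder x y ⊨ sentence S q σ))
  P-⇔ {q} {σ} {x} {y} = mk⇔
    (λ p → let (l , s) = proj₁ def (from (pr-η₂ M (P q σ)) p)
           in to ⊏-⇔ (to strict⇔ l) , to relativized s)
    (λ (l , s) → to (pr-η₂ M (P q σ)) (proj₂ def (from strict⇔ (from ⊏-⇔ l) , from relativized s)))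
    where
    def = axiom _ (P-def q σ) y x

    relativized : Sat M (x ◂ y ◂ ⟨⟩) (embed rel↪qe (relativize (sentence S q σ))) ⇔
                  (Seg prefixOrder x y ⊨ sentence S q σ)
    relativized = relativize-⇔ (sentence S q σ) (λ ()) refl refl ⇔-∘
      ⇔-sym (IsReduct.Sat-embed (reduct-isReduct rel↪qe M) (relativize (sentence S q σ)))

  exhaust : ∀ q {x y} → x ⊏ y → ∃[ σ ] (Seg prefixOrder x y ⊨ sentence S q σ)
  exhaust q {x} {y} l =
    let (σ , p) = ⋁⁻ {M = M} (λ σ → atom (P q σ) (var 0F ◂ var 1F ◂ ⟨⟩))
                    (axiom _ (P-exhaust q) y x (from strict⇔ (from ⊏-⇔ l)))
    in σ , proj₂ (to P-⇔ (to (pr-η₂ M (P q σ)) p))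

  realize : ∀ q σ x → ∃[ y ] x ⊏ y × (Seg prefixOrder x y ⊨ sentence S q σ)
  realize q σ x =
    let (y , p) = axiom _ (realization q σ) x in y , to P-⇔ (to (pr-η₂ M (P q σ)) p)

-- Elementary equivalence of any two models of the theory

module ModelEquivalence (em : ExcludedMiddle 0ℓ) where
  open FiniteMax em
  open Intervals em
  open Extension em
  open Positions em
  open Segments em
  open Formulas em

  module _ {K L : PrefixOrder n} where
    private
      module K = PrefixOrder K
      module L = PrefixOrder L

    -- The direction from g j towards c′ is that from f j towards c, in which no f i lies.
    new-branch : (∀ {i x y z} → K.Dir i x y → K.Dir i x z → ∃[ u ] x K.⊏ u × u K.⊑ y × u K.⊑ z) →
                 ∀ {m} {f : Vector (Point K) m} {g c c′ j} → PartialIso K L (2 ℕ.+ r) f g →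
                 g j L.⊑ c′ → Sim K L (2 ℕ.+ r) (f j) c (g j) c′ →
                 (∀ i → c K.⋏ f i K.⊑ f j) → ∀ i → c′ L.⋏ g i L.⊑ g j
    new-branch {r = r} Dir-common {f = f} {g} {c} {c′} {j} p l s h i
      with ⊑∨⊏ L (L.⋏-lowerˡ c′ (g i)) l
    ... | inj₁ q = q
    ... | inj₂ q =
      let (_ , d) = L.Dir-exists q
          j⊑i     = from ⊑-⇔ (L.⊑-trans (proj₁ q) (L.⋏-lowerʳ _ _))
          d₁      = Sim-first (two (Sim-sym s)) (L.Dir-mono d (L.⋏-lowerˡ _ _))
          d₂      = Sim-first (two (Sim-sym (sim j⊑i))) (L.Dir-mono d (L.⋏-lowerʳ _ _))
          (u , j⊏u , u⊑c , u⊑i) = Dir-common d₁ d₂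
      in contradiction (K.⊑-trans (K.⋏-greatest u⊑c u⊑i) (h i)) (proj₂ j⊏u)
      where
      open PartialIso p
      two : ∀ {x y x′ y′} → Sim L K (2 ℕ.+ r) x y x′ y′ → Sim L K 2 x y x′ y′
      two = Sim-antitone (s≤s (s≤s z≤n))

    -- By the hypotheses on meets, `c` meets each old point exactly where `f j` does, and the old
    -- points below `c` are those below `f j`. So every interval ending in `c` is a concatenation at
    -- `f j`.
    PartialIso-beyond : ∀ {m} {f : Vector (Point K) m} {g c c′ j} → PartialIso K L r f g →
                        f j K.⊏ c → g j L.⊏ c′ → Sim K L r (f j) c (g j) c′ →
                        (∀ i → c K.⋏ f i K.⊑ f j) → (∀ i → c′ L.⋏ g i L.⊑ g j) →
                        PartialIso K L r (c ◂ f) (c′ ◂ g)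
    PartialIso-beyond {f = f} {g} {c} {c′} {j} p (l , ¬l) (l′ , ¬l′) s h h′ = PartialIso-insert p
      (λ i → mk⇔ (λ q → L.⊑-trans (to ⊑-⇔ (below q)) l′) (λ q → K.⊑-trans (from ⊑-⇔ (below′ q)) l))
      (λ i → mk⇔ (λ q → contradiction (K.⊑-trans (K.⋏-greatest K.⊑-refl q) (h i)) ¬l)
                 (λ q → contradiction (L.⊑-trans (L.⋏-greatest L.⊑-refl q) (h′ i)) ¬l′))
      (λ i q → Sim-+ (below q) l (to ⊑-⇔ (below q)) l′ (sim (below q)) s)
      (λ i q → contradiction (K.⊑-trans (K.⋏-greatest K.⊑-refl q) (h i)) ¬l)
      (λ i → let (k , (e₁ , e₂) , (e₃ , e₄)) = closed j i in suc k ,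
         (K.⊑-trans e₁ (K.⋏-greatest (K.⊑-trans (K.⋏-lowerˡ _ _) l) (K.⋏-lowerʳ _ _)) ,
          K.⊑-trans (K.⋏-greatest (h i) (K.⋏-lowerʳ _ _)) e₂) ,
         (L.⊑-trans e₃ (L.⋏-greatest (L.⊑-trans (L.⋏-lowerˡ _ _) l′) (L.⋏-lowerʳ _ _)) ,
          L.⊑-trans (L.⋏-greatest (h′ i) (L.⋏-lowerʳ _ _)) e₄))
      where
      open PartialIso p
      below : ∀ {i} → f i K.⊑ c → f i K.⊑ f j
      below q = K.⊑-trans (K.⋏-greatest q K.⊑-refl) (h _)
      below′ : ∀ {i} → g i L.⊑ c′ → g i L.⊑ g j
      below′ q = L.⊑-trans (L.⋏-greatest q L.⊑-refl) (h′ _)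

    -- The first round copies `z`, the second keeps the copy away from `x′`. Applied in both
    -- directions, this preserves immediacy and thereby edges.
    Sim-between : ∀ {x y x′ y′} → Sim K L 2 x y x′ y′ →
                  ∃[ z ] x K.⊏ z × z K.⊏ y → ∃[ z′ ] x′ L.⊏ z′ × z′ L.⊏ y′
    Sim-between (step f _) (z , l , l′) =
      let (z′ , _ , d , s , _) = f (proj₁ l) (proj₂ (K.Dir-exists l′))
      in z′ , Sim-⊏ s l , L.Dir⇒⊏ d

  module _ {S : CharacteristicSystem n} {M N : Structure (ℒ-qe S)}
           (TM : ∀ ψ → T¹ S ψ → M ⊨ ψ) (TN : ∀ ψ → T¹ S ψ → N ⊨ ψ) where
    private
      module M = Model M TM
      module N = Model N TN

      K = M.prefixOrder
      L = N.prefixOrder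

    -- Exhaustion in `M` finds a characteristic sentence true between `x` and `c`, and realization
    -- in `N` makes the same sentence true above `x′`. Both intervals then belong to the class of
    -- one colored ordinal `A`, for a rank high enough to decide `q` rounds.
    Sim-realize : ∀ q {x c} → x M.⊏ c → ∀ x′ → ∃[ c′ ] x′ N.⊏ c′ × Sim K L q x c x′ c′
    Sim-realize q l x′ =
      let (σ , s)       = M.exhaust Q l
          (c′ , l′ , s′) = N.realize Q σ x′
          (A , _ , _ , isChar) = characteristic S Q σ
      in c′ , l′ , ≡[]⇒Sim λ φ h →
           ⇔-sym (to (isChar _) s′ φ h) ⇔-∘ to (isChar _) s φ h
      where Q = max-rank (tests n q)

    -- Only the insertion of the highest meet costs a round; the step beyond it can be realized for
    -- any number of rounds. The point `f o` below `c` ensures that this meet lies above an old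
    -- point.
    PartialIso-extend : ∀ {m} {f : Vector (Point K) m} {g} → PartialIso K L (3 ℕ.+ r) f g →
                        ∀ {o c} → f o M.⊑ c →
                        ∃[ m ] ∃[ m′ ] ∃[ c′ ] PartialIso K L (2 ℕ.+ r) (c ◂ m ◂ f) (c′ ◂ m′ ◂ g)
    PartialIso-extend {r} {f = f} {g} p {o} {c} l
      with finite-max (λ _ → ⊤) (λ i j → c M.⋏ f i M.⊑ c M.⋏ f j) M.⊑-refl M.⊑-trans
             (λ {i} {j} _ _ → M.⊑-linear (M.⋏-lowerˡ c (f i)) (M.⋏-lowerˡ c (f j))) (o , tt)
    ... | j , _ , max
      with PartialIso-between p (M.⊑-trans (M.⋏-greatest l M.⊑-refl) (max {o} _)) (M.⋏-lowerʳ c (f j))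
         | em {c M.⊑ c M.⋏ f j}
    ... | m′ , p′ | yes q = _ , m′ , m′ , PartialIso-repeat p′ zero (q , M.⋏-lowerˡ c (f j))
    ... | m′ , p′ | no ¬q =
      let m⊏c             = M.⋏-lowerˡ c (f j) , ¬q
          (c′ , l′ , s) = Sim-realize (2 ℕ.+ r) m⊏c m′
          h : ∀ i → c M.⋏ (c M.⋏ f j ◂ f) i M.⊑ c M.⋏ f j
          h = λ { zero → M.⋏-lowerʳ _ _ ; (suc i) → max {i} _ }
      in _ , m′ , c′ , PartialIso-beyond {j = zero} p′ m⊏c l′ s h
           (new-branch M.Dir-common {j = zero} p′ (proj₁ l′) s h)

    -- The root is kept in every position to provide an old point below `c`.
    Position-extend : ∀ {u : Vector (Point K) k} {v} →
                      Position K L (suc r) (M.root′ ◂ u) (N.root′ ◂ v) →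
                      ∀ c → ∃[ c′ ] Position K L r (M.root′ ◂ c ◂ u) (N.root′ ◂ c′ ◂ v)
    Position-extend {u = u} {v} p c =
      let (o , e , _) = track 0F
          (m , m′ , c′ , iso′) = PartialIso-extend iso (M.⊑-trans (proj₂ e) (M.root-⊑ c))
      in c′ , record { iso = iso′ ; track = track′ c′ }
      where
      open Position p
      track′ : ∀ {m m′} c′ i → ∃[ j ] (M.root′ ◂ c ◂ u) i M.≋ (c ◂ m ◂ f) j ×
                                      (N.root′ ◂ c′ ◂ v) i N.≋ (c′ ◂ m′ ◂ g) j
      track′ c′ 0F            = let (j , e) = track 0F in suc (suc j) , e
      track′ c′ 1F            = 0F , ≋-refl K , ≋-refl L
      track′ c′ (suc (suc i)) = let (j , e) = track (suc i) in suc (suc j) , e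

  module _ {S : CharacteristicSystem n} {M N : Structure (ℒ-qe S)}
           (TM : ∀ ψ → T¹ S ψ → M ⊨ ψ) (TN : ∀ ψ → T¹ S ψ → N ⊨ ψ) where
    private
      module M = Model M TM
      module N = Model N TN

      module SM = Structure M
      module SN = Structure N

      K = M.prefixOrder
      L = N.prefixOrder

      R : ℕ → ∀ {k} → Vector SM.Carrier k → Vector SN.Carrier k → Set
      R r ρ τ = Position K L r (M.root′ ◂ ρ) (N.root′ ◂ τ)

      R-forth : ∀ {r k} {ρ : Vector SM.Carrier k} {τ} → R (suc r) ρ τ → ∀ a → ∃[ b ] R r (a ◂ ρ) (b ◂ τ)
      R-forth = Position-extend TM TN

      R-back : ∀ {r k} {ρ : Vector SM.Carrier k} {τ} → R (suc r) ρ τ → ∀ b → ∃[ a ] R r (a ◂ ρ) (b ◂ τ)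
      R-back p b = let (a , p′) = Position-extend TN TM (Position-sym p) b in a , Position-sym p′

      module _ {ρ : Vector SM.Carrier k} {τ} (p : R r ρ τ) where
        open Position p
        open PartialIso iso using (closed)

        -- Terms lead to no new points: the root is tracked and the listed points are closed under
        -- meets.
        track-term : ∀ t → ∃[ j ] eval M ρ t M.≋ f j × eval N τ t N.≋ g j
        track-term (var i)       = track (suc i)
        track-term (app root ts) =
          let (j , e , e′) = track 0F
          in j , ≋-trans K (to M.≈-⇔-≋ (SM.func-cong root λ ())) e ,
                 ≋-trans L (to N.≈-⇔-≋ (SN.func-cong root λ ())) e′
        track-term (app meet ts) =
          let (i , a , a′) = track-term (ts 0F)
              (j , b , b′) = track-term (ts 1F)
              (l , c , c′) = closed i j
          in l , ≋-trans K (to M.≈-⇔-≋ (SM.func-cong meet (◂-η₂ M _))) (≋-trans K (⋏-cong K a b) (swap c))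
               , ≋-trans L (to N.≈-⇔-≋ (SN.func-cong meet (◂-η₂ N _))) (≋-trans L (⋏-cong L a′ b′) (swap c′))

        terms : ∀ s t → Position K L r (eval M ρ s ◂ eval M ρ t ◂ ⟨⟩) (eval N τ s ◂ eval N τ t ◂ ⟨⟩)
        terms s t = record { iso = iso ; track = λ { 0F → track-term s ; 1F → track-term t } }

      R-≐ : ∀ {r k} {ρ : Vector SM.Carrier k} {τ} → R r ρ τ → ∀ s t →
            Sat M ρ (s ≐ t) ⇔ Sat N τ (s ≐ t)
      R-≐ p s t = ⇔-sym N.≈-⇔-≋ ⇔-∘ (Position-≋ (terms p s t) 0F 1F ⇔-∘ M.≈-⇔-≋)

      immediate : ∀ {x y x′ y′ i} → Position K L 0 (x ◂ y ◂ ⟨⟩) (x′ ◂ y′ ◂ ⟨⟩) →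
                  (M.Dir i x y × ¬ (∃[ z ] x M.⊏ z × z M.⊏ y)) ⇔ (N.Dir i x′ y′ × ¬ (∃[ z ] x′ N.⊏ z × z N.⊏ y′))
      immediate p = mk⇔
        (λ (d , none) → to Dir⇔ d , λ some → none (Sim-between (Sim-sym (sim d)) some))
        (λ (d , none) → from Dir⇔ d , λ some → none (Sim-between (sim (from Dir⇔ d)) some))
        where
        Dir⇔ = Position-Dir p 0F 1F
        sim : ∀ {i} → M.Dir i _ _ → Sim K L 2 _ _ _ _
        sim d = Position-sim p 0F 1F (proj₁ (M.Dir⇒⊏ d))

      weight : ∀ {a} → QePr S a → ℕ
      weight (rel _) = 0
      weight (P q σ) = weightedRank (λ _ → 0) (sentence S q σ)

      R-atom : ∀ {a k} {ρ : Vector SM.Carrier k} {τ} (p : QePr S a) (ts : Vector (Term (ℒ-qe S) k) a) →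
               R (weight p) ρ τ → Sat M ρ (atom p ts) ⇔ Sat N τ (atom p ts)
      R-atom (rel sub) ts p =
        ⇔-sym (pr-η₂ N (rel sub)) ⇔-∘ (Position-⊑ (terms p (ts 0F) (ts 1F)) 0F 1F ⇔-∘ pr-η₂ M (rel sub))
      R-atom (rel (edge i)) ts p =
        ⇔-sym (pr-η₂ N (rel (edge i))) ⇔-∘ (⇔-sym (N.E-⇔ em) ⇔-∘
        (immediate (Position-antitone z≤n (terms p (ts 0F) (ts 1F))) ⇔-∘
        (M.E-⇔ em ⇔-∘ pr-η₂ M (rel (edge i)))))
      R-atom (P q σ) ts p =
        ⇔-sym (pr-η₂ N (P q σ)) ⇔-∘ (⇔-sym N.P-⇔ ⇔-∘ (mk⇔
          (λ (l , s) → let l′ = to (Position-⊏ xy 0F 1F) l in l′ , to (same l l′) s)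
          (λ (l′ , s) → let l = from (Position-⊏ xy 0F 1F) l′ in l , from (same l l′) s)
        ⇔-∘ (M.P-⇔ ⇔-∘ pr-η₂ M (P q σ))))
        where
        xy = terms p (ts 0F) (ts 1F)

        -- The weight of `P q σ` is the quantifier rank of its sentence; with the reserve of two
        -- rounds in a position, this is the number of rounds that `Sim⇒⊨` asks for.
        same : ∀ l l′ → _ ⇔ _
        same l l′ = Sim⇒⊨ (Seg-presents K _ _) (Seg-presents L _ _) l l′ (sentence S q σ)
                      (Position-sim xy 0F 1F (proj₁ l))

    -- The game starts with the two roots alone. Their only interval is empty, so any number of
    -- rounds is available.
    elementarily-equivalent : ∀ φ → (M ⊨ φ) ⇔ (N ⊨ φ)
    elementarily-equivalent φ =
      BackAndForth.agree R Position-antitone R-forth R-back R-≐ weight R-atom φ record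
        { iso   = PartialIso-insert none (λ ()) (λ ()) (λ ()) (λ ()) (λ ())
        ; track = λ { 0F → 0F , ≋-refl K , ≋-refl L }
        }
      where
      none : PartialIso K L _ ⟨⟩ ⟨⟩
      none = record { ⊑-⇔ = λ {} ; sim = λ {} ; closed = λ () }

-- Nodes

-- up m α is the least multiple of ω^m above α.

private
  upᴸ : ℕ → List ℕ → List ℕ
  upᴸ m []       = m ∷ []
  upᴸ m (a ∷ as) with m ℕ.≤? a
  ... | yes _ = a ∷ upᴸ m as
  ... | no _  = m ∷ []

  upᴸ-descending : ∀ m {as} → Linked ℕ._≥_ as → Linked ℕ._≥_ (upᴸ m as)
  upᴸ-descending m []  = [-]
  upᴸ-descending m {a ∷ _} [-] with m ℕ.≤? a
  ... | yes p = p ∷ [-]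
  ... | no _  = [-]
  upᴸ-descending m {a ∷ b ∷ bs} (p ∷ d) with m ℕ.≤? a
  ... | no _  = [-]
  ... | yes q with m ℕ.≤? b | upᴸ-descending m {b ∷ bs} d
  ...   | yes _ | d′ = p ∷ d′
  ...   | no _  | d′ = q ∷ d′

  <-upᴸ : ∀ m as → as <ᴸ upᴸ m as
  <-upᴸ m []       = halt
  <-upᴸ m (a ∷ as) with m ℕ.≤? a
  ... | yes _ = next refl (<-upᴸ m as)
  ... | no ¬p = this (ℕ.≰⇒> ¬p)

  <-[m] : ∀ {m a as cs} → m ℕ.≤ a → cs <ᴸ m ∷ [] → cs <ᴸ a ∷ as
  <-[m] p halt                 = halt
  <-[m] p (this q)             = this (ℕ.<-≤-trans q p)
  <-[m] p (next refl (base ()))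

  upᴸ-idem : ∀ m as {bs cs} → bs <ᴸ upᴸ m as → cs <ᴸ upᴸ m bs → cs <ᴸ upᴸ m as
  upᴸ-idem m [] halt r = r
  upᴸ-idem m [] {b ∷ _} (this p) r with m ℕ.≤? b
  ... | yes q = contradiction q (ℕ.<⇒≱ p)
  ... | no _  = r
  upᴸ-idem m [] (next refl (base ())) r
  upᴸ-idem m (a ∷ as) p r with m ℕ.≤? a
  upᴸ-idem m (a ∷ as) {[]} p r | yes q = <-[m] q r
  upᴸ-idem m (a ∷ as) {b ∷ _} (this p) r | yes q with m ℕ.≤? b
  upᴸ-idem m (a ∷ as) {b ∷ _} (this p) r           | yes q | no _  = <-[m] q r
  upᴸ-idem m (a ∷ as) {b ∷ _} (this p) halt        | yes q | yes _ = halt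
  upᴸ-idem m (a ∷ as) {b ∷ _} (this p) (this r)    | yes q | yes _ = this (ℕ.<-trans r p)
  upᴸ-idem m (a ∷ as) {b ∷ _} (this p) (next refl r) | yes q | yes _ = this p
  upᴸ-idem m (a ∷ as) {b ∷ _} (next refl p) r | yes q with m ℕ.≤? a
  upᴸ-idem m (a ∷ as) {b ∷ _} (next refl p) halt          | yes q | yes _ = halt
  upᴸ-idem m (a ∷ as) {b ∷ _} (next refl p) (this r)      | yes q | yes _ = this r
  upᴸ-idem m (a ∷ as) {b ∷ _} (next refl p) (next refl r) | yes q | yes _ = next refl (upᴸ-idem m as p r)
  upᴸ-idem m (a ∷ as) {b ∷ _} (next refl p) r             | yes q | no ¬q = contradiction q ¬q
  upᴸ-idem m (a ∷ as) halt r                  | no ¬q = r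
  upᴸ-idem m (a ∷ as) {b ∷ _} (this p) r      | no ¬q with m ℕ.≤? b
  ... | yes q = contradiction q (ℕ.<⇒≱ p)
  ... | no _  = r
  upᴸ-idem m (a ∷ as) (next refl (base ())) r | no ¬q

  upᴸ-mono : ∀ {m m′} → m ℕ.< m′ → ∀ as → upᴸ m as <ᴸ upᴸ m′ as
  upᴸ-mono p []       = this p
  upᴸ-mono {m} {m′} p (a ∷ as) with m ℕ.≤? a | m′ ℕ.≤? a
  ... | yes _ | yes _ = next refl (upᴸ-mono p as)
  ... | yes _ | no ¬q = this (ℕ.≰⇒> ¬q)
  ... | no ¬q | yes q = contradiction (ℕ.≤-trans (ℕ.<⇒≤ p) q) ¬q
  ... | no _  | no _  = this p

  ∷ʳ0-<-upᴸ : ∀ as → as ∷ʳ 0 <ᴸ upᴸ 1 as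
  ∷ʳ0-<-upᴸ []       = this (s≤s z≤n)
  ∷ʳ0-<-upᴸ (a ∷ as) with 1 ℕ.≤? a
  ... | yes _ = next refl (∷ʳ0-<-upᴸ as)
  ... | no ¬p = this (ℕ.≰⇒> ¬p)

  <-∷ʳ0 : ∀ as → as <ᴸ as ∷ʳ 0
  <-∷ʳ0 []       = halt
  <-∷ʳ0 (a ∷ as) = next refl (<-∷ʳ0 as)

  <-∷ʳ0⁻ : ∀ as {cs} → cs <ᴸ as ∷ʳ 0 → cs <ᴸ as ⊎ cs ≡ as
  <-∷ʳ0⁻ [] halt                  = inj₂ refl
  <-∷ʳ0⁻ [] (next refl (base ()))
  <-∷ʳ0⁻ (a ∷ as) halt            = inj₁ halt
  <-∷ʳ0⁻ (a ∷ as) (this p)        = inj₁ (this p)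
  <-∷ʳ0⁻ (a ∷ as) (next refl p)   = Sum.map (next refl) (cong (a ∷_)) (<-∷ʳ0⁻ as p)

up : ℕ → Ω → Ω
up m (cnf as d) = cnf (upᴸ m as) (upᴸ-descending m d)

<Ω-up : ∀ m α → α <Ω up m α
<Ω-up m α = <-upᴸ m (exponents α)

-- `up m α` is a multiple of ω^m above `β`, hence not below the least such multiple `up m β`. Steps
-- bounded in this way can thus be iterated without passing the first bound.
up-idem : ∀ m α {β γ} → β <Ω up m α → γ <Ω up m β → γ <Ω up m α
up-idem m α p q = upᴸ-idem m (exponents α) p q

up-mono : ∀ {m m′} → m ℕ.< m′ → ∀ α → up m α <Ω up m′ α
up-mono p α = upᴸ-mono p (exponents α)

sucΩ-<-up : ∀ α → sucΩ α <Ω up 1 α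
sucΩ-<-up α = ∷ʳ0-<-upᴸ (exponents α)

<Ω-suc : ∀ α → α <Ω sucΩ α
<Ω-suc α = <-∷ʳ0 (exponents α)

<Ω-suc⁻ : ∀ α {γ} → γ <Ω sucΩ α → γ <Ω α ⊎ γ ≡ α
<Ω-suc⁻ (cnf as _) p with <-∷ʳ0⁻ as p
... | inj₁ q    = inj₁ q
... | inj₂ refl = inj₂ refl

module _ {s t : Node n} where

  ⊆⇒≯ : s ⊆ t → ¬ len t <Ω len s
  ⊆⇒≯ p l = <Ω-irrefl (len t) (proj₁ (apply p (len t) l))

  ⊆-≮⇒⊇ : s ⊆ t → ¬ len s <Ω len t → t ⊆ s
  ⊆-≮⇒⊇ p ¬l with <Ω-compare (len s) (len t)
  ... | tri< l _ _ = contradiction l ¬l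
  ... | tri> _ _ l = contradiction l (⊆⇒≯ p)
  ... | tri≈ _ e _ = incl λ γ l → subst (γ <Ω_) (sym e) l ,
          sym (proj₂ (apply p γ (subst (γ <Ω_) (sym e) l)))

  ⊊⇒< : s ⊊ t → len s <Ω len t
  ⊊⇒< (p , ¬e) with len s <Ω? len t
  ... | yes l = l
  ... | no ¬l = contradiction (p , ⊆-≮⇒⊇ p ¬l) ¬e

⊆-linear : ∀ {s t u : Node n} → s ⊆ u → t ⊆ u → s ⊆ t ⊎ t ⊆ s
⊆-linear {s = s} {t} p q with <Ω-compare (len s) (len t)
... | tri< l _ _ = inj₁ (incl λ γ m → let m′ = <Ω-trans {γ} {len s} {len t} m l in
        m′ , trans (proj₂ (apply p γ m)) (sym (proj₂ (apply q γ m′))))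
... | tri> _ _ l = inj₂ (incl λ γ m → let m′ = <Ω-trans {γ} {len t} {len s} m l in
        m′ , trans (proj₂ (apply q γ m)) (sym (proj₂ (apply p γ m′))))
... | tri≈ _ e _ = inj₁ (incl λ γ m → let m′ = subst (γ <Ω_) e m in
        m′ , trans (proj₂ (apply p γ m)) (sym (proj₂ (apply q γ m′))))

empty-⊆ : (s : Node n) → empty ⊆ s
empty-⊆ s = incl λ { γ (base ()) }

⊆-append : ∀ i (s : Node n) → s ⊆ append i s
⊆-append i s = incl λ γ p → <Ω-trans {γ} {len s} {sucΩ (len s)} p (<Ω-suc (len s)) , same γ p
  where
  same : ∀ γ (p : γ <Ω len s) → entry s γ p ≡
         entry (append i s) γ (<Ω-trans {γ} {len s} {sucΩ (len s)} p (<Ω-suc (len s)))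
  same γ p with γ <Ω? len s
  ... | yes _ = refl
  ... | no ¬p = contradiction p ¬p

entry-append : ∀ i (s : Node n) → entry (append i s) (len s) (<Ω-suc (len s)) ≡ i
entry-append i s with len s <Ω? len s
... | yes p = contradiction p (<Ω-irrefl (len s))
... | no _  = refl

append-⊆ : ∀ {i} {s t : Node n} → s ⊆ t → (l : len s <Ω len t) → entry t (len s) l ≡ i → append i s ⊆ t
append-⊆ {i = i} {s} {t} p l e = incl λ γ q → below γ q , same γ q
  where
  below : ∀ γ → γ <Ω sucΩ (len s) → γ <Ω len t
  below γ q with <Ω-suc⁻ (len s) {γ} q
  ... | inj₁ r    = proj₁ (apply p γ r)
  ... | inj₂ refl = l

  same : ∀ γ (q : γ <Ω sucΩ (len s)) → entry (append i s) γ q ≡ entry t γ (below γ q)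
  same γ q with γ <Ω? len s | <Ω-suc⁻ (len s) {γ} q
  ... | yes r | _         = proj₂ (apply p γ r)
  ... | no ¬r | inj₁ r    = contradiction r ¬r
  ... | no ¬r | inj₂ refl = sym e

append-immediate : ∀ {i} {s t u : Node n} → u ≈ᴺ append i s → s ⊊ t → ¬ t ⊊ u
append-immediate {s = s} {t} {u} e p q
  with <Ω-suc⁻ (len s) {len t} (subst (len t <Ω_) (≈ᴺ⇒len≡ e) (⊊⇒< q))
... | inj₁ r = <Ω-irrefl (len s) (<Ω-trans {len s} {len t} {len s} (⊊⇒< p) r)
... | inj₂ r = <Ω-irrefl (len s) (subst (len s <Ω_) r (⊊⇒< p))

append-⊊ : ∀ {i} {s t : Node n} → t ≈ᴺ append i s → s ⊊ t
append-⊊ {i = i} {s} e@(p , q) = ⊆ᴺ-trans (⊆-append i s) q ,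
  λ (_ , r) → ⊆⇒≯ (⊆ᴺ-trans q r) (<Ω-suc (len s))

append-injective : ∀ {i j} {s : Node n} → append i s ≈ᴺ append j s → i ≡ j
append-injective {i = i} {j} {s} (p , _) =
  trans (sym (entry-append i s)) (trans (proj₂ (apply p (len s) (<Ω-suc (len s)))) (entry-append j s))

-- The nodes as a tree-like structure

module NodeTree (em : ExcludedMiddle 0ℓ) where
  open Meet em

  nodeTree : ∀ n → TreeLike (tree-rel n)
  nodeTree n = record
    { ⊑-refl       = ⊆ᴺ-refl
    ; ⊑-antisym    = _,_
    ; ⊑-trans      = ⊆ᴺ-trans
    ; ⊑-linear     = ⊆-linear
    ; _⋏_          = _⊓_
    ; ⋏-lowerˡ     = ⊓-lowerˡ
    ; ⋏-lowerʳ     = ⊓-lowerʳ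
    ; ⋏-greatest   = ⊓-greatest
    ; E-functional = λ e e′ → ≈.trans e (≈.sym e′)
    ; E-⊏          = append-⊊
    ; E-immediate  = append-immediate
    ; E-separate   = λ i≢j e e′ y≈z → i≢j (append-injective (≈.trans (≈.sym e) (≈.trans y≈z e′)))
    ; E-branch     = λ {x} {y} p → let l = ⊊⇒< p in
                       _ , append (entry y (len x) l) x , ≈.refl , append-⊆ (proj₁ p) l refl
    }
    where
    open Structure (tree-rel n)

  module _ (n : ℕ) where
    open TreeLike (nodeTree n)

    -- Lengths strictly increase along the order, so descent in an interval is descent in `Ω`.
    Seg-isColoredOrdinal : ∀ x y → IsColoredOrdinal (Seg prefixOrder x y)
    Seg-isColoredOrdinal x y = record
      { isStrictTotalOrder = record
        { isStrictPartialOrder = record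
          { isEquivalence = ≈.≈-equivalence
          ; irrefl        = λ (p , q) (_ , ¬r) → ¬r q
          ; trans         = λ p q → ⊏-⊑-trans p (proj₁ q)
          ; <-resp-≈      = (λ (p , _) q → ⊏-⊑-trans q p) , (λ (_ , p) q → PrefixOrder.⊑-⊏-trans prefixOrder p q)
          }
        ; compare = compare
        }
      ; wellFounded = λ a → wf a (<Ω-wellFounded (len (proj₁ a)))
      ; uniqueColor = λ (z , _ , l) → let (i , d) = Dir-exists l in i , d , Dir-unique d
      }
      where
      open PrefixOrder prefixOrder using (Dir-exists; Dir-unique)
      module ≈ = Structure (Seg prefixOrder x y)

      wf : ∀ (a : ≈.Carrier) → Acc _<Ω_ (len (proj₁ a)) → Acc (λ b c → proj₁ b ⊏ proj₁ c) a
      wf a (acc rs) = acc λ {b} l → wf b (rs (⊊⇒< (from ⊏-⇔ l)))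

      compare : Trichotomous ≈._≈_ (λ b c → proj₁ b ⊏ proj₁ c)
      compare (a , _ , p , _) (b , _ , q , _) with em {a ⊑ b} | em {b ⊑ a} | ⊑-linear p q
      ... | yes r | yes s | _ = tri≈ (λ (_ , ¬s) → ¬s s) (r , s) (λ (_ , ¬r) → ¬r r)
      ... | yes r | no ¬s | _ = tri< (r , ¬s) (λ (_ , s) → ¬s s) (λ (s , _) → ¬s s)
      ... | no ¬r | yes s | _ = tri> (λ (r , _) → ¬r r) (λ (r , _) → ¬r r) (s , ¬r)
      ... | no ¬r | no ¬s | inj₁ r = contradiction r ¬r
      ... | no ¬r | no ¬s | inj₂ s = contradiction s ¬s

-- Copying colored ordinals into the tree

module Least (em : ExcludedMiddle 0ℓ) where

  least : ∀ {I : Set} {_<_ : Rel I 0ℓ} → WellFounded _<_ → (D : Pred I 0ℓ) → ∃ D →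
          ∃[ i ] D i × ∀ {j} → j < i → ¬ D j
  least {I} {_<_} wf D (i , d) = go i (wf i) d
    where
    go : ∀ i → Acc _<_ i → D i → ∃[ i ] D i × ∀ {j} → j < i → ¬ D j
    go i (acc rs) d with em {∃[ j ] j < i × D j}
    ... | yes (j , l , d′) = go j (rs l) d′
    ... | no none          = i , d , λ l d′ → none (_ , l , d′)

  ¬∀⇒∃¬ : ∀ {I : Set} {D : Pred I 0ℓ} → ¬ (∀ i → D i) → ∃[ i ] ¬ D i
  ¬∀⇒∃¬ {D = D} ¬all with em {∃[ i ] ¬ D i}
  ... | yes p = p
  ... | no ¬p = contradiction (λ i → stable i) ¬all
    where
    stable : ∀ i → D i
    stable i with em {D i}
    ... | yes d = d
    ... | no ¬d = contradiction (i , ¬d) ¬p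

  -- Finitely many properties have finitely many truth patterns, so the bounds of one
  -- representative of each pattern have a common bound.
  uniform-bound : ∀ {I J : Set} (Bounded : I → J → Set) (_∨_ : J → J → J) →
    (∀ {i j k} → Bounded i j → Bounded i (j ∨ k)) → (∀ {i j k} → Bounded i k → Bounded i (j ∨ k)) →
    J → (Qs : List (Pred I 0ℓ)) (X : Pred I 0ℓ) → (∀ {i} → X i → ∃[ j ] Bounded i j) →
    ∃[ j ] ∀ {i} → X i → ∃[ i′ ] X i′ × (∀ {Q} → Q ∈ Qs → Q i ⇔ Q i′) × Bounded i′ j
  uniform-bound Bounded _∨_ ∨ˡ ∨ʳ j₀ [] X bound with em {∃ X}
  ... | yes (i , x) = let (j , b) = bound x in j , λ _ → i , x , (λ ()) , b
  ... | no none     = j₀ , λ x → contradiction (_ , x) none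
  uniform-bound Bounded _∨_ ∨ˡ ∨ʳ j₀ (Q ∷ Qs) X bound =
    let (j , f) = part (λ i → X i × Q i) (bound ∘ proj₁)
        (k , g) = part (λ i → X i × ¬ Q i) (bound ∘ proj₁)
    in j ∨ k , λ {i} x → split f g x (em {Q i})
    where
    part = uniform-bound Bounded _∨_ ∨ˡ ∨ʳ j₀ Qs
    split : ∀ {j k i} →
      (∀ {i} → X i × Q i → ∃[ i′ ] (X i′ × Q i′) × (∀ {Q} → Q ∈ Qs → Q i ⇔ Q i′) × Bounded i′ j) →
      (∀ {i} → X i × ¬ Q i → ∃[ i′ ] (X i′ × ¬ Q i′) × (∀ {Q} → Q ∈ Qs → Q i ⇔ Q i′) × Bounded i′ k) →
      X i → Dec (Q i) →
      ∃[ i′ ] X i′ × (∀ {Q′} → Q′ ∈ Q ∷ Qs → Q′ i ⇔ Q′ i′) × Bounded i′ (j ∨ k)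
    split f g x (yes p) = let (i′ , (x′ , p′) , a , b) = f (x , p) in
      i′ , x′ , (λ { (here refl) → mk⇔ (λ _ → p′) (λ _ → p) ; (there Q∈) → a Q∈ }) , ∨ˡ b
    split f g x (no ¬p) = let (i′ , (x′ , ¬p′) , a , b) = g (x , ¬p) in
      i′ , x′ , (λ { (here refl) → mk⇔ (λ p → contradiction p ¬p) (λ p → contradiction p ¬p′)
                   ; (there Q∈) → a Q∈ }) , ∨ʳ b

-- The top point nothing turns the whole ordinal into an interval.
module Extended (em : ExcludedMiddle 0ℓ) {A : Structure (ℒ-col n)} (ordinal : IsColoredOrdinal A) where
  open Structure A
  open IsColoredOrdinal ordinal
  open IsStrictTotalOrder isStrictTotalOrder using (compare; irrefl; asym; <-resp-≈) renaming (trans to <-trans)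
  open Least em

  private
    infix 4 _⊑_ _⊏_
    _⊑_ : Rel (Maybe Carrier) 0ℓ
    x      ⊑ nothing = ⊤
    just a ⊑ just b  = ¬ b < a
    nothing ⊑ just b = ⊥

    _⊏_ : Rel (Maybe Carrier) 0ℓ
    x ⊏ y = x ⊑ y × ¬ y ⊑ x

    ⊏⇒< : ∀ {a b} → just a ⊏ just b → a < b
    ⊏⇒< {a} {b} (_ , ¬¬l) with compare a b
    ... | tri< l _ _ = l
    ... | tri≈ _ e _ = contradiction (irrefl e) ¬¬l
    ... | tri> _ _ l = contradiction (asym l) ¬¬l

    <⇒⊏ : ∀ {a b} → a < b → just a ⊏ just b
    <⇒⊏ l = asym l , λ ¬l → ¬l l

    ≋⇒≈ : ∀ {a b} → just a ⊑ just b → just b ⊑ just a → a ≈ b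
    ≋⇒≈ {a} {b} p q with compare a b
    ... | tri< l _ _ = contradiction l q
    ... | tri≈ _ e _ = e
    ... | tri> _ _ l = contradiction l p

    ≈⇒⊑ : ∀ {a b} → a ≈ b → just a ⊑ just b
    ≈⇒⊑ e l = irrefl (≈.sym e) l

    ⊑-refl : ∀ {x} → x ⊑ x
    ⊑-refl {nothing} = tt
    ⊑-refl {just a}  = irrefl ≈.refl

    ⊑-trans : ∀ {x y z} → x ⊑ y → y ⊑ z → x ⊑ z
    ⊑-trans {z = nothing} _ _ = tt
    ⊑-trans {just a} {just b} {just c} p q l with compare a b
    ... | tri< m _ _ = q (<-trans l m)
    ... | tri≈ _ e _ = q (proj₁ (<-resp-≈) e l)
    ... | tri> _ _ m = p m

    ⊑-total : ∀ x y → x ⊑ y ⊎ y ⊑ x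
    ⊑-total x        nothing  = inj₁ tt
    ⊑-total nothing  (just b) = inj₂ tt
    ⊑-total (just a) (just b) with compare a b
    ... | tri< _ _ ¬l = inj₁ ¬l
    ... | tri≈ _ _ ¬l = inj₁ ¬l
    ... | tri> ¬l _ _ = inj₂ ¬l

    min : ∀ x y → ∃[ z ] z ⊑ x × z ⊑ y × (z ≡ x ⊎ z ≡ y)
    min x y with ⊑-total x y
    ... | inj₁ l = x , ⊑-refl {x} , l , inj₁ refl
    ... | inj₂ l = y , l , ⊑-refl {y} , inj₂ refl

    min-greatest : ∀ {x y z w} → z ≡ x ⊎ z ≡ y → w ⊑ x → w ⊑ y → w ⊑ z
    min-greatest (inj₁ refl) p _ = p
    min-greatest (inj₂ refl) _ q = q

    Dir : Fin n → Rel (Maybe Carrier) 0ℓ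
    Dir i nothing  y = ⊥
    Dir i (just a) y = just a ⊏ y × pr (col i) (a ◂ ⟨⟩)

    color-cong : ∀ {i} {as bs : Vector Carrier 1} → as 0F ≈ bs 0F → pr (col i) as → pr (col i) bs
    color-cong e = pr-cong (col _) λ { 0F → e }

  extended : PrefixOrder n
  extended = record
    { Point      = Maybe Carrier
    ; _⊑_        = _⊑_
    ; ⊑-refl     = λ {x} → ⊑-refl {x}
    ; ⊑-trans    = λ {x} {y} {z} → ⊑-trans {x} {y} {z}
    ; ⊑-linear   = λ {x} {y} _ _ → ⊑-total x y
    ; _⋏_        = λ x y → proj₁ (min x y)
    ; ⋏-lowerˡ   = λ x y → proj₁ (proj₂ (min x y))
    ; ⋏-lowerʳ   = λ x y → proj₁ (proj₂ (proj₂ (min x y)))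
    ; ⋏-greatest = λ {x} {y} {z} → min-greatest {x} {y} {_} {z} (proj₂ (proj₂ (proj₂ (min x y))))
    ; Dir        = Dir
    ; Dir⇒⊏      = λ { {x = just a} (l , _) → l }
    ; Dir-exists = λ { {just a} l → let (i , c , _) = uniqueColor a in i , l , c
                     ; {nothing} (_ , ¬l) → contradiction tt ¬l }
    ; Dir-unique = λ { {x = just a} (_ , c) (_ , d) → let (_ , _ , u) = uniqueColor a in trans (sym (u c)) (u d) }
    ; Dir-mono   = λ { {x = just a} {y} {z} ((p , ¬p) , c) q →
                       (⊑-trans {just a} {y} {z} p q , λ q′ → ¬p (⊑-trans {y} {z} {just a} q q′)) , c }
    ; Dir-respˡ  = λ { {x = just a} {just b} {z} (p , q) ((l , ¬l) , c) →
                       (⊑-trans {just b} {just a} {z} q l , λ m → ¬l (⊑-trans {z} {just b} {just a} m q)) ,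
                       color-cong (≋⇒≈ p q) c
                     ; {x = just a} {nothing} (_ , ()) _ }
    }

  private
    just-accessible : ∀ a → Acc _<_ a → Acc _⊏_ (just a)
    just-accessible a (acc rs) =
      acc λ { {just b} l → just-accessible b (rs (⊏⇒< l)) ; {nothing} (() , _) }

  extended-wellFounded : WellFounded (PrefixOrder._⊏_ extended)
  extended-wellFounded (just a) = just-accessible a (wellFounded a)
  extended-wellFounded nothing  = acc λ { {just b} _ → just-accessible b (wellFounded b)
                                        ; {nothing} (_ , ¬l) → contradiction tt ¬l }

  bottom : Carrier → ∃[ a ] ∀ b → just a ⊑ just b
  bottom a₀ = let (a , _ , min) = least wellFounded (λ _ → ⊤) (a₀ , tt) in a , λ b l → min l tt

  extended-presents : ∀ {a} → (∀ b → just a ⊑ just b) → Presents A extended (just a) nothing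
  extended-presents h = record
    { point = just
    ; lower = h
    ; upper = λ _ → tt , λ ()
    ; onto  = λ { {just b} _ _ → b , ⊑-refl {just b} , ⊑-refl {just b}
               ; {nothing} _ (_ , ¬l) → contradiction tt ¬l }
    ; ≈-⇔   = mk⇔ (λ e → ≈⇒⊑ e , ≈⇒⊑ (≈.sym e)) (λ (p , q) → ≋⇒≈ p q)
    ; lt-⇔  = mk⇔ <⇒⊏ ⊏⇒< ⇔-∘ pr-η₂ A lt
    ; col-⇔ = mk⇔ (λ c → (tt , λ ()) , color-cong ≈.refl c) (λ (_ , c) → color-cong ≈.refl c)
    }

-- Limits of bounded chains of nodes

module Limits (em : ExcludedMiddle 0ℓ) (n : ℕ) where
  open Least em
  open NodeTree em
  open TreeLike (nodeTree n) using (_⊏_; ⊏-⇔; ⊏-⊑-trans)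

  ⊏⇒len< : ∀ s t → s ⊏ t → len s <Ω len t
  ⊏⇒len< s t l = ⊊⇒< {s = s} {t} (from ⊏-⇔ l)

  module _ (y : ℕ → Node n) (increasing : ∀ k → y k ⊏ y (suc k)) where

    chain : ∀ k l → y k ⊆ y (l ℕ.+ k)
    chain k zero    = ⊆ᴺ-refl
    chain k (suc l) = ⊆ᴺ-trans (chain k l) (proj₁ (increasing (l ℕ.+ k)))

    private
      chain-≤ : ∀ {k l} → k ℕ.≤ l → y k ⊆ y l
      chain-≤ {k} {l} p = subst (λ i → y k ⊆ y i) (ℕ.m∸n+n≡m p) (chain k (l ℕ.∸ k))

      coherent : ∀ k l γ p q → entry (y k) γ p ≡ entry (y l) γ q
      coherent k l γ p q with ℕ.≤-total k l
      ... | inj₁ m = proj₂ (apply (chain-≤ m) γ p)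
      ... | inj₂ m = sym (proj₂ (apply (chain-≤ m) γ q))

    module _ {β : Ω} (bounded : ∀ k → len (y k) <Ω β) where

      private
        sup : ∃[ γ ] (∀ k → len (y k) <Ω γ) × (∀ {δ} → δ <Ω γ → ¬ (∀ k → len (y k) <Ω δ))
        sup = least <Ω-wellFounded (λ γ → ∀ k → len (y k) <Ω γ) (β , bounded)

        height : Ω
        height = proj₁ sup

        reach : ∀ γ → γ <Ω height → ∃[ k ] γ <Ω len (y k)
        reach γ p with ¬∀⇒∃¬ (proj₂ (proj₂ sup) {γ} p)
        ... | k , ¬l with <Ω-compare γ (len (y k))
        ...   | tri< l _ _ = k , l
        ...   | tri≈ _ refl _ = suc k , ⊏⇒len< (y k) (y (suc k)) (increasing k)
        ...   | tri> _ _ l = contradiction l ¬l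

        -- `entry` receives its bound irrelevantly; decidability of the order recovers a proof from
        -- which to compute `k`.
        reach′ : ∀ γ → .(γ <Ω height) → ∃[ k ] γ <Ω len (y k)
        reach′ γ p = reach γ (recompute (γ <Ω? height) p)

      -- The bound `β` guarantees a height inside ω^ω. Taking the least ordinal above all lengths
      -- makes the chain cofinal: each position of the limit is a position of some `y k`.
      limit : Node n
      limit = node height λ γ p → entry (y (proj₁ (reach′ γ p))) γ (proj₂ (reach′ γ p))

      ⊏-limit : ∀ k → y k ⊏ limit
      ⊏-limit k = ⊏-⊑-trans {x = y k} {y (suc k)} {limit} (increasing k) (incl λ γ p →
        let q = <Ω-trans {γ} {len (y (suc k))} {height} p (proj₁ (proj₂ sup) (suc k))
            (l , r) = reach′ γ q
        in q , coherent (suc k) l γ p r)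

      limit-reached : ∀ {w} → w ⊏ limit → ∃[ k ] w ⊏ y k
      limit-reached {w} l with reach (len w) (⊏⇒len< w limit l)
      ... | k , p with ⊆-linear (proj₁ l) (proj₁ (⊏-limit k))
      ...   | inj₁ q = k , q , λ q′ → ⊆⇒≯ q′ p
      ...   | inj₂ q = contradiction p (⊆⇒≯ q)

      limit-bounded : ¬ β <Ω len limit
      limit-bounded l = proj₂ (proj₂ sup) {β} l bounded

module Singletons (em : ExcludedMiddle 0ℓ) where

  -- The only possible move is at the start; it leaves an empty interval and the same one-point
  -- interval again.
  Sim-single : ∀ {n} {K L : PrefixOrder n}
               {r i x y x′ y′} → PrefixOrder.Dir K i x y → ¬ (∃[ z ] K ⊢ x ⊏ z × K ⊢ z ⊏ y) →
               PrefixOrder.Dir L i x′ y′ → ¬ (∃[ z ] L ⊢ x′ ⊏ z × L ⊢ z ⊏ y′) → Sim K L r x y x′ y′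
  Sim-single {r = zero}  _ _ _ _ = stop
  Sim-single {K = K} {L} {suc r} d none d′ none′ = step
    (λ p e → single {K = K} {L} d none d′ none′ p e)
    (λ p e → let (z , l , d , s , t) = single {K = L} {K} d′ none′ d none p e
             in z , l , d , Sim-sym s , Sim-sym t)
    where
    single : ∀ {n r} {K L : PrefixOrder n}
             {i x y x′ y′} → PrefixOrder.Dir K i x y → ¬ (∃[ z ] K ⊢ x ⊏ z × K ⊢ z ⊏ y) →
             PrefixOrder.Dir L i x′ y′ → ¬ (∃[ z ] L ⊢ x′ ⊏ z × L ⊢ z ⊏ y′) →
             ∀ {j z} → K ⊢ x ⊑ z → PrefixOrder.Dir K j z y →
             ∃[ z′ ] L ⊢ x′ ⊑ z′ × PrefixOrder.Dir L j z′ y′ × Sim K L r x z x′ z′ × Sim K L r z y z′ y′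
    single {K = K} {L} {i} {x} {y} {x′} {y′} d none d′ none′ {j} {z} p e with em {PrefixOrder._⊑_ K z x}
    ... | no ¬q = contradiction (z , (p , ¬q) , PrefixOrder.Dir⇒⊏ K e) none
    ... | yes q = x′ , PrefixOrder.⊑-refl L ,
      subst (λ k → PrefixOrder.Dir L k x′ y′)
        (PrefixOrder.Dir-unique K (PrefixOrder.Dir-respˡ K (p , q) d) e) d′ ,
      Sim-empty (λ (_ , ¬q) → ¬q q) (λ (_ , ¬q) → ¬q (PrefixOrder.⊑-refl L)) ,
      Sim-single (PrefixOrder.Dir-respˡ K (p , q) d)
        (λ (w , l , l′) → none (w , PrefixOrder.⊑-⊏-trans K p l , l′)) d′ none′

-- Copies of well-founded intervals above every node

module Realization (em : ExcludedMiddle 0ℓ) {n} (K : PrefixOrder n)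
                   (wf : WellFounded (PrefixOrder._⊏_ K)) (q : ℕ) where
  open Least em
  open NodeTree em
  open Intervals em
  open Tests em
  open Limits em n
  open Singletons em

  private
    module K = PrefixOrder K
    module N = TreeLike (nodeTree n)

    T : PrefixOrder n
    T = N.prefixOrder

    module T = PrefixOrder T

  -- The copy stays below the next multiple of ω^m, so copies can be chained without limit.
  record Good (m : ℕ) (b a : Point K) : Set where
    constructor good
    field copy : ∀ s → ∃[ t ] s N.⊏ t × len t <Ω up m (len s) × Sim K T q b a s t

  open Good

  up-mono-≤ : ∀ {m m′ γ} → m ℕ.≤ m′ → ∀ α → γ <Ω up m α → γ <Ω up m′ α
  up-mono-≤ {m} {m′} {γ} p α l with ℕ.m≤n⇒m<n∨m≡n p
  ... | inj₁ m<m′ = <Ω-trans {γ} {up m α} {up m′ α} l (up-mono m<m′ α)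
  ... | inj₂ refl = l

  Good-mono : ∀ {m m′ b a} → m ℕ.≤ m′ → Good m b a → Good m′ b a
  Good-mono p (good g) = good λ s →
    let (t , l , l′ , sim) = g s in t , l , up-mono-≤ {γ = len t} p (len s) l′ , sim

  Good-+ : ∀ {m m′ b c a} → b K.⊑ c → c K.⊑ a → Good m b c → Good m′ c a → Good (m ℕ.⊔ m′) b a
  Good-+ {m} {m′} p p′ g g′ = good λ s →
    let (t , l , h , sim) = copy (Good-mono (ℕ.m≤m⊔n m m′) g) s
        (u , l′ , h′ , sim′) = copy (Good-mono (ℕ.m≤n⊔m m m′) g′) t
    in u , N.⊏-⊑-trans {x = s} {t} {u} l (proj₁ l′) , up-idem (m ℕ.⊔ m′) (len s) {len t} {len u} h h′ ,
       Sim-+ p p′ (proj₁ l) (proj₁ l′) sim sim′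

  Good-sim : ∀ {m b a b′ a′} → Sim K K q b a b′ a′ → Good m b′ a′ → Good m b a
  Good-sim sim (good g) = good λ s → let (t , l , h , sim′) = g s in t , l , h , Sim-trans sim sim′

  -- The copy is a single successor step, which stays below the next multiple of ω; hence the
  -- exponent 1.
  Good-single : ∀ {b a} → b K.⊏ a → ¬ (∃[ z ] b K.⊏ z × z K.⊏ a) → Good 1 b a
  Good-single l none = good λ s →
    let (i , d)      = K.Dir-exists l
        (d′ , none′) = to (N.E-⇔ em {i} {s} {append i s}) (⊆ᴺ-refl , ⊆ᴺ-refl)
    in append i s , N.Dir⇒⊏ d′ , sucΩ-<-up (len s) , Sim-single d none d′ none′

  module _ {a : Point K} (h : ℕ → Point K) (h-⊏ : ∀ k → h k K.⊏ h (suc k)) (h⊏a : ∀ k → h k K.⊏ a)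
           -- The right halves get two more rounds so that `Sim-first` applies to them: `z` and `z′`
           -- then have the same color.
           (reflect : ∀ k {z} → h k K.⊑ z → z K.⊏ a → ∃[ z′ ] h k K.⊑ z′ × z′ K.⊏ h (suc k) ×
                      Sim K K q (h k) z (h k) z′ × Sim K K (2 ℕ.+ q) z a z′ a)
           (y : ℕ → Node n) (y-⊏ : ∀ k → y k N.⊏ y (suc k))
           (U : Node n) (y⊏U : ∀ k → y k N.⊏ U) (reached : ∀ {w} → w N.⊏ U → ∃[ k ] w N.⊏ y k)
           (sim : ∀ k → Sim K T q (h k) (h (suc k)) (y k) (y (suc k))) where

    private
      y-⊑ : ∀ k l → y k N.⊑ y (l ℕ.+ k)
      y-⊑ = chain y y-⊏

      h-⊑ : ∀ k l → h k K.⊑ h (l ℕ.+ k)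
      h-⊑ k zero    = K.⊑-refl
      h-⊑ k (suc l) = K.⊑-trans (h-⊑ k l) (proj₁ (h-⊏ (l ℕ.+ k)))

      sim-+ : ∀ k l → Sim K T q (h k) (h (l ℕ.+ k)) (y k) (y (l ℕ.+ k))
      sim-+ k zero    = Sim-empty (λ (_ , ¬p) → ¬p K.⊑-refl) (λ (_ , ¬p) → ¬p (⊆ᴺ-refl {s = y k}))
      sim-+ k (suc l) = Sim-+ (h-⊑ k l) (proj₁ (h-⊏ (l ℕ.+ k))) (y-⊑ k l) (proj₁ (y-⊏ (l ℕ.+ k)))
                          (sim-+ k l) (sim (l ℕ.+ k))

      module _ {j : ℕ} (j<q : j ℕ.< q) (ih : ∀ k → Sim K T j (h k) a (y k) U) (k : ℕ) where

        -- Reflection replaces `z` by a point below `h (suc k)`, where the copy of a single piece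
        -- can answer. What lies beyond that piece is covered by `ih` at `suc k`.
        forth : ∀ {i z} → h k K.⊑ z → K.Dir i z a →
                ∃[ w ] y k N.⊑ w × N.Dir i w U × Sim K T j (h k) z (y k) w × Sim K T j z a w U
        forth p d with reflect k p (K.Dir⇒⊏ d) | Sim-antitone j<q (sim k)
        ... | z′ , p′ , l , s₁ , s₂ | step f _ =
          let d′ = Sim-first (Sim-antitone (s≤s (s≤s z≤n)) s₂) d
              (w , p″ , d″ , s₃ , s₄) = f p′ (K.Dir-cut l (proj₁ (h⊏a (suc k))) d′)
          in w , p″ , T.Dir-mono {x = w} {y (suc k)} {U} d″ (proj₁ (y⊏U (suc k))) ,
             Sim-trans (Sim-antitone (ℕ.<⇒≤ j<q) s₁) s₃ ,
             Sim-trans (Sim-antitone (ℕ.≤-trans (ℕ.<⇒≤ j<q) (ℕ.m≤n+m q 2)) s₂)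
               (Sim-+ (proj₁ l) (proj₁ (h⊏a (suc k))) (proj₁ (N.Dir⇒⊏ {x = w} {y (suc k)} d″))
                      (proj₁ (y⊏U (suc k)))
                 s₄ (ih (suc k)))

        -- The `y l` are cofinal in `U`, so `w` lies within finitely many copied pieces, whose
        -- concatenation answers it.
        back : ∀ {i w} → y k N.⊑ w → N.Dir i w U →
               ∃[ z ] h k K.⊑ z × K.Dir i z a × Sim K T j (h k) z (y k) w × Sim K T j z a w U
        back {i} {w} p d with reached {w} (N.Dir⇒⊏ {x = w} {U} d)
        ... | l , w⊏ with Sim-antitone j<q (sim-+ k l)
        ...   | step _ b =
          let w⊏′ = N.⊏-⊑-trans {x = w} {y l} {y (l ℕ.+ k)} w⊏
                      (subst (λ i → y l ⊆ y i) (ℕ.+-comm k l) (y-⊑ l k))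
              U⊒  = proj₁ (y⊏U (l ℕ.+ k))
              (z , p′ , d′ , s₁ , s₂) = b {z′ = w} p (T.Dir-cut {x = w} {y (l ℕ.+ k)} {U} w⊏′ U⊒ d)
          in z , p′ , K.Dir-mono d′ (proj₁ (h⊏a (l ℕ.+ k))) , s₁ ,
             Sim-+ (proj₁ (K.Dir⇒⊏ d′)) (proj₁ (h⊏a (l ℕ.+ k))) (proj₁ w⊏′) U⊒ s₂ (ih (l ℕ.+ k))

    -- Induction on the number of rounds, for all `k` at once, because after a move the remaining
    -- interval is continued from a later `h`.
    Sim-limit : ∀ j → j ℕ.≤ q → ∀ k → Sim K T j (h k) a (y k) U
    Sim-limit zero    _   k = stop
    Sim-limit (suc j) j<q k = step (forth j<q (Sim-limit j (ℕ.<⇒≤ j<q)) k) (back j<q (Sim-limit j (ℕ.<⇒≤ j<q)) k)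

  -- Each stage of the chain stays below `up m (len s)`. The limit may attain this length, so the
  -- exponent grows by one.
  Good-limit : ∀ {a m} (h : ℕ → Point K) → (∀ k → h k K.⊏ h (suc k)) → (∀ k → h k K.⊏ a) →
               (∀ k {z} → h k K.⊑ z → z K.⊏ a → ∃[ z′ ] h k K.⊑ z′ × z′ K.⊏ h (suc k) ×
                 Sim K K q (h k) z (h k) z′ × Sim K K (2 ℕ.+ q) z a z′ a) →
               (∀ k → Good m (h k) (h (suc k))) → Good (suc m) (h 0) a
  Good-limit {a} {m} h h-⊏ h⊏a reflect copies = good λ s →
    complete s (limit (y s) (y-⊏ s) (y-bounded s)) (⊏-limit (y s) (y-⊏ s) (y-bounded s))
      (λ {w} → limit-reached (y s) (y-⊏ s) (y-bounded s) {w})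
      (limit-bounded (y s) (y-⊏ s) {up m (len s)} (y-bounded s))
    where
    y : Node n → ℕ → Node n
    y s zero    = s
    y s (suc k) = proj₁ (copy (copies k) (y s k))

    y-⊏ : ∀ s k → y s k N.⊏ y s (suc k)
    y-⊏ s k = proj₁ (proj₂ (copy (copies k) (y s k)))

    y-bounded : ∀ s k → len (y s k) <Ω up m (len s)
    y-bounded s zero    = <Ω-up m (len s)
    y-bounded s (suc k) = up-idem m (len s) {len (y s k)} {len (y s (suc k))} (y-bounded s k)
      (proj₁ (proj₂ (proj₂ (copy (copies k) (y s k)))))

    y-sim : ∀ s k → Sim K T q (h k) (h (suc k)) (y s k) (y s (suc k))
    y-sim s k = proj₂ (proj₂ (proj₂ (copy (copies k) (y s k))))

    complete : ∀ s U → (∀ k → y s k N.⊏ U) → (∀ {w} → w N.⊏ U → ∃[ k ] w N.⊏ y s k) → ¬ up m (len s) <Ω len U →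
               ∃[ t ] s N.⊏ t × len t <Ω up (suc m) (len s) × Sim K T q (h 0) a s t
    complete s U y⊏U reached ¬l = U , y⊏U 0 , below ,
      Sim-limit h h-⊏ h⊏a reflect (y s) (y-⊏ s) U y⊏U reached (y-sim s) q ℕ.≤-refl 0
      where
      below : len U <Ω up (suc m) (len s)
      below with <Ω-compare (len U) (up m (len s))
      ... | tri< l _ _ = <Ω-trans {len U} {up m (len s)} {up (suc m) (len s)} l (up-mono ℕ.≤-refl (len s))
      ... | tri≈ _ e _ = subst (_<Ω up (suc m) (len s)) (sym e) (up-mono ℕ.≤-refl (len s))
      ... | tri> _ _ l = contradiction l ¬l

  module _ {a b : Point K} (b⊏a : b K.⊏ a) (dense : ∀ {c} → b K.⊑ c → c K.⊏ a → ∃[ d ] c K.⊏ d × d K.⊏ a)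
           (below : ∀ {c d} → d K.⊏ a → c K.⊏ d → ∃[ m ] Good m c d) where

    private
      Index : Set
      Index = ∃[ c ] b K.⊑ c × c K.⊏ a

    -- Induction gives each interval its own exponent, but a limit needs a common one. Being good
    -- depends only on the `q`-round type, and there are finitely many types.
    uniform : ∃[ m ] ∀ {c d} → c K.⊏ d → d K.⊏ a → Good m c d
    uniform =
      let (m , f) = uniform-bound Bounded ℕ._⊔_
            (λ {i} {j} {k} → Good-mono (ℕ.m≤m⊔n j k)) (λ {i} {j} {k} → Good-mono (ℕ.m≤n⊔m j k)) 0
            (List.map test (tests n q)) Proper
            (λ (l , l′) → below l′ l)
      in m , λ {c} {d} l l′ → let (_ , _ , agree , g) = f {c , d} (l , l′)
                              in Good-sim (agree⇒Sim λ {t} t∈ → agree {test t} (∈-map⁺ test t∈)) g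
      where
      Proper : Pred (Point K × Point K) 0ℓ
      Proper (c , d) = c K.⊏ d × d K.⊏ a

      Bounded : Point K × Point K → ℕ → Set
      Bounded (c , d) m = Good m c d

      test : Test n → Pred (Point K × Point K) 0ℓ
      test t (c , d) = Holds K t c d

    -- Up to Sim there are finitely many ways to split [h , a), hence some h′ ⊏ a bounds a
    -- representative of each.
    reflect : ∀ ((h , _) : Index) → Σ[ (h′ , _) ∈ Index ] h K.⊏ h′ × ∀ {z} → h K.⊑ z → z K.⊏ a →
              ∃[ z′ ] h K.⊑ z′ × z′ K.⊏ h′ × Sim K K q h z h z′ × Sim K K (2 ℕ.+ q) z a z′ a
    reflect (h , b⊑h , h⊏a) =
      let ((h′ , p , l) , f) = uniform-bound Bounded max
            (λ {i} {j} {k} l → K.⊏-⊑-trans l (max-ˡ j k)) (λ {i} {j} {k} l → K.⊏-⊑-trans l (max-ʳ j k))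
            (h , K.⊑-refl , h⊏a)
            (List.map left (tests n q) ++ List.map right (tests n (2 ℕ.+ q)))
            (λ z → h K.⊑ z × z K.⊏ a)
            (λ (l , l′) → let (d , m , m′) = dense (K.⊑-trans b⊑h l) l′ in (d , K.⊑-trans l (proj₁ m) , m′) , m)
          (_ , (u , _) , _ , v) = f {h} (K.⊑-refl , h⊏a)
      in (h′ , K.⊑-trans b⊑h p , l) , K.⊑-⊏-trans u v , λ {z} u v →
        let (z′ , (u′ , _) , agree , v′) = f {z} (u , v)
        in z′ , u′ , v′ ,
           agree⇒Sim (λ {t} t∈ → agree {left t} (∈-++⁺ˡ (∈-map⁺ left t∈))) ,
           agree⇒Sim (λ {t} t∈ → agree {right t} (∈-++⁺ʳ (List.map left (tests n q)) (∈-map⁺ right t∈)))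
      where
      Later : Set
      Later = ∃[ c ] h K.⊑ c × c K.⊏ a

      Bounded : Point K → Later → Set
      Bounded z (c , _) = z K.⊏ c

      left right : Test n → Pred (Point K) 0ℓ
      left t z  = Holds K t h z
      right t z = Holds K t z a

      max-with : ∀ (j k : Later) → proj₁ j K.⊑ proj₁ k ⊎ proj₁ k K.⊑ proj₁ j →
                 Σ[ l ∈ Later ] proj₁ j K.⊑ proj₁ l × proj₁ k K.⊑ proj₁ l
      max-with j k (inj₁ l) = k , l , K.⊑-refl
      max-with j k (inj₂ l) = j , K.⊑-refl , l

      max-spec : ∀ (j k : Later) → Σ[ l ∈ Later ] proj₁ j K.⊑ proj₁ l × proj₁ k K.⊑ proj₁ l
      max-spec j k = max-with j k (K.⊑-linear (proj₁ (proj₂ (proj₂ j))) (proj₁ (proj₂ (proj₂ k))))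

      max : Later → Later → Later
      max j k = proj₁ (max-spec j k)

      max-ˡ : ∀ j k → proj₁ j K.⊑ proj₁ (max j k)
      max-ˡ j k = proj₁ (proj₂ (max-spec j k))

      max-ʳ : ∀ j k → proj₁ k K.⊑ proj₁ (max j k)
      max-ʳ j k = proj₂ (proj₂ (max-spec j k))

    Good-dense : ∃[ m ] Good m b a
    Good-dense = _ , Good-limit (proj₁ ∘ index) (λ k → proj₁ (proj₂ (reflect (index k))))
      (λ k → proj₂ (proj₂ (index k))) (λ k → proj₂ (proj₂ (reflect (index k))))
      (λ k → proj₂ uniform (proj₁ (proj₂ (reflect (index k)))) (proj₂ (proj₂ (index (suc k)))))
      where
      index : ℕ → Index
      index zero    = b , K.⊑-refl , b⊏a
      index (suc k) = proj₁ (reflect (index k))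

  -- An immediate predecessor of `a` at or above `b` splits off a one-point interval. If there is
  -- none, points of the interval can always be increased below `a`, which is what the limit
  -- construction needs.
  all-good : ∀ {b} a → Acc K._⊏_ a → b K.⊏ a → ∃[ m ] Good m b a
  all-good {b} a (acc rs) b⊏a with em {∃[ p ] b K.⊑ p × p K.⊏ a × ¬ (∃[ z ] p K.⊏ z × z K.⊏ a)}
  ... | no dense = Good-dense b⊏a (λ {c} p l → stable (λ none → dense (c , p , l , none)))
                         (λ {_} {d} l l′ → all-good d (rs l) l′)
    where
    stable : ∀ {A : Set} → ¬ ¬ A → A
    stable {A} ¬¬p with em {A}
    ... | yes p = p
    ... | no ¬p = contradiction ¬p ¬¬p
  ... | yes (p , b⊑p , p⊏a , none) with em {p K.⊑ b}
  ...   | yes p⊑b = 1 , Good-single b⊏a λ (z , l , l′) → none (z , K.⊑-⊏-trans p⊑b l , l′)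
  ...   | no ¬p⊑b = let (m , g) = all-good p (rs p⊏a) (b⊑p , ¬p⊑b) in
    _ , Good-+ b⊑p (proj₁ p⊏a) g (Good-single p⊏a none)

-- The standard model

module StandardModel (em : ExcludedMiddle 0ℓ) {n} (S : CharacteristicSystem n) where
  open NodeTree em
  open Segments em
  open TreeLike (nodeTree n)

  private
    module T = Structure (tree-qe em S)

  tree-rel-isReduct : IsReduct rel↪qe (tree-rel n) (tree-qe em S)
  tree-rel-isReduct = record
    { image⟨_⟩ = id
    ; onto     = λ y → y , T.≈.refl {y}
    ; ≈-⇔      = ⇔-id _
    ; func-≈   = λ ()
    ; pr-⇔     = λ _ → ⇔-id _
    }

  private
    module _ {q : ℕ} {σ : Fin (size S q)} {x y : Node n} where

      relativized : (Seg prefixOrder x y ⊨ sentence S q σ) ⇔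
                    Sat (tree-rel n) (x ◂ y ◂ ⟨⟩) (relativize (sentence S q σ))
      relativized = ⇔-sym (relativize-⇔ (sentence S q σ) (λ ()) refl refl)

      P-intro : ∀ {xs : Vector (Node n) 2} → xs 0F ≡ x → xs 1F ≡ y → x ⊏ y →
                Seg prefixOrder x y ⊨ sentence S q σ →
                T.pr (P q σ) xs
      P-intro refl refl l s = from ⊏-⇔ l ,
        Sat-cong (tree-rel n) (λ { 0F → T.≈.refl {x} ; 1F → T.≈.refl {y} }) (relativize (sentence S q σ))
          (to relativized s)

  Seg-realize : ∀ q σ x → ∃[ y ] x ⊏ y × (Seg prefixOrder x y ⊨ sentence S q σ)
  Seg-realize q σ x =
    let (A , (ordinal , a₀) , _ , isChar) = characteristic S q σ
        φ        = sentence S q σ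
        open Extended em ordinal
        (a , a≤) = bottom a₀
        -- Two rounds beyond the quantifier rank of `φ`, as `Sim⇒⊨` requires. The top point
        -- `nothing` is the end of the interval formed by all of `A`.
        (_ , g)  = Realization.all-good em extended extended-wellFounded (2 ℕ.+ weightedRank (λ _ → 0) φ)
                     nothing (extended-wellFounded nothing) (tt , λ ())
        (y , l , _ , sim) = Realization.Good.copy g x
    in y , l , to (Sim⇒⊨ (extended-presents {a} a≤) (Seg-presents prefixOrder x y) (tt , λ ()) l φ sim)
                  (from (isChar A) (λ _ _ → ⇔-id _))

  tree-qe-model : ∀ ψ → T¹ S ψ → tree-qe em S ⊨ ψ
  tree-qe-model _ ⊆-refl      x = ⊑-refl {x}
  tree-qe-model _ ⊆-antisym   y x = id
  tree-qe-model _ ⊆-trans     z y x (p , q) = ⊆ᴺ-trans p q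
  tree-qe-model _ ε-least     x = empty-⊆ x
  tree-qe-model _ pred-linear z y x (p , q) = ⊆-linear p q
  tree-qe-model _ meet-lower  y x = ⋏-lowerˡ x y , ⋏-lowerʳ x y
  tree-qe-model _ meet-great  z y x (p , q) = ⋏-greatest {x} {y} {z} p q
  tree-qe-model _ (E-total i) x = append i x , T.≈.refl {append i x} , λ y e → e
  tree-qe-model _ (E-cover i) y x e =
    E-⊏ {i} {x} {y} e , λ (z , p , q) → E-immediate {i} {x} {y} {z} e p q
  tree-qe-model _ (E-disjoint i j i≢j) z y x (e , e′) = E-separate {i} {j} {x} {y} {z} i≢j e e′
  tree-qe-model _ branching   y x p =
    let (i , z , e , l) = E-branch {x} {y} p
    in ⋁⁺ {M = tree-qe em S} (λ i → ∃′ (atom (rel (edge i)) (var 1F ◂ var 0F ◂ ⟨⟩) ∧′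
                                              atom (rel sub) (var 0F ◂ var 2F ◂ ⟨⟩)))
         i (z , e , l)
  tree-qe-model _ (P-def q σ) y x =
    (λ (l , s) → l , to (IsReduct.Sat-embed tree-rel-isReduct φ)
      (Sat-cong (tree-rel n) (λ { 0F → T.≈.refl {x} ; 1F → T.≈.refl {y} }) φ s)) ,
    (λ (l , s) → P-intro {x = x} {y} refl refl (to ⊏-⇔ l)
      (from relativized (from (IsReduct.Sat-embed tree-rel-isReduct φ) s)))
    where φ = relativize (sentence S q σ)
  tree-qe-model _ (P-exhaust q) y x l =
    let (σ , s , _) = exactlyOne S q (Seg prefixOrder x y)
          (Seg-isColoredOrdinal n x y , x , ⊑-refl {x} , to ⊏-⇔ l)
    in ⋁⁺ {M = tree-qe em S} (λ σ → atom (P q σ) (var 0F ◂ var 1F ◂ ⟨⟩)) σ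
         (P-intro {x = x} {y} refl refl (to ⊏-⇔ l) s)
  tree-qe-model _ (realization q σ) x =
    let (y , l , s) = Seg-realize q σ x in y , P-intro {x = x} {y} refl refl l s

-- Successor functions and their graphs

-- Variable `v` is the value of the term. Each successor in the term becomes an edge, with a
-- quantified name for the value of its argument.
graph : ∀ {m} → Term (ℒ-fun n) k → (Fin k → Fin m) → Fin m → Formula (ℒ-rel n) m
graph (var i)           ren v = var (ren i) ≐ var v
graph (app (succ i) ts) ren v =
  ∃′ (graph (ts 0F) (suc ∘ ren) 0F ∧′ atom (edge i) (var 0F ◂ var (suc v) ◂ ⟨⟩))

fun→rel : Formula (ℒ-fun n) k → Formula (ℒ-rel n) k
fun→rel (atom sub ts) = ∃′ (∃′ (graph (ts 0F) (λ i → suc (suc i)) 1F ∧′ graph (ts 1F) (λ i → suc (suc i)) 0F ∧′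
                                atom sub (var 1F ◂ var 0F ◂ ⟨⟩)))
fun→rel (s ≐ t)       = ∃′ (graph s suc 0F ∧′ graph t suc 0F)
fun→rel ⊥′            = ⊥′
fun→rel (φ ∧′ ψ)      = fun→rel φ ∧′ fun→rel ψ
fun→rel (φ ∨′ ψ)      = fun→rel φ ∨′ fun→rel ψ
fun→rel (φ ⇒′ ψ)      = fun→rel φ ⇒′ fun→rel ψ
fun→rel (∀′ φ)        = ∀′ (fun→rel φ)
fun→rel (∃′ φ)        = ∃′ (fun→rel φ)

term→fun : Term (ℒ-rel n) k → Term (ℒ-fun n) k
term→fun (var i) = var i

rel→fun : Formula (ℒ-rel n) k → Formula (ℒ-fun n) k
rel→fun (atom sub ts)      = atom sub (term→fun ∘ ts)
rel→fun (atom (edge i) ts) = term→fun (ts 1F) ≐ app (succ i) (term→fun (ts 0F) ◂ ⟨⟩)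
rel→fun (s ≐ t)            = term→fun s ≐ term→fun t
rel→fun ⊥′                 = ⊥′
rel→fun (φ ∧′ ψ)           = rel→fun φ ∧′ rel→fun ψ
rel→fun (φ ∨′ ψ)           = rel→fun φ ∨′ rel→fun ψ
rel→fun (φ ⇒′ ψ)           = rel→fun φ ⇒′ rel→fun ψ
rel→fun (∀′ φ)             = ∀′ (rel→fun φ)
rel→fun (∃′ φ)             = ∃′ (rel→fun φ)

∃-⇔ : ∀ {A : Set} {Q R : A → Set} → (∀ a → Q a ⇔ R a) → ∃ Q ⇔ ∃ R
∃-⇔ e = mk⇔ (λ (a , p) → a , to (e a) p) (λ (a , p) → a , from (e a) p)

module _ {n} (M : Structure (ℒ-common n)) (graphs : ∀ χ → GraphAxioms χ → M ⊨ χ) where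
  open Structure M

  private
    fun : Formula (ℒ-fun n) k → Formula (ℒ-common n) k
    fun = embed fun↪common

    rel′ : Formula (ℒ-rel n) k → Formula (ℒ-common n) k
    rel′ = embed rel↪common

    S : Fin n → Carrier → Carrier
    S i x = func (succ i) (x ◂ ⟨⟩)

    S-η : ∀ {i xs x} → xs 0F ≈ x → func (succ i) xs ≈ S i x
    S-η e = func-cong (succ _) λ { 0F → e }

    edge-⇔ : ∀ {i xs} → pr (edge i) xs ⇔ xs 1F ≈ S i (xs 0F)
    edge-⇔ {i} {xs} = mk⇔
      (λ e → ≈.trans (proj₁ ax (from (pr-η₂ M (edge i)) (to (pr-η₂ M (edge i)) e))) (S-η ≈.refl))
      (λ e → from (pr-η₂ M (edge i)) (to (pr-η₂ M (edge i)) (proj₂ ax (≈.trans e (≈.sym (S-η ≈.refl))))))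
      where ax = graphs _ (i , refl) (xs 1F) (xs 0F)

  graph-⇔ : ∀ {m} (t : Term (ℒ-fun n) k) {ren : Fin k → Fin m} {v ρ τ} → (∀ i → τ (ren i) ≡ ρ i) →
            Sat M τ (rel′ (graph t ren v)) ⇔ eval M ρ (embedᵗ fun↪common t) ≈ τ v
  graph-⇔ (var i) e rewrite e i = ⇔-id _
  graph-⇔ (app (succ i) ts) e = mk⇔
    (λ (y , p , q) → ≈.trans (S-η (to (graph-⇔ (ts 0F) e) p)) (≈.sym (to edge-⇔ q)))
    (λ p → _ , from (graph-⇔ (ts 0F) e) ≈.refl , from edge-⇔ (≈.trans (≈.sym p) (S-η ≈.refl)))

  fun→rel-⇔ : ∀ (φ : Formula (ℒ-fun n) k) {ρ} → Sat M ρ (rel′ (fun→rel φ)) ⇔ Sat M ρ (fun φ)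
  fun→rel-⇔ (atom sub ts) = mk⇔
    (λ (x , y , p , q , l) → pr-cong sub
      (λ { 0F → ≈.sym (to (graph-⇔ (ts 0F) λ _ → refl) p) ; 1F → ≈.sym (to (graph-⇔ (ts 1F) λ _ → refl) q) }) l)
    (λ l → _ , _ , from (graph-⇔ (ts 0F) λ _ → refl) ≈.refl , from (graph-⇔ (ts 1F) λ _ → refl) ≈.refl ,
      pr-cong sub (λ { 0F → ≈.refl ; 1F → ≈.refl }) l)
  fun→rel-⇔ (s ≐ t)  = mk⇔
    (λ (x , p , q) → ≈.trans (to (graph-⇔ s λ _ → refl) p) (≈.sym (to (graph-⇔ t λ _ → refl) q)))
    (λ p → _ , from (graph-⇔ s λ _ → refl) p , from (graph-⇔ t λ _ → refl) ≈.refl)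
  fun→rel-⇔ ⊥′       = ⇔-id _
  fun→rel-⇔ (φ ∧′ ψ) = fun→rel-⇔ φ ×-⇔ fun→rel-⇔ ψ
  fun→rel-⇔ (φ ∨′ ψ) = fun→rel-⇔ φ ⊎-⇔ fun→rel-⇔ ψ
  fun→rel-⇔ (φ ⇒′ ψ) = →-cong-⇔ (fun→rel-⇔ φ) (fun→rel-⇔ ψ)
  fun→rel-⇔ (∀′ φ)   = ∀-⇔ λ _ → fun→rel-⇔ φ
  fun→rel-⇔ (∃′ φ)   = ∃-⇔ λ _ → fun→rel-⇔ φ

  private
    term-≈ : ∀ (t : Term (ℒ-rel n) k) {ρ} →
             eval M ρ (embedᵗ rel↪common t) ≈ eval M ρ (embedᵗ fun↪common (term→fun t))
    term-≈ (var i) = ≈.refl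

  rel→fun-⇔ : ∀ (φ : Formula (ℒ-rel n) k) {ρ} → Sat M ρ (fun (rel→fun φ)) ⇔ Sat M ρ (rel′ φ)
  rel→fun-⇔ (atom sub ts) = ⇔-sym (pr-⇔ M sub (λ i → term-≈ (ts i)))
  rel→fun-⇔ (atom (edge i) ts) = mk⇔
    (λ p → from edge-⇔ (≈.trans (term-≈ (ts 1F)) (≈.trans p (S-η (≈.sym (term-≈ (ts 0F)))))))
    (λ p → ≈.trans (≈.sym (term-≈ (ts 1F))) (≈.trans (to edge-⇔ p) (≈.sym (S-η (≈.sym (term-≈ (ts 0F)))))))
  rel→fun-⇔ (s ≐ t) = mk⇔
    (λ p → ≈.trans (term-≈ s) (≈.trans p (≈.sym (term-≈ t))))
    (λ p → ≈.trans (≈.sym (term-≈ s)) (≈.trans p (term-≈ t)))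
  rel→fun-⇔ ⊥′       = ⇔-id _
  rel→fun-⇔ (φ ∧′ ψ) = rel→fun-⇔ φ ×-⇔ rel→fun-⇔ ψ
  rel→fun-⇔ (φ ∨′ ψ) = rel→fun-⇔ φ ⊎-⇔ rel→fun-⇔ ψ
  rel→fun-⇔ (φ ⇒′ ψ) = →-cong-⇔ (rel→fun-⇔ φ) (rel→fun-⇔ ψ)
  rel→fun-⇔ (∀′ φ)   = ∀-⇔ λ _ → rel→fun-⇔ φ
  rel→fun-⇔ (∃′ φ)   = ∃-⇔ λ _ → rel→fun-⇔ φ

module _ (n : ℕ) where
  private
    module T = Structure (tree n)
    module R = Structure (tree-rel n)

  -- The common expansion of both trees, through which truth passes between the two languages.
  tree-common : Structure (ℒ-common n)
  tree-common = record
    { Carrier       = Node n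
    ; _≈_           = _≈ᴺ_
    ; ≈-equivalence = ≈ᴺ-isEquivalence
    ; func          = T.func
    ; pr            = R.pr
    ; func-cong     = T.func-cong
    ; pr-cong       = R.pr-cong
    }

  tree-common-graphs : ∀ χ → GraphAxioms χ → tree-common ⊨ χ
  tree-common-graphs _ (i , refl) y x = id , id

  tree-rel-common : IsReduct rel↪common (tree-rel n) tree-common
  tree-rel-common = record
    { image⟨_⟩ = id
    ; onto     = λ y → y , T.≈.refl {y}
    ; ≈-⇔      = ⇔-id _
    ; func-≈   = λ ()
    ; pr-⇔     = λ _ → ⇔-id _
    }

  tree-fun-common : IsReduct fun↪common (tree n) tree-common
  tree-fun-common = record
    { image⟨_⟩ = id
    ; onto     = λ y → y , T.≈.refl {y}
    ; ≈-⇔      = ⇔-id _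
    ; func-≈   = λ { (succ i) xs → T.≈.refl {append i (xs 0F)} }
    ; pr-⇔     = λ { sub → ⇔-id _ }
    }

  tree-rel→fun : ∀ φ → (tree n ⊨ rel→fun φ) ⇔ (tree-rel n ⊨ φ)
  tree-rel→fun φ = ⇔-sym (IsReduct.⊨-embed tree-rel-common φ) ⇔-∘
    (rel→fun-⇔ tree-common tree-common-graphs φ ⇔-∘ IsReduct.⊨-embed tree-fun-common (rel→fun φ))

  tree-fun→rel : ∀ φ → (tree-rel n ⊨ fun→rel φ) ⇔ (tree n ⊨ φ)
  tree-fun→rel φ = ⇔-sym (IsReduct.⊨-embed tree-fun-common φ) ⇔-∘
    (fun→rel-⇔ tree-common tree-common-graphs φ ⇔-∘ IsReduct.⊨-embed tree-rel-common (fun→rel φ))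

  -- The graph axioms make every sentence equivalent to its translation. Since the translations
  -- preserve truth in the trees, a model of one theory with the graph axioms is a model of the
  -- other.
  Th-definitionallyEquivalent : ∀ {ℓ} {T : Pred (Sentence (ℒ-rel n)) ℓ} → (∀ φ → T φ ⇔ (tree-rel n ⊨ φ)) →
                                DefinitionallyEquivalent T (Th (tree n))
  Th-definitionallyEquivalent T⇔ = record
    { admissible       = λ i M model → model _ (from (T⇔ (functional i)) λ x →
        append i x , T.≈.refl {append i x} , λ y e → e)
    ; sameConsequences = λ χ → mk⇔
        (λ entails M model → entails M λ where
          _ (inj₁ (φ , t , refl)) → to (rel→fun-⇔ M (λ χ g → model χ (inj₂ g)) φ)
            (model _ (inj₁ (rel→fun φ , from (tree-rel→fun φ) (to (T⇔ φ) t) , refl)))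
          _ (inj₂ g) → model _ (inj₂ g))
        (λ entails M model → entails M λ where
          _ (inj₁ (φ , t , refl)) → to (fun→rel-⇔ M (λ χ g → model χ (inj₂ g)) φ)
            (model _ (inj₁ (fun→rel φ , from (T⇔ _) (from (tree-fun→rel φ) t) , refl)))
          _ (inj₂ g) → model _ (inj₂ g))
    }

-- Every model is elementarily equivalent to the standard tree, which is a model itself. So the
-- consequences are the sentences true there, and excluded middle decides each of them.
theorem14 : (em : ∀ {ℓ} → ExcludedMiddle ℓ) →
    ∀ n → 2 ≤ n → (S : CharacteristicSystem n) →
    Complete (T¹ S) ×
    (∀ φ → (T¹ S ⊩ φ) ⇔ (tree-qe em S ⊨ φ)) ×
    (∀ φ → restrict rel↪qe (T¹ S) φ ⇔ (tree-rel n ⊨ φ)) ×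
    DefinitionallyEquivalent (restrict rel↪qe (T¹ S)) (Th (tree n))
theorem14 em n _ S =
  ((λ entails → entails (tree-qe em S) tree-qe-model) , decide) ,
  consequences , rel-consequences , Th-definitionallyEquivalent n rel-consequences
  where
  open StandardModel em S
  open ModelEquivalence em

  consequences : ∀ φ → (T¹ S ⊩ φ) ⇔ (tree-qe em S ⊨ φ)
  consequences φ = mk⇔ (λ entails → entails (tree-qe em S) tree-qe-model)
    (λ s M model → to (elementarily-equivalent tree-qe-model model φ) s)

  decide : ∀ φ → (T¹ S ⊩ φ) ⊎ (T¹ S ⊩ ¬′ φ)
  decide φ with em {P = tree-qe em S ⊨ φ}
  ... | yes s = inj₁ (from (consequences φ) s)
  ... | no ¬s = inj₂ (from (consequences (¬′ φ)) ¬s)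

  rel-consequences : ∀ φ → restrict rel↪qe (T¹ S) φ ⇔ (tree-rel n ⊨ φ)
  rel-consequences φ = ⇔-sym (IsReduct.⊨-embed tree-rel-isReduct φ) ⇔-∘ consequences (embed rel↪qe φ)
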